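{- There is an algorithm which, given an instance of \textsc{Min Stable Cut} with $n$ vertices, maximum weight $W$, maximum degree $\Delta$, and a tree decomposition of width $\mathrm{tw}$ of the input graph, finds an optimal solution in time $(\Delta\cdot W)^{O(\mathrm{tw})}n^{O(1)}$.
   Context: Let $G=(V,E)$ be a finite simple graph with edge weights $w:E\to\mathbb{N}$. The weighted degree of $v\in V$ is $d_w(v)=\sum_{uv\in E}w(uv)$. A cut is a partition of $V$ into $V_0,V_1$. It is stable for $v\in V_i$ ($i\in\{0,1\}$) if $\sum_{vu\in E,\,u\in V_{1-i}}w(vu)\ge d_w(v)/2$; it is stable if it is stable for all vertices. The weight of the cut is the sum of the weights of edges with one endpoint in $V_0$ and the other in $V_1$. \textsc{Min Stable Cut}: given $(G,w)$, find a stable cut of minimum weight. Maximum degree means the maximum unweighted degree (number of incident edges); maximum weight means $\max_{e\in E}w(e)$. -}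

module Defs where

open import Data.Nat.Properties using (+-0-commutativeMonoid)
open import Algebra.Properties.CommutativeMonoid.Sum +-0-commutativeMonoid using (sum)
open import Data.Bool.Base using (Bool; true; false; if_then_else_; not; _∧_; _xor_)
open import Data.Fin.Base using (Fin)
open import Data.Fin.Subset using (Subset; _∈_; ∣_∣)
import Data.List.Base as List
open List using (List; []; _∷_; length; tabulate)
import Data.List.Membership.Propositional as ListMem
open import Data.List.Relation.Unary.All using (All; []; _∷_)
import Data.List.Relation.Unary.All as All
open import Data.Maybe using (Maybe; just; nothing; fromMaybe; is-just; Is-just)
open import Data.Nat.Base using (ℕ; zero; suc; _+_; _*_; _∸_; _≤_; _⊔_)
open import Data.Product.Base using (∃-syntax; _×_)
import Data.Vec.Base as Vec
open import Data.Vec.Functional using (Vector)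
import Data.Vec.Functional as Vector
open import Relation.Binary.Construct.Closure.Equivalence using (EqClosure)
open import Relation.Binary.PropositionalEquality.Core using (_≡_)

maximum : ∀ {n} → Vector ℕ n → ℕ
maximum = Vector.foldr _⊔_ 0

------------------------------------------------------------------------
-- Weighted graphs and cuts

-- A finite simple graph on Fin n together with w : E → ℕ:
-- weight u v is nothing if uv is not an edge and just w(uv) if it is.

record WeightedGraph (n : ℕ) : Set where
  field
    weight      : Fin n → Fin n → Maybe ℕ
    symmetric   : ∀ u v → weight u v ≡ weight v u
    irreflexive : ∀ v → weight v v ≡ nothing

  Edge : Fin n → Fin n → Set
  Edge u v = Is-just (weight u v)

  -- Extends w by 0 to non-edges, so that sums and maxima over edges can
  -- range over all pairs of vertices.
  w : Fin n → Fin n → ℕ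
  w u v = fromMaybe 0 (weight u v)

  weightedDegree : Fin n → ℕ
  weightedDegree v = sum λ u → w v u

  degree : Fin n → ℕ
  degree v = sum λ u → if is-just (weight v u) then 1 else 0

  maxDegree : ℕ
  maxDegree = maximum degree

  maxWeight : ℕ
  maxWeight = maximum λ u → maximum λ v → w u v

-- v ∈ V₀ if C v is false, and v ∈ V₁ if C v is true.

Cut : ℕ → Set
Cut n = Fin n → Bool

module _ {n} (G : WeightedGraph n) where
  open WeightedGraph G

  cutDegree : Cut n → Fin n → ℕ
  cutDegree C v = sum λ u → if C v xor C u then w v u else 0

  StableFor : Cut n → Fin n → Set
  StableFor C v = weightedDegree v ≤ 2 * cutDegree C v

  Stable : Cut n → Set
  Stable C = ∀ v → StableFor C v

  -- Restricting to u ∈ V₀ and v ∈ V₁ counts every edge of the cut once.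
  cutWeight : Cut n → ℕ
  cutWeight C = sum λ u → sum λ v → if not (C u) ∧ C v then w u v else 0

  IsMinStableCut : Cut n → Set
  IsMinStableCut C = Stable C × (∀ D → Stable D → cutWeight C ≤ cutWeight D)

------------------------------------------------------------------------
-- Tree decompositions

-- Finite trees, presented with an arbitrary choice of root and of an
-- order on the children of each node.

data Tree (A : Set) : Set where
  node : A → List (Tree A) → Tree A

module _ {A : Set} where

  data Node : Tree A → Set where
    root  : ∀ {t} → Node t
    child : ∀ {a ts} (i : Fin (length ts)) →
            Node (List.lookup ts i) → Node (node a ts)

  label : ∀ {t} → Node t → A
  label {node a ts} root        = a
  label             (child i x) = label x

  data Parent : ∀ {t} → Node t → Node t → Set where
    here  : ∀ {a ts} {i : Fin (length ts)} →
            Parent {node a ts} root (child i root)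
    below : ∀ {a ts} {i : Fin (length ts)} {x y : Node (List.lookup ts i)} →
            Parent x y → Parent {node a ts} (child i x) (child i y)

  mutual
    labels : Tree A → List A
    labels (node a ts) = a ∷ forestLabels ts

    forestLabels : List (Tree A) → List A
    forestLabels []       = []
    forestLabels (t ∷ ts) = labels t List.++ forestLabels ts

  nodeCount : Tree A → ℕ
  nodeCount t = length (labels t)

record TreeDecomposition {n} (G : WeightedGraph n) : Set where
  open WeightedGraph G using (Edge)
  field
    tree : Tree (Subset n)

  bag : Node tree → Subset n
  bag = label

  -- The tree edges joining two nodes whose bags both contain v.
  Joins : Fin n → Node tree → Node tree → Set
  Joins v x y = Parent x y × v ∈ bag x × v ∈ bag y

  field
    vertexCovered : ∀ v → ∃[ x ] v ∈ bag x
    edgeCovered   : ∀ u v → Edge u v → ∃[ x ] (u ∈ bag x × v ∈ bag x)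
    connected     : ∀ v x y → v ∈ bag x → v ∈ bag y → EqClosure (Joins v) x y

  size : ℕ
  size = nodeCount tree

  width : ℕ
  width = List.foldr _⊔_ 0 (List.map ∣_∣ (labels tree)) ∸ 1

------------------------------------------------------------------------
-- Algorithms: a strict functional language with general recursion

infixr 5 _`⇒_
infixr 6 _`⊎_
infixr 7 _`×_

data Ty : Set where
  `⊤ `ℕ          : Ty
  _`×_ _`⊎_ _`⇒_ : Ty → Ty → Ty
  `List `Tree    : Ty → Ty

Ctx : Set
Ctx = List Ty

infix 4 _∋_ _⊢_

_∋_ : Ctx → Ty → Set
Γ ∋ A = A ListMem.∈ Γ

-- Numbers are only accessible through zero, suc and caseℕ, i.e. they are
-- unary; this is what makes unit cost per construct realistic.

data _⊢_ (Γ : Ctx) : Ty → Set where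
  var      : ∀ {A} → Γ ∋ A → Γ ⊢ A
  -- The function being defined is the second variable of its own body.
  fun      : ∀ {A B} → A ∷ (A `⇒ B) ∷ Γ ⊢ B → Γ ⊢ A `⇒ B
  app      : ∀ {A B} → Γ ⊢ A `⇒ B → Γ ⊢ A → Γ ⊢ B
  tt       : Γ ⊢ `⊤
  zero     : Γ ⊢ `ℕ
  suc      : Γ ⊢ `ℕ → Γ ⊢ `ℕ
  caseℕ    : ∀ {B} → Γ ⊢ `ℕ → Γ ⊢ B → `ℕ ∷ Γ ⊢ B → Γ ⊢ B
  pair     : ∀ {A B} → Γ ⊢ A → Γ ⊢ B → Γ ⊢ A `× B
  fst      : ∀ {A B} → Γ ⊢ A `× B → Γ ⊢ A
  snd      : ∀ {A B} → Γ ⊢ A `× B → Γ ⊢ B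
  inl      : ∀ {A B} → Γ ⊢ A → Γ ⊢ A `⊎ B
  inr      : ∀ {A B} → Γ ⊢ B → Γ ⊢ A `⊎ B
  case⊎    : ∀ {A B C} → Γ ⊢ A `⊎ B → A ∷ Γ ⊢ C → B ∷ Γ ⊢ C → Γ ⊢ C
  nil      : ∀ {A} → Γ ⊢ `List A
  cons     : ∀ {A} → Γ ⊢ A → Γ ⊢ `List A → Γ ⊢ `List A
  caseList : ∀ {A B} → Γ ⊢ `List A → Γ ⊢ B → A ∷ `List A ∷ Γ ⊢ B → Γ ⊢ B
  node     : ∀ {A} → Γ ⊢ A → Γ ⊢ `List (`Tree A) → Γ ⊢ `Tree A
  caseTree : ∀ {A B} → Γ ⊢ `Tree A → A ∷ `List (`Tree A) ∷ Γ ⊢ B → Γ ⊢ B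

-- Trees are built by their own constructor, rather than from Tree (Val A),
-- so that the list of children of a tree is itself a value.

data Val : Ty → Set where
  closure : ∀ {Γ A B} → All Val Γ → A ∷ (A `⇒ B) ∷ Γ ⊢ B → Val (A `⇒ B)
  tt      : Val `⊤
  nat     : ℕ → Val `ℕ
  pair    : ∀ {A B} → Val A → Val B → Val (A `× B)
  inl     : ∀ {A B} → Val A → Val (A `⊎ B)
  inr     : ∀ {A B} → Val B → Val (A `⊎ B)
  list    : ∀ {A} → List (Val A) → Val (`List A)
  node    : ∀ {A} → Val A → List (Val (`Tree A)) → Val (`Tree A)

Env : Ctx → Set
Env = All Val

-- ρ ⊢ e ⇓ v ∣ k: in the environment ρ, e evaluates to v in time k, where k
-- is the number of rules applied.  Values are shared, never copied, so on a
-- pointer machine each rule takes constant time for a fixed program.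

infix 3 _⊢_⇓_∣_

data _⊢_⇓_∣_ {Γ} (ρ : Env Γ) : ∀ {A} → Γ ⊢ A → Val A → ℕ → Set where

  var : ∀ {A} {x : Γ ∋ A} → ρ ⊢ var x ⇓ All.lookup ρ x ∣ 1

  fun : ∀ {A B} {e : A ∷ (A `⇒ B) ∷ Γ ⊢ B} → ρ ⊢ fun e ⇓ closure ρ e ∣ 1

  app : ∀ {Δ A B} {e : Γ ⊢ A `⇒ B} {e′ : Γ ⊢ A}
        {σ : Env Δ} {b : A ∷ (A `⇒ B) ∷ Δ ⊢ B} {v w i j k} →
        ρ ⊢ e ⇓ closure σ b ∣ i → ρ ⊢ e′ ⇓ v ∣ j →
        v ∷ closure σ b ∷ σ ⊢ b ⇓ w ∣ k →
        ρ ⊢ app e e′ ⇓ w ∣ 1 + i + j + k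

  tt : ρ ⊢ tt ⇓ tt ∣ 1

  zero : ρ ⊢ zero ⇓ nat 0 ∣ 1

  suc : ∀ {e m i} → ρ ⊢ e ⇓ nat m ∣ i → ρ ⊢ suc e ⇓ nat (suc m) ∣ 1 + i

  caseℕ-zero : ∀ {B e v i j} {e₀ : Γ ⊢ B} {e₁ : `ℕ ∷ Γ ⊢ B} →
    ρ ⊢ e ⇓ nat 0 ∣ i → ρ ⊢ e₀ ⇓ v ∣ j →
    ρ ⊢ caseℕ e e₀ e₁ ⇓ v ∣ 1 + i + j

  caseℕ-suc : ∀ {B e m v i j} {e₀ : Γ ⊢ B} {e₁ : `ℕ ∷ Γ ⊢ B} →
    ρ ⊢ e ⇓ nat (suc m) ∣ i → nat m ∷ ρ ⊢ e₁ ⇓ v ∣ j →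
    ρ ⊢ caseℕ e e₀ e₁ ⇓ v ∣ 1 + i + j

  pair : ∀ {A B} {e : Γ ⊢ A} {e′ : Γ ⊢ B} {v v′ i j} →
    ρ ⊢ e ⇓ v ∣ i → ρ ⊢ e′ ⇓ v′ ∣ j →
    ρ ⊢ pair e e′ ⇓ pair v v′ ∣ 1 + i + j

  fst : ∀ {A B} {e : Γ ⊢ A `× B} {v v′ i} →
    ρ ⊢ e ⇓ pair v v′ ∣ i → ρ ⊢ fst e ⇓ v ∣ 1 + i

  snd : ∀ {A B} {e : Γ ⊢ A `× B} {v v′ i} →
    ρ ⊢ e ⇓ pair v v′ ∣ i → ρ ⊢ snd e ⇓ v′ ∣ 1 + i

  inl : ∀ {A B} {e : Γ ⊢ A} {v i} →
    ρ ⊢ e ⇓ v ∣ i → ρ ⊢ inl {B = B} e ⇓ inl v ∣ 1 + i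

  inr : ∀ {A B} {e : Γ ⊢ B} {v i} →
    ρ ⊢ e ⇓ v ∣ i → ρ ⊢ inr {A = A} e ⇓ inr v ∣ 1 + i

  case⊎-inl : ∀ {A B C} {e : Γ ⊢ A `⊎ B} {v w i j}
    {e₁ : A ∷ Γ ⊢ C} {e₂ : B ∷ Γ ⊢ C} →
    ρ ⊢ e ⇓ inl v ∣ i → v ∷ ρ ⊢ e₁ ⇓ w ∣ j →
    ρ ⊢ case⊎ e e₁ e₂ ⇓ w ∣ 1 + i + j

  case⊎-inr : ∀ {A B C} {e : Γ ⊢ A `⊎ B} {v w i j}
    {e₁ : A ∷ Γ ⊢ C} {e₂ : B ∷ Γ ⊢ C} →
    ρ ⊢ e ⇓ inr v ∣ i → v ∷ ρ ⊢ e₂ ⇓ w ∣ j →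
    ρ ⊢ case⊎ e e₁ e₂ ⇓ w ∣ 1 + i + j

  nil : ∀ {A} → ρ ⊢ nil {A = A} ⇓ list [] ∣ 1

  cons : ∀ {A} {e : Γ ⊢ A} {e′ : Γ ⊢ `List A} {v vs i j} →
    ρ ⊢ e ⇓ v ∣ i → ρ ⊢ e′ ⇓ list vs ∣ j →
    ρ ⊢ cons e e′ ⇓ list (v ∷ vs) ∣ 1 + i + j

  caseList-nil : ∀ {A B} {e : Γ ⊢ `List A} {w i j}
    {e₀ : Γ ⊢ B} {e₁ : A ∷ `List A ∷ Γ ⊢ B} →
    ρ ⊢ e ⇓ list [] ∣ i → ρ ⊢ e₀ ⇓ w ∣ j →
    ρ ⊢ caseList e e₀ e₁ ⇓ w ∣ 1 + i + j

  caseList-cons : ∀ {A B} {e : Γ ⊢ `List A} {v vs w i j}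
    {e₀ : Γ ⊢ B} {e₁ : A ∷ `List A ∷ Γ ⊢ B} →
    ρ ⊢ e ⇓ list (v ∷ vs) ∣ i → v ∷ list vs ∷ ρ ⊢ e₁ ⇓ w ∣ j →
    ρ ⊢ caseList e e₀ e₁ ⇓ w ∣ 1 + i + j

  node : ∀ {A} {e : Γ ⊢ A} {e′ : Γ ⊢ `List (`Tree A)} {v vs i j} →
    ρ ⊢ e ⇓ v ∣ i → ρ ⊢ e′ ⇓ list vs ∣ j →
    ρ ⊢ node e e′ ⇓ node v vs ∣ 1 + i + j

  caseTree : ∀ {A B} {e : Γ ⊢ `Tree A} {v vs w i j}
    {e₁ : A ∷ `List (`Tree A) ∷ Γ ⊢ B} →
    ρ ⊢ e ⇓ node v vs ∣ i → v ∷ list vs ∷ ρ ⊢ e₁ ⇓ w ∣ j →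
    ρ ⊢ caseTree e e₁ ⇓ w ∣ 1 + i + j

Program : Ty → Ty → Set
Program A B = A ∷ [] ⊢ B

_on_returns_inTime_ : ∀ {A B} → Program A B → Val A → Val B → ℕ → Set
p on input returns output inTime k = input ∷ [] ⊢ p ⇓ output ∣ k

------------------------------------------------------------------------
-- Encoding of instances and solutions

`Bool : Ty
`Bool = `⊤ `⊎ `⊤

`Maybe : Ty → Ty
`Maybe A = `⊤ `⊎ A

encodeBool : Bool → Val `Bool
encodeBool false = inl tt
encodeBool true  = inr tt

encodeMaybe : Maybe ℕ → Val (`Maybe `ℕ)
encodeMaybe nothing  = inl tt
encodeMaybe (just m) = inr (nat m)

encodeSubset : ∀ {n} → Subset n → Val (`List `Bool)
encodeSubset s = list (List.map encodeBool (Vec.toList s))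

mutual
  encodeTree : ∀ {n} → Tree (Subset n) → Val (`Tree (`List `Bool))
  encodeTree (node s ts) = node (encodeSubset s) (encodeForest ts)

  encodeForest : ∀ {n} → List (Tree (Subset n)) → List (Val (`Tree (`List `Bool)))
  encodeForest []       = []
  encodeForest (t ∷ ts) = encodeTree t ∷ encodeForest ts

-- The weighted adjacency matrix and the tree of bags.

`Instance : Ty
`Instance = `List (`List (`Maybe `ℕ)) `× `Tree (`List `Bool)

encodeInstance : ∀ {n} (G : WeightedGraph n) → TreeDecomposition G → Val `Instance
encodeInstance G D = pair
  (list (tabulate λ u → list (tabulate λ v → encodeMaybe (weight u v))))
  (encodeTree tree)
  where
  open WeightedGraph G using (weight)
  open TreeDecomposition D using (tree)

`Cut : Ty
`Cut = `List `Bool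

encodeCut : ∀ {n} → Cut n → Val `Cut
encodeCut C = list (tabulate λ v → encodeBool (C v))

{-# OPTIONS --safe #-}

-- A partial cut P colours the vertices seen so far.  At a node of the
-- decomposition with bag σ its key consists of the colours and cut degrees
-- of the vertices of σ; a table keeps one lightest partial cut per key, among
-- those in which every coloured vertex outside σ is already stable.  This is
-- an exchange argument: if D and E are separated by D ∩ E ⊆ σ ∩ τ, then for
-- every X coloured on D ∪ E and every vertex v
--     deg X v + deg (X on D ∩ E) v = deg (X on D) v + deg (X on E) v,
-- so replacing both halves by lighter ones with the same keys keeps the key
-- and does not increase the weight.  Cut degrees are at most ΔW, hence there
-- are at most (3 + 2ΔW)^(tw + 1) keys, which is (ΔW)^O(tw) if ΔW ≥ 2 (and
-- then tw ≥ 1).  If ΔW ≤ 1 the time must be polynomial although a bag can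
-- have exponentially many colourings; but if all weighted degrees are at most
-- 1 the edges of positive weight form a matching, and cutting all of them is
-- optimal.  The tables are not empty because flipping an unstable vertex
-- increases the weight of a cut, so a stable cut exists.
module Submission where

open import Data.Bool.Base using (Bool; true; false; if_then_else_; not; _∧_; _∨_; _xor_)
open import Data.Bool.Properties using (T-≡; ∨-assoc; ∨-zeroʳ; ∨-identityʳ; xor-comm; xor-same)
open import Data.Fin.Base using (Fin; zero; suc; fromℕ<)
open import Data.Fin.Properties using (injective⇒≤; fromℕ<-injective; any?) renaming (_≟_ to _≟ᶠ_)
open import Data.Fin.Subset using (Subset; ∣_∣) renaming (_∈_ to _∈ₛ_)
open import Data.Fin.Subset.Properties using (x∈p⇒∣p-x∣<∣p∣; x∈p∧x≢y⇒x∈p-y)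
open import Data.List.Base as List using (List; []; _∷_; length; tabulate)
open import Data.List.Membership.Propositional using (_∈_)
open import Data.List.Membership.Propositional.Properties using (∈-lookup)
open import Data.List.Properties using (length-tabulate; length-map; length-++; map-tabulate; ++-identityʳ)
open import Data.List.Relation.Unary.All as All using (All; []; _∷_)
open import Data.List.Relation.Unary.All.Properties using (++⁻)
open import Data.List.Relation.Unary.AllPairs using (AllPairs; []; _∷_)
open import Data.List.Relation.Unary.Any using (here; there)
open import Data.Maybe using (Maybe; just; nothing; fromMaybe; is-just; Is-just; _<∣>_)
open import Data.Maybe.Relation.Unary.Any using (just)
open import Data.Nat.Base using (ℕ; zero; suc; NonZero; _+_; _*_; _^_; _∸_; _⊔_; _≤_; _<_; _≤ᵇ_; z≤n; s≤s; s≤s⁻¹; >-nonZero; _%_)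
open import Data.Nat.DivMod using (m<n⇒m%n≡m; [m+kn]%n≡m%n)
open import Data.Nat.Properties
open import Data.Nat.Solver using (module +-*-Solver)
open import Algebra.Properties.CommutativeMonoid.Sum +-0-commutativeMonoid using (sum; sum-cong-≗; ∑-distrib-+; ∑-comm; sum-replicate-zero)
open import Data.Product.Base using (Σ-syntax; _×_; _,_; proj₁; proj₂)
open import Data.Sum.Base as Sum using (_⊎_; inj₁; inj₂; [_,_]′)
open import Data.Unit.Base using (⊤; tt)
import Data.Vec.Base as Vec
import Data.Vec.Functional as Vector
open import Data.Vec.Properties using ([]=⇒lookup; lookup⇒[]=)
open import Function.Base using (_∘_; id)
open import Function.Bundles using (Equivalence)
open import Relation.Binary.Construct.Closure.Equivalence as EqClosure using (EqClosure)
open import Relation.Binary.PropositionalEquality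
open import Relation.Binary.Structures using (IsEquivalence)
open import Relation.Nullary using (¬_; contradiction; yes; no; does)
open import Relation.Nullary.Decidable using (True; toWitness)
open import Defs

-- The tree is used as given, without introduce and forget nodes: one join per tree edge does all
-- the work. A child starts from all colourings of its own bag, absorbs its children and is then
-- joined into its parent. A vertex of the child's bag that the parent's bag lacks is forgotten by
-- that join, because its stability is tested there. An extra root with empty bag is joined with the
-- whole tree at the end, so that every vertex has been tested, all keys coincide and a single cut
-- remains. Tables hold whole partial cuts, whose degrees and weights are recomputed from the matrix
-- whenever two of them are compared. This costs a polynomial factor, but it spares both
-- backtracking and invariants about stored numbers. Tables are scanned linearly, so the time is a
-- fixed power of their length; this is harmless because a fixed power of (ΔW)^O(tw) has the same
-- form. The number N of tree nodes enters the polynomial factor next to n, since a decomposition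
-- may have more nodes than the graph has vertices.

v0 : ∀ {Γ A} → A ∷ Γ ⊢ A
v0 = var (here refl)

v1 : ∀ {Γ A B} → B ∷ A ∷ Γ ⊢ A
v1 = var (there (here refl))

v2 : ∀ {Γ A B C} → C ∷ B ∷ A ∷ Γ ⊢ A
v2 = var (there (there (here refl)))

v3 : ∀ {Γ A B C D} → D ∷ C ∷ B ∷ A ∷ Γ ⊢ A
v3 = var (there (there (there (here refl))))

v4 : ∀ {Γ A B C D E} → E ∷ D ∷ C ∷ B ∷ A ∷ Γ ⊢ A
v4 = var (there (there (there (there (here refl)))))

v5 : ∀ {Γ A B C D E F} → F ∷ E ∷ D ∷ C ∷ B ∷ A ∷ Γ ⊢ A
v5 = var (there (there (there (there (there (here refl))))))

v6 : ∀ {Γ A B C D E F G} → G ∷ F ∷ E ∷ D ∷ C ∷ B ∷ A ∷ Γ ⊢ A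
v6 = var (there (there (there (there (there (there (here refl)))))))

v7 : ∀ {Γ A B C D E F G H} → H ∷ G ∷ F ∷ E ∷ D ∷ C ∷ B ∷ A ∷ Γ ⊢ A
v7 = var (there (there (there (there (there (there (there (here refl))))))))

v8 : ∀ {Γ A B C D E F G H I} → I ∷ H ∷ G ∷ F ∷ E ∷ D ∷ C ∷ B ∷ A ∷ Γ ⊢ A
v8 = var (there (there (there (there (there (there (there (there (here refl)))))))))

-- Bodies of recursive functions that use no variable of the context Γ.
Fn : Ty → Ty → Set
Fn A B = ∀ {Γ} → A ∷ (A `⇒ B) ∷ Γ ⊢ B

call : ∀ {Γ A B} → Fn A B → Γ ⊢ A → Γ ⊢ B
call f e = app (fun f) e

-- Each branch binds the unit payload of the Boolean, so every variable index goes up by one inside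
-- a branch.
ifE : ∀ {Γ A} → Γ ⊢ `Bool → `⊤ ∷ Γ ⊢ A → `⊤ ∷ Γ ⊢ A → Γ ⊢ A
ifE c t e = case⊎ c e t

trueE falseE : ∀ {Γ} → Γ ⊢ `Bool
trueE  = inr tt
falseE = inl tt

foldFn : ∀ {Γ A R} → `List A ∷ (`List A `⇒ R) ∷ Γ ⊢ R →
         R ∷ (R `⇒ R) ∷ A ∷ `List A ∷ `List A ∷ (`List A `⇒ R) ∷ Γ ⊢ R →
         `List A ∷ (`List A `⇒ R) ∷ Γ ⊢ R
foldFn z b = caseList v0 z (app (fun b) (app v3 v1))

-- A right fold whose step b also sees the remaining list: 0 is the
-- accumulator, 2 the head and 3 the tail.
foldE : ∀ {Γ A R} → Γ ⊢ `List A → `List A ∷ (`List A `⇒ R) ∷ Γ ⊢ R →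
        R ∷ (R `⇒ R) ∷ A ∷ `List A ∷ `List A ∷ (`List A `⇒ R) ∷ Γ ⊢ R →
        Γ ⊢ R
foldE xs z b = app (fun (foldFn z b)) xs

vec : ∀ {A n} → (Fin n → Val A) → Val (`List A)
vec f = list (tabulate f)

-- The program

-- A profile lists for each vertex its colour, its cut degree and whether it is stable, so that
-- `totalF`, `settledF` and `keyF` are single folds over it.
`Row `Color `Colors `Table `Bag `Matrix `Profile : Ty
`Row     = `List (`Maybe `ℕ)
`Matrix  = `List `Row
`Color   = `Maybe `Bool
`Colors  = `List `Color
`Table   = `List `Colors
`Bag     = `List `Bool
`Profile = `List (`Color `× `ℕ `× `Bool)

Step : Ty → Ty → Ctx → Set
Step A R Γ = R ∷ (R `⇒ R) ∷ A ∷ `List A ∷ `List A ∷ (`List A `⇒ R) ∷ Γ ⊢ R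

addF : Fn (`ℕ `× `ℕ) `ℕ
addF = caseℕ (fst v0) (snd v0) (suc (app v2 (pair v0 (snd v1))))

leqF : Fn (`ℕ `× `ℕ) `Bool
leqF = caseℕ (fst v0) trueE (caseℕ (snd v1) falseE (app v3 (pair v1 v0)))

zipF : ∀ {A C} → Fn (`List A `× `List C) (`List (A `× C))
zipF = caseList (fst v0) nil (caseList (snd v2) nil (cons (pair v2 v0) (app v5 (pair v3 v1))))

degreeStep : ∀ {Γ} → Step (`Maybe `ℕ) `ℕ Γ
degreeStep = call addF (pair (case⊎ v2 zero v0) v0)

degreeF : Fn `Row `ℕ
degreeF = foldE v0 zero degreeStep

entryF : Fn (`Color `× `Maybe `ℕ `× `Color) `ℕ
entryF = case⊎ (fst (snd v0)) zero (case⊎ (fst v1) zero (case⊎ (snd (snd v2)) zero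
           (ifE v1 (ifE v1 zero v4) (ifE v1 v4 zero))))

cutDegreeStep : ∀ {Γ} → Step (`Maybe `ℕ `× `Color) `ℕ (`Color `× `Row `× `Colors ∷ Γ)
cutDegreeStep = call addF (pair (call entryF (pair (fst v6) v2)) v0)

cutDegreeF : Fn (`Color `× `Row `× `Colors) `ℕ
cutDegreeF = foldE (call zipF (snd v0)) zero cutDegreeStep

profileStep : ∀ {Γ} → Step (`Row `× `Color) `Profile (`Matrix `× `Colors ∷ Γ)
profileStep = cons (pair (snd v2) (pair deg (call leqF (pair (call degreeF (fst v2)) (call addF (pair deg deg)))))) v0
  where
  deg : ∀ {Γ A C D E F} → A ∷ C ∷ `Row `× `Color ∷ D ∷ E ∷ F ∷ `Matrix `× `Colors ∷ Γ ⊢ `ℕ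
  deg = call cutDegreeF (pair (snd v2) (pair (fst v2) (snd v6)))

profileF : Fn (`Matrix `× `Colors) `Profile
profileF = foldE (call zipF v0) nil profileStep

totalStep : ∀ {Γ} → Step (`Color `× `ℕ `× `Bool) `ℕ Γ
totalStep = call addF (pair (fst (snd v2)) v0)

totalF : Fn `Profile `ℕ
totalF = foldE v0 zero totalStep

settledStep : ∀ {Γ} → Step (`Bool `× `Color `× `ℕ `× `Bool) `Bool Γ
settledStep = ifE (fst v2) v1 (case⊎ (fst (snd v3)) v2 (ifE (snd (snd (snd v4))) v3 falseE))

settledF : Fn (`Bag `× `Profile) `Bool
settledF = foldE (call zipF v0) trueE settledStep

keyStep : ∀ {Γ} → Step (`Bool `× `Color `× `ℕ `× `Bool) (`List `ℕ) Γ
keyStep = cons (ifE (fst v2) (case⊎ (fst (snd v3)) zero (ifE v0 (suc (suc double)) (suc double))) zero) v0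
  where
  double : ∀ {Γ A C D E F} → A ∷ C ∷ D ∷ E ∷ F ∷ `Bool `× `Color `× `ℕ `× `Bool ∷ Γ ⊢ `ℕ
  double = call addF (pair (fst (snd (snd v5))) (fst (snd (snd v5))))

keyF : Fn (`Bag `× `Profile) (`List `ℕ)
keyF = foldE (call zipF v0) nil keyStep

equalStep : ∀ {Γ} → Step (`ℕ `× `ℕ) `Bool Γ
equalStep = ifE (call leqF v2) (ifE (call leqF (pair (snd v3) (fst v3))) v2 falseE) falseE

equalF : Fn (`List `ℕ `× `List `ℕ) `Bool
equalF = foldE (call zipF v0) trueE equalStep

mergeStep : ∀ {Γ} → Step (`Color `× `Color) `Colors Γ
mergeStep = cons (case⊎ (fst v2) (snd v3) (inr v0)) v0

mergeF : Fn (`Colors `× `Colors) `Colors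
mergeF = foldE (call zipF v0) nil mergeStep

compatibleStep : ∀ {Γ} → Step (`Color `× `Color) `Bool Γ
compatibleStep = case⊎ (fst v2) v1 (case⊎ (snd v3) v2 (ifE v1 (ifE v1 v4 falseE) (ifE v1 falseE v4)))

compatibleF : Fn (`Colors `× `Colors) `Bool
compatibleF = foldE (call zipF v0) trueE compatibleStep

keyE : ∀ {Γ A} → Γ ⊢ `Matrix `× `Bag `× A → Γ ⊢ `Colors → Γ ⊢ `List `ℕ
keyE a p = call keyF (pair (fst (snd a)) (call profileF (pair (fst a) p)))

totalE : ∀ {Γ A} → Γ ⊢ `Matrix `× `Bag `× A → Γ ⊢ `Colors → Γ ⊢ `ℕ
totalE a p = call totalF (call profileF (pair (fst a) p))

insertStep : ∀ {Γ A} → Step `Colors `Table (`Matrix `× `Bag `× `Colors `× A ∷ Γ)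
insertStep = ifE (call equalF (pair (keyE v6 (fst (snd (snd v6)))) (keyE v6 v2)))
  (ifE (call leqF (pair (totalE v7 (fst (snd (snd v7)))) (totalE v7 v3)))
    (cons (fst (snd (snd v8))) v5)
    (cons v4 v5))
  (cons v3 v1)

insertF : Fn (`Matrix `× `Bag `× `Colors `× `Table) `Table
insertF = foldE (snd (snd (snd v0))) (cons (fst (snd (snd v2))) nil) insertStep

mergeIntoStep : ∀ {Γ A} → Step `Colors `Table (`Matrix `× `Bag `× `Colors `× A ∷ Γ)
mergeIntoStep = ifE (call compatibleF (pair (fst (snd (snd v6))) v2))
  (ifE (call settledF (pair (fst (snd v7)) (call profileF (pair (fst v7) (call mergeF (pair (fst (snd (snd v7))) v3))))))
    (call insertF (pair (fst v8) (pair (fst (snd v8)) (pair (call mergeF (pair (fst (snd (snd v8))) v4)) v2))))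
    v2)
  v1

mergeIntoF : Fn (`Matrix `× `Bag `× `Colors `× `Table `× `Table) `Table
mergeIntoF = foldE (snd (snd (snd (snd v0)))) (fst (snd (snd (snd v2)))) mergeIntoStep

joinStep : ∀ {Γ} → Step `Colors `Table (`Matrix `× `Bag `× `Table `× `Table ∷ Γ)
joinStep = call mergeIntoF (pair (fst v6) (pair (fst (snd v6)) (pair v2 (pair v0 (snd (snd (snd v6)))))))

joinF : Fn (`Matrix `× `Bag `× `Table `× `Table) `Table
joinF = foldE (fst (snd (snd v0))) nil joinStep

freeStep fixedStep : ∀ {Γ} → Step `Colors `Table Γ
freeStep  = cons (cons (inr falseE) v2) (cons (cons (inr trueE) v2) v0)
fixedStep = cons (cons (inl tt) v2) v0

initialStep : ∀ {Γ} → Step `Bool `Table Γ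
initialStep = ifE v2 (foldE v1 nil freeStep) (foldE v1 nil fixedStep)

initialF : Fn `Bag `Table
initialF = foldE v0 (cons nil nil) initialStep

-- The language has no mutual recursion, so trees are solved by the forest function: a node is the
-- forest of its children, started from its own bag and all colourings of that bag. One call
-- descends into a child and another continues with its siblings.
solveF : Fn (`Matrix `× `Bag `× `Table `× `List (`Tree `Bag)) `Table
solveF = caseList (snd (snd (snd v0))) (fst (snd (snd v0))) (caseTree v0
  (app v5 (pair (fst v4) (pair (fst (snd v4)) (pair
    (call joinF (pair (fst v4) (pair (fst (snd v4)) (pair (fst (snd (snd v4)))
      (app v5 (pair (fst v4) (pair v0 (pair (call initialF v0) v1))))))))
    v3)))))

leftsStep : ∀ {Γ A C} → Step A (`List (`⊤ `⊎ C)) Γ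
leftsStep = cons (inl tt) v0

-- Applied to the matrix only for its length: n copies of `inl tt` encode the empty bag as well as
-- the partial cut that colours nothing, which are the data of the extra root.
leftsF : ∀ {A C} → Fn (`List A) (`List (`⊤ `⊎ C))
leftsF = foldE v0 nil leftsStep

cutStep : ∀ {Γ} → Step `Color `Cut Γ
cutStep = cons (case⊎ v2 falseE v0) v0

firstF : Fn `Table `Cut
firstF = caseList v0 nil (foldE v0 nil cutStep)

smallStep : ∀ {Γ} → Step `Row `Bool Γ
smallStep = ifE (call leqF (pair (call degreeF v2) (suc zero))) v1 falseE

smallF : Fn `Matrix `Bool
smallF = foldE v0 trueE smallStep

tailsStep : ∀ {Γ A} → Step (`List A) (`List (`List A)) Γ
tailsStep = cons (caseList v2 nil v1) v0

tailsF : ∀ {A} → Fn (`List (`List A)) (`List (`List A))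
tailsF = foldE v0 nil tailsStep

greedyF : Fn `Matrix `Cut
greedyF = caseList v0 nil (cons (caseℕ (call degreeF v0) falseE trueE) (app v3 (call tailsF v1)))

minStableCut : Program `Instance `Cut
minStableCut = ifE (call smallF (fst v0))
  (call greedyF (fst v1))
  (call firstF (call solveF (pair (fst v1) (pair (call leftsF (fst v1))
    (pair (cons (call leftsF (fst v1)) nil) (cons (snd v1) nil))))))

-- The functions computed by the program

Row Partial Indicator : ℕ → Set
Row n       = Fin n → Maybe ℕ
Partial n   = Fin n → Maybe Bool
Indicator n = Fin n → Bool

Matrix : ℕ → Set
Matrix n = Fin n → Row n

differ : Maybe Bool → Maybe Bool → Bool
differ (just a) (just b) = a xor b
differ _        _        = false

allᵇ : ∀ {n} → (Fin n → Bool) → Bool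
allᵇ {zero}  f = true
allᵇ {suc n} f = f zero ∧ allᵇ (f ∘ suc)

rowDegree : ∀ {n} → Row n → ℕ
rowDegree r = sum λ u → fromMaybe 0 (r u)

crossing : Maybe Bool → Maybe ℕ → Maybe Bool → ℕ
crossing p r q = if differ p q then fromMaybe 0 r else 0

-- Faithful because uncoloured vertices have cut degree 0.
keyEntry : Bool → Maybe Bool → ℕ → ℕ
keyEntry true (just true)  d = suc (suc (d + d))
keyEntry true (just false) d = suc (d + d)
keyEntry _    _            d = 0

equalᵇ : ∀ {n} → (Fin n → ℕ) → (Fin n → ℕ) → Bool
equalᵇ f g = allᵇ λ v → (f v ≤ᵇ g v) ∧ (g v ≤ᵇ f v)

merge : ∀ {n} → Partial n → Partial n → Partial n
merge P Q v = P v <∣> Q v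

compatible : ∀ {n} → Partial n → Partial n → Bool
compatible P Q = allᵇ λ v → not (differ (P v) (Q v))

extend : ∀ {n} → Bool → List (Partial n) → List (Partial (suc n))
extend b     []      = []
extend true  (P ∷ A) = (just false Vector.∷ P) ∷ (just true Vector.∷ P) ∷ extend true A
extend false (P ∷ A) = (nothing Vector.∷ P) ∷ extend false A

initial : ∀ {n} → Indicator n → List (Partial n)
initial {zero}  σ = Vector.[] ∷ []
initial {suc n} σ = extend (σ zero) (initial (σ ∘ suc))

-- In a matching, the end of an edge with the smaller index still sees its partner among the
-- remaining vertices and gets `true`; the other end sees nobody and gets `false`.
greedy : ∀ {n} → Matrix n → Indicator n
greedy {zero}  M = Vector.[]
greedy {suc n} M = (1 ≤ᵇ rowDegree (M zero)) Vector.∷ greedy (λ u v → M (suc u) (suc v))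

allSmall : ∀ {n} → Matrix n → Bool
allSmall M = allᵇ λ v → rowDegree (M v) ≤ᵇ 1

module _ {n} (M : Matrix n) where

  cutDeg : Partial n → Fin n → ℕ
  cutDeg P v = sum λ u → crossing (P v) (M v u) (P u)

  stableᵇ : Partial n → Fin n → Bool
  stableᵇ P v = rowDegree (M v) ≤ᵇ cutDeg P v + cutDeg P v

  -- Counts every edge of the cut twice.
  total : Partial n → ℕ
  total P = sum (cutDeg P)

  settledᵇ : Indicator n → Partial n → Bool
  settledᵇ σ P = allᵇ λ v → σ v ∨ (not (is-just (P v)) ∨ stableᵇ P v)

  key : Indicator n → Partial n → Fin n → ℕ
  key σ P v = keyEntry (σ v) (P v) (cutDeg P v)

  module _ (σ : Indicator n) where

    insert : Partial n → List (Partial n) → List (Partial n)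
    insert P []      = P ∷ []
    insert P (Q ∷ A) =
      if equalᵇ (key σ P) (key σ Q)
      then (if total P ≤ᵇ total Q then P ∷ A else Q ∷ A)
      else Q ∷ insert P A

    mergeInto : Partial n → List (Partial n) → List (Partial n) → List (Partial n)
    mergeInto P A []      = A
    mergeInto P A (Q ∷ R) =
      if compatible P Q
      then (if settledᵇ σ (merge P Q) then insert (merge P Q) (mergeInto P A R) else mergeInto P A R)
      else mergeInto P A R

    join : List (Partial n) → List (Partial n) → List (Partial n)
    join []      R = []
    join (P ∷ A) R = mergeInto P (join A R) R

  solveForest : Indicator n → List (Partial n) → List (Tree (Subset n)) → List (Partial n)
  solveForest σ A []               = A
  solveForest σ A (node s us ∷ ts) =
    solveForest σ (join σ A (solveForest (Vec.lookup s) (initial (Vec.lookup s)) us)) ts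

-- Running times

encodeColor : Maybe Bool → Val `Color
encodeColor nothing  = inl tt
encodeColor (just b) = inr (encodeBool b)

encodeRow : ∀ {n} → Row n → Val `Row
encodeRow r = vec (encodeMaybe ∘ r)

encodeMatrix : ∀ {n} → Matrix n → Val `Matrix
encodeMatrix M = vec (encodeRow ∘ M)

encodeBag : ∀ {n} → Indicator n → Val `Bag
encodeBag σ = vec (encodeBool ∘ σ)

encodePartial : ∀ {n} → Partial n → Val `Colors
encodePartial P = vec (encodeColor ∘ P)

encodeTable : ∀ {n} → List (Partial n) → Val `Table
encodeTable A = list (List.map encodePartial A)

encodeProfile : ∀ {n} → Partial n → (Fin n → ℕ) → Indicator n → Val `Profile
encodeProfile P d st = vec λ v → pair (encodeColor (P v)) (pair (nat (d v)) (encodeBool (st v)))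

term≤sum : ∀ {n} (f : Fin n → ℕ) u → f u ≤ sum f
term≤sum f zero    = m≤m+n _ _
term≤sum f (suc u) = ≤-trans (term≤sum (f ∘ suc) u) (m≤n+m _ _)

sum-mono : ∀ {n} {f g : Fin n → ℕ} → (∀ u → f u ≤ g u) → sum f ≤ sum g
sum-mono {zero}  f≤g = z≤n
sum-mono {suc n} f≤g = +-mono-≤ (f≤g zero) (sum-mono (f≤g ∘ suc))

crossing≤ : ∀ p r q → crossing p r q ≤ fromMaybe 0 r
crossing≤ p r q with differ p q
... | true  = ≤-refl
... | false = z≤n

cutDeg≤rowDegree : ∀ {n} (M : Matrix n) P v → cutDeg M P v ≤ rowDegree (M v)
cutDeg≤rowDegree M P v = sum-mono λ u → crossing≤ (P v) (M v u) (P u)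

-- Makes a bound on the finished initial table valid for all tables built on the way to it.
length-extend : ∀ {n} b (A : List (Partial n)) → length A ≤ length (extend b A)
length-extend b     []      = z≤n
length-extend true  (P ∷ A) = m≤n⇒m≤1+n (s≤s (length-extend true A))
length-extend false (P ∷ A) = s≤s (length-extend false A)

forestSize : ∀ {n} → List (Tree (Subset n)) → ℕ
forestSize ts = length (forestLabels ts)

encodeSubset≡ : ∀ {n} (s : Subset n) → encodeSubset s ≡ encodeBag (Vec.lookup s)
encodeSubset≡ s = cong list (go s)
  where
  go : ∀ {n} (s : Subset n) → List.map encodeBool (Vec.toList s) ≡ tabulate (encodeBool ∘ Vec.lookup s)
  go Vec.[]      = refl
  go (b Vec.∷ s) = cong (encodeBool b ∷_) (go s)

Everyᶠ : ∀ {n} → (Indicator n → Set) → List (Tree (Subset n)) → Set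
Everyᶠ X []               = ⊤
Everyᶠ X (node s us ∷ ts) = X (Vec.lookup s) × Everyᶠ X us × Everyᶠ X ts

forestSize-∷ : ∀ {n} (s : Subset n) us ts → forestSize (node s us ∷ ts) ≡ suc (forestSize us + forestSize ts)
forestSize-∷ s us ts = cong suc (length-++ (forestLabels us))

-- Time of `solveF` in units of `B ^ 16`. A forest with k nodes causes k calls on nonempty and k + 1
-- calls on empty forests, each charged 100.
forestTime : ∀ {n} → List (Tree (Subset n)) → ℕ
forestTime []               = 100
forestTime (node s us ∷ ts) = 100 + (forestTime us + forestTime ts)

forestTime≡ : ∀ {n} (ts : List (Tree (Subset n))) → forestTime ts ≡ 100 + 200 * forestSize ts
forestTime≡ []               = refl
forestTime≡ (node s us ∷ ts) = begin
  100 + (forestTime us + forestTime ts)                 ≡⟨ cong₂ (λ x y → 100 + (x + y)) (forestTime≡ us) (forestTime≡ ts) ⟩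
  100 + (100 + 200 * a + (100 + 200 * b))               ≡⟨ solve 2 (λ a b → con 100 :+ (con 100 :+ con 200 :* a :+ (con 100 :+ con 200 :* b))
                                                             := con 100 :+ con 200 :* (con 1 :+ (a :+ b))) refl a b ⟩
  100 + 200 * suc (a + b)                               ≡⟨ cong (λ x → 100 + 200 * x) (sym (forestSize-∷ s us ts)) ⟩
  100 + 200 * forestSize (node s us ∷ ts)               ∎
  where
  open ≡-Reasoning
  open +-*-Solver using (solve; con; _:+_; _:*_; _:=_)
  a = forestSize us
  b = forestSize ts

forestTime≤ : ∀ {n S} (ts : List (Tree (Subset n))) → forestSize ts ≤ S → forestTime ts ≤ 1000 * suc S
forestTime≤ {S = S} ts ts≤S = begin
  forestTime ts              ≡⟨ forestTime≡ ts ⟩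
  100 + 200 * forestSize ts  ≤⟨ +-mono-≤ (m≤m+n 100 900) (*-mono-≤ (m≤m+n 200 800) ts≤S) ⟩
  1000 + 1000 * S            ≡⟨ sym (*-suc 1000 S) ⟩
  1000 * suc S               ∎
  where open ≤-Reasoning

-- S bounds every number and the length of every list of an execution; a
-- fixed number of nested recursions then takes time B ^ k with k fixed.
module Bounded (S B : ℕ) (large : 1000 * suc S ≤ B) where

  private
    1≤B : 1 ≤ B
    1≤B = ≤-trans (s≤s z≤n) large

    1≤B^ : ∀ k → 1 ≤ B ^ k
    1≤B^ k = subst (_≤ B ^ k) (^-zeroˡ k) (^-monoˡ-≤ k 1≤B)

    1000≤B : 1000 ≤ B
    1000≤B = ≤-trans (*-monoʳ-≤ 1000 (s≤s z≤n)) large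

  infix 3 _⊢_↓_∣_·_

  -- The coefficient `m` adds up along the constructs of a program text, while `k` measures the
  -- nesting of loops. A finished subroutine is normalised to coefficient 1 at the price of one more
  -- exponent, so coefficients stay small literals.
  record _⊢_↓_∣_·_ {Γ A} (ρ : Env Γ) (e : Γ ⊢ A) (v : Val A) (m k : ℕ) : Set where
    constructor within
    field
      {time}     : ℕ
      derivation : ρ ⊢ e ⇓ v ∣ time
      bound      : time ≤ m * B ^ k

  private
    bound₁ : ∀ k {m i} → i ≤ m * B ^ k → 1 + i ≤ (1 + m) * B ^ k
    bound₁ k p = +-mono-≤ (1≤B^ k) p

    bound₀ : ∀ k → 1 ≤ 1 * B ^ k
    bound₀ k = bound₁ k {0} z≤n

    bound₊ : ∀ k {m m′ i i′} → i ≤ m * B ^ k → i′ ≤ m′ * B ^ k → i + i′ ≤ (m + m′) * B ^ k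
    bound₊ k {m} {m′} {i} {i′} p q = subst (i + i′ ≤_) (sym (*-distribʳ-+ (B ^ k) m m′)) (+-mono-≤ p q)

  weaken : ∀ {Γ A} {ρ : Env Γ} {e : Γ ⊢ A} {v m m′ k} → m ≤ m′ →
           ρ ⊢ e ↓ v ∣ m · k → ρ ⊢ e ↓ v ∣ m′ · k
  weaken {k = k} m≤m′ (within d p) = within d (≤-trans p (*-monoˡ-≤ (B ^ k) m≤m′))

  result↓ : ∀ {Γ A} {ρ : Env Γ} {e : Γ ⊢ A} {v w m k} → v ≡ w → ρ ⊢ e ↓ v ∣ m · k → ρ ⊢ e ↓ w ∣ m · k
  result↓ refl d = d

  raise : ∀ {Γ A} {ρ : Env Γ} {e : Γ ⊢ A} {v m k k′} → k ≤ k′ →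
          ρ ⊢ e ↓ v ∣ m · k → ρ ⊢ e ↓ v ∣ m · k′
  raise {m = m} {k} {k′} k≤k′ (within d p) =
    within d (≤-trans p (*-monoʳ-≤ m (^-monoʳ-≤ B {{>-nonZero 1≤B}} k≤k′)))

  absorb : ∀ {Γ A} {ρ : Env Γ} {e : Γ ⊢ A} {v m k} → m ≤ B →
           ρ ⊢ e ↓ v ∣ m · k → ρ ⊢ e ↓ v ∣ 1 · suc k
  absorb {m = m} {k} m≤B (within d p) =
    within d (≤-trans p (subst (m * B ^ k ≤_) (sym (*-identityˡ (B ^ suc k))) (*-monoˡ-≤ (B ^ k) m≤B)))

  norm : ∀ {Γ A} {ρ : Env Γ} {e : Γ ⊢ A} {v m k} {small : True (m ≤? 1000)} →
         ρ ⊢ e ↓ v ∣ m · k → ρ ⊢ e ↓ v ∣ 1 · suc k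
  norm {small = p} = absorb (≤-trans (toWitness p) 1000≤B)

  -- A loop of at most `S` rounds of constant cost fits into one factor `B`.
  linear : ∀ {a} i → True (a ≤? 1000) → i ≤ S → a * suc i ≤ B
  linear {a} i a≤ i≤ = ≤-trans (*-mono-≤ (toWitness a≤) (s≤s i≤)) large

  module _ {Γ} {ρ : Env Γ} {k : ℕ} where

    app↓ : ∀ {Δ A B} {f : Γ ⊢ A `⇒ B} {e : Γ ⊢ A} {σ : Env Δ} {b : A ∷ (A `⇒ B) ∷ Δ ⊢ B} {v w m m′ m″} →
           ρ ⊢ f ↓ closure σ b ∣ m · k → ρ ⊢ e ↓ v ∣ m′ · k →
           v ∷ closure σ b ∷ σ ⊢ b ↓ w ∣ m″ · k →
           ρ ⊢ app f e ↓ w ∣ 1 + m + m′ + m″ · k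
    app↓ {m = m} {m′} (within d p) (within d′ p′) (within d″ p″) =
      within (app d d′ d″) (bound₊ k {1 + m + m′} (bound₊ k {1 + m} (bound₁ k {m} p) p′) p″)

    var↓ : ∀ {A} {x : Γ ∋ A} → ρ ⊢ var x ↓ All.lookup ρ x ∣ 1 · k
    var↓ = within var (bound₀ k)

    fun↓ : ∀ {A B} {b : A ∷ (A `⇒ B) ∷ Γ ⊢ B} → ρ ⊢ fun b ↓ closure ρ b ∣ 1 · k
    fun↓ = within fun (bound₀ k)

    tt↓ : ρ ⊢ tt ↓ tt ∣ 1 · k
    tt↓ = within tt (bound₀ k)

    zero↓ : ρ ⊢ zero ↓ nat 0 ∣ 1 · k
    zero↓ = within zero (bound₀ k)

    nil↓ : ∀ {A} → ρ ⊢ nil {A = A} ↓ list [] ∣ 1 · k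
    nil↓ = within nil (bound₀ k)

    suc↓ : ∀ {e i m} → ρ ⊢ e ↓ nat i ∣ m · k → ρ ⊢ suc e ↓ nat (suc i) ∣ 1 + m · k
    suc↓ {m = m} (within d p) = within (suc d) (bound₁ k {m} p)

    fst↓ : ∀ {A B} {e : Γ ⊢ A `× B} {v w m} → ρ ⊢ e ↓ pair v w ∣ m · k → ρ ⊢ fst e ↓ v ∣ 1 + m · k
    fst↓ {m = m} (within d p) = within (fst d) (bound₁ k {m} p)

    snd↓ : ∀ {A B} {e : Γ ⊢ A `× B} {v w m} → ρ ⊢ e ↓ pair v w ∣ m · k → ρ ⊢ snd e ↓ w ∣ 1 + m · k
    snd↓ {m = m} (within d p) = within (snd d) (bound₁ k {m} p)

    inl↓ : ∀ {A B} {e : Γ ⊢ A} {v m} → ρ ⊢ e ↓ v ∣ m · k → ρ ⊢ inl {B = B} e ↓ inl v ∣ 1 + m · k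
    inl↓ {m = m} (within d p) = within (inl d) (bound₁ k {m} p)

    inr↓ : ∀ {A B} {e : Γ ⊢ B} {v m} → ρ ⊢ e ↓ v ∣ m · k → ρ ⊢ inr {A = A} e ↓ inr v ∣ 1 + m · k
    inr↓ {m = m} (within d p) = within (inr d) (bound₁ k {m} p)

    pair↓ : ∀ {A B} {e : Γ ⊢ A} {e′ : Γ ⊢ B} {v w m m′} →
            ρ ⊢ e ↓ v ∣ m · k → ρ ⊢ e′ ↓ w ∣ m′ · k → ρ ⊢ pair e e′ ↓ pair v w ∣ 1 + m + m′ · k
    pair↓ {m = m} (within d p) (within d′ p′) = within (pair d d′) (bound₊ k {1 + m} (bound₁ k {m} p) p′)

    cons↓ : ∀ {A} {e : Γ ⊢ A} {e′ : Γ ⊢ `List A} {v vs m m′} →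
            ρ ⊢ e ↓ v ∣ m · k → ρ ⊢ e′ ↓ list vs ∣ m′ · k → ρ ⊢ cons e e′ ↓ list (v ∷ vs) ∣ 1 + m + m′ · k
    cons↓ {m = m} (within d p) (within d′ p′) = within (cons d d′) (bound₊ k {1 + m} (bound₁ k {m} p) p′)

    caseℕ-zero↓ : ∀ {A e} {z : Γ ⊢ A} {s : `ℕ ∷ Γ ⊢ A} {v m m′} →
                  ρ ⊢ e ↓ nat 0 ∣ m · k → ρ ⊢ z ↓ v ∣ m′ · k → ρ ⊢ caseℕ e z s ↓ v ∣ 1 + m + m′ · k
    caseℕ-zero↓ {m = m} (within d p) (within d′ p′) = within (caseℕ-zero d d′) (bound₊ k {1 + m} (bound₁ k {m} p) p′)

    caseℕ-suc↓ : ∀ {A e} {z : Γ ⊢ A} {s : `ℕ ∷ Γ ⊢ A} {i v m m′} →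
                 ρ ⊢ e ↓ nat (suc i) ∣ m · k → nat i ∷ ρ ⊢ s ↓ v ∣ m′ · k → ρ ⊢ caseℕ e z s ↓ v ∣ 1 + m + m′ · k
    caseℕ-suc↓ {m = m} (within d p) (within d′ p′) = within (caseℕ-suc d d′) (bound₊ k {1 + m} (bound₁ k {m} p) p′)

    case-inl↓ : ∀ {A B C} {e : Γ ⊢ A `⊎ B} {l : A ∷ Γ ⊢ C} {r : B ∷ Γ ⊢ C} {v w m m′} →
                ρ ⊢ e ↓ inl v ∣ m · k → v ∷ ρ ⊢ l ↓ w ∣ m′ · k → ρ ⊢ case⊎ e l r ↓ w ∣ 1 + m + m′ · k
    case-inl↓ {m = m} (within d p) (within d′ p′) = within (case⊎-inl d d′) (bound₊ k {1 + m} (bound₁ k {m} p) p′)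

    case-inr↓ : ∀ {A B C} {e : Γ ⊢ A `⊎ B} {l : A ∷ Γ ⊢ C} {r : B ∷ Γ ⊢ C} {v w m m′} →
                ρ ⊢ e ↓ inr v ∣ m · k → v ∷ ρ ⊢ r ↓ w ∣ m′ · k → ρ ⊢ case⊎ e l r ↓ w ∣ 1 + m + m′ · k
    case-inr↓ {m = m} (within d p) (within d′ p′) = within (case⊎-inr d d′) (bound₊ k {1 + m} (bound₁ k {m} p) p′)

    case-nil↓ : ∀ {A C} {e : Γ ⊢ `List A} {l : Γ ⊢ C} {r : A ∷ `List A ∷ Γ ⊢ C} {w m m′} →
                ρ ⊢ e ↓ list [] ∣ m · k → ρ ⊢ l ↓ w ∣ m′ · k → ρ ⊢ caseList e l r ↓ w ∣ 1 + m + m′ · k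
    case-nil↓ {m = m} (within d p) (within d′ p′) = within (caseList-nil d d′) (bound₊ k {1 + m} (bound₁ k {m} p) p′)

    case-cons↓ : ∀ {A C} {e : Γ ⊢ `List A} {l : Γ ⊢ C} {r : A ∷ `List A ∷ Γ ⊢ C} {v vs w m m′} →
                 ρ ⊢ e ↓ list (v ∷ vs) ∣ m · k → v ∷ list vs ∷ ρ ⊢ r ↓ w ∣ m′ · k →
                 ρ ⊢ caseList e l r ↓ w ∣ 1 + m + m′ · k
    case-cons↓ {m = m} (within d p) (within d′ p′) = within (caseList-cons d d′) (bound₊ k {1 + m} (bound₁ k {m} p) p′)

    case-node↓ : ∀ {A C} {e : Γ ⊢ `Tree A} {b : A ∷ `List (`Tree A) ∷ Γ ⊢ C} {v vs w m m′} →
                 ρ ⊢ e ↓ node v vs ∣ m · k → v ∷ list vs ∷ ρ ⊢ b ↓ w ∣ m′ · k →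
                 ρ ⊢ caseTree e b ↓ w ∣ 1 + m + m′ · k
    case-node↓ {m = m} (within d p) (within d′ p′) = within (caseTree d d′) (bound₊ k {1 + m} (bound₁ k {m} p) p′)

    true↓ : ρ ⊢ trueE ↓ encodeBool true ∣ 2 · k
    true↓ = inr↓ tt↓

    false↓ : ρ ⊢ falseE ↓ encodeBool false ∣ 2 · k
    false↓ = inl↓ tt↓

    -- The result is a function `f` of the condition, so both branches are derived before `b` is
    -- inspected. Charging both of them keeps the coefficient independent of `b`.
    if↓ : ∀ {A c} {t e : `⊤ ∷ Γ ⊢ A} (f : Bool → Val A) b {m m′ m″} →
          ρ ⊢ c ↓ encodeBool b ∣ m · k →
          tt ∷ ρ ⊢ t ↓ f true ∣ m′ · k →
          tt ∷ ρ ⊢ e ↓ f false ∣ m″ · k →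
          ρ ⊢ ifE c t e ↓ f b ∣ 1 + m + (m′ + m″) · k
    if↓ f true  {m} {m′} {m″} c t e = weaken (+-monoʳ-≤ (1 + m) (m≤m+n m′ m″)) (case-inr↓ c t)
    if↓ f false {m} {m′} {m″} c t e = weaken (+-monoʳ-≤ (1 + m) (m≤n+m m″ m′)) (case-inl↓ c e)

  -- Quantified over the environment because `call` builds the closure at the call site, where it
  -- captures whatever is bound.
  Computes : ∀ {A C} → Fn A C → Val A → Val C → ℕ → Set
  Computes f v w k = ∀ {Γ} (ρ : Env Γ) → v ∷ closure ρ f ∷ ρ ⊢ f ↓ w ∣ 1 · k

  call↓ : ∀ {A C Γ} {f : Fn A C} {ρ : Env Γ} {e v w m j k} →
          Computes f v w j → {_ : True (j ≤? k)} → ρ ⊢ e ↓ v ∣ m · k →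
          ρ ⊢ call f e ↓ w ∣ 3 + m · k
  call↓ {f = f} {ρ} {m = m} c {j≤k} e = weaken (≤-reflexive (cong (2 +_) (+-comm m 1))) (app↓ fun↓ e (raise (toWitness j≤k) (c ρ)))

  -- The trace of a fold: one derivation per element, all with the same exponent but with
  -- coefficients of their own. Clients argue about a single step, and the accounting over the whole
  -- list is done once, in `fold↓`.
  data Folds {Γ A R} (ρ : Env Γ) (z : `List A ∷ (`List A `⇒ R) ∷ Γ ⊢ R)
             (b : R ∷ (R `⇒ R) ∷ A ∷ `List A ∷ `List A ∷ (`List A `⇒ R) ∷ Γ ⊢ R) (k : ℕ) :
             List (Val A) → Val R → Set where
    []   : ∀ {r m} {_ : True (m ≤? 1000)} →
           list [] ∷ closure ρ (foldFn z b) ∷ ρ ⊢ z ↓ r ∣ m · k →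
           Folds ρ z b k [] r
    step : ∀ {v vs acc r m} {_ : True (m ≤? 1000)} →
           (let σ = v ∷ list vs ∷ list (v ∷ vs) ∷ closure ρ (foldFn z b) ∷ ρ) →
           acc ∷ closure σ b ∷ σ ⊢ b ↓ r ∣ m · k →
           Folds ρ z b k vs acc →
           Folds ρ z b k (v ∷ vs) r

  private
    fold-time : ∀ i → 8 + i * 8 ≡ 8 * suc i
    fold-time i = *-comm (suc i) 8

    run-folds : ∀ {Γ A R} {ρ : Env Γ} {z b k vs r} → Folds {Γ} {A} {R} ρ z b k vs r →
                list vs ∷ closure ρ (foldFn z b) ∷ ρ ⊢ foldFn z b ↓ r ∣ 8 + length vs * 8 · suc k
    run-folds ([] {m = m} {p} d) = weaken (m≤m+n 3 5) (case-nil↓ var↓ (norm {small = p} d))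
    run-folds (step {vs = vs} {m = m} {p} d f) =
      weaken (≤-reflexive (cong (7 +_) (trans (+-comm _ 1) refl)))
        (case-cons↓ var↓ (app↓ fun↓ (app↓ var↓ var↓ (run-folds f)) (norm {small = p} d)))

  -- Two exponents are spent: one to normalise the cost of a step, one for the number of rounds.
  fold↓ : ∀ {Γ A R} {ρ : Env Γ} {xs z b j k vs r m} → Folds {Γ} {A} {R} ρ z b j vs r →
          length vs ≤ S → {_ : True (2 + j ≤? k)} →
          ρ ⊢ xs ↓ list vs ∣ m · k → ρ ⊢ foldE xs z b ↓ r ∣ 3 + m · k
  fold↓ {vs = vs} {m = m} f len {j≤k} e =
    weaken (≤-reflexive (cong (2 +_) (+-comm m 1)))
      (app↓ fun↓ e (raise (toWitness j≤k)
        (absorb (≤-trans (≤-reflexive (fold-time (length vs))) (linear {8} (length vs) _ len)) (run-folds f))))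

  vec-length : ∀ {A n} (f : Fin n → Val A) → n ≤ S → length (tabulate f) ≤ S
  vec-length f = subst (_≤ S) (sym (length-tabulate f))

  -- Costs of the subroutines

  add↓ : ∀ x y → x ≤ S → Computes addF (pair (nat x) (nat y)) (nat (x + y)) 1
  add↓ x y x≤S ρ = absorb (linear {10} x _ x≤S) (weaken (bound x) (go x))
    where
    go : ∀ x → pair (nat x) (nat y) ∷ closure ρ addF ∷ ρ ⊢ addF ↓ nat (x + y) ∣ 5 + x * 10 · 0
    go zero    = caseℕ-zero↓ (fst↓ var↓) (snd↓ var↓)
    go (suc x) = caseℕ-suc↓ (fst↓ var↓) (suc↓ (app↓ var↓ (pair↓ var↓ (snd↓ var↓)) (go x)))
    bound : ∀ x → 5 + x * 10 ≤ 10 * suc x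
    bound x = ≤-trans (+-monoˡ-≤ (x * 10) (m≤m+n 5 5)) (≤-reflexive (*-comm (suc x) 10))

  leq↓ : ∀ x y → x ≤ S → Computes leqF (pair (nat x) (nat y)) (encodeBool (x ≤ᵇ y)) 1
  leq↓ x y x≤S ρ = absorb (linear {11} x _ x≤S) (weaken (bound x) (go x y))
    where
    go : ∀ x y → pair (nat x) (nat y) ∷ closure ρ leqF ∷ ρ ⊢ leqF ↓ encodeBool (x ≤ᵇ y) ∣ 8 + x * 11 · 0
    go zero    y       = weaken (m≤m+n 5 3) (caseℕ-zero↓ (fst↓ var↓) true↓)
    go (suc x) zero    = weaken (m≤m+n 8 _) (caseℕ-suc↓ (fst↓ var↓) (caseℕ-zero↓ (snd↓ var↓) false↓))
    go (suc x) (suc y) = caseℕ-suc↓ (fst↓ var↓) (caseℕ-suc↓ (snd↓ var↓)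
      (app↓ var↓ (pair↓ var↓ var↓) (subst (λ b → pair (nat x) (nat y) ∷ closure ρ leqF ∷ ρ ⊢ leqF ↓ encodeBool b ∣ 8 + x * 11 · 0) (shift x y) (go x y))))
      where
      -- `_≤ᵇ_` is defined through `_<ᵇ_`, so cancelling the successors is definitional only after a
      -- case split on `x`.
      shift : ∀ x y → (x ≤ᵇ y) ≡ (suc x ≤ᵇ suc y)
      shift zero    y = refl
      shift (suc x) y = refl
    bound : ∀ x → 8 + x * 11 ≤ 11 * suc x
    bound x = ≤-trans (+-monoˡ-≤ (x * 11) (m≤m+n 8 3)) (≤-reflexive (*-comm (suc x) 11))

  zip↓ : ∀ {A C n} (f : Fin n → Val A) (g : Fin n → Val C) → n ≤ S →
         Computes zipF (pair (vec f) (vec g)) (vec λ v → pair (f v) (g v)) 1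
  zip↓ {n = n} f g n≤S ρ = absorb (linear {15} n _ n≤S) (weaken (bound n) (go f g))
    where
    go : ∀ {A C n} (f : Fin n → Val A) (g : Fin n → Val C) →
         pair (vec f) (vec g) ∷ closure ρ zipF ∷ ρ ⊢ zipF ↓ vec (λ v → pair (f v) (g v)) ∣ 4 + n * 15 · 0
    go {n = zero}  f g = case-nil↓ (fst↓ var↓) nil↓
    go {n = suc n} f g = case-cons↓ (fst↓ var↓) (case-cons↓ (snd↓ var↓)
      (cons↓ (pair↓ var↓ var↓) (app↓ var↓ (pair↓ var↓ var↓) (go (f ∘ suc) (g ∘ suc)))))
    bound : ∀ n → 4 + n * 15 ≤ 15 * suc n
    bound n = ≤-trans (+-monoˡ-≤ (n * 15) (m≤m+n 4 11)) (≤-reflexive (*-comm (suc n) 15))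

  entry↓ : ∀ p r q → Computes entryF (pair (encodeColor p) (pair (encodeMaybe r) (encodeColor q))) (nat (crossing p r q)) 1
  entry↓ p r q ρ = norm (go p r q)
    where
    go : ∀ p r q → pair (encodeColor p) (pair (encodeMaybe r) (encodeColor q)) ∷ closure ρ entryF ∷ ρ
                   ⊢ entryF ↓ nat (crossing p r q) ∣ 20 · 0
    go p nothing q with differ p q
    ... | true  = weaken (m≤m+n 5 15) (case-inl↓ (fst↓ (snd↓ var↓)) zero↓)
    ... | false = weaken (m≤m+n 5 15) (case-inl↓ (fst↓ (snd↓ var↓)) zero↓)
    go nothing      (just w) q              = weaken (m≤m+n 8 12) (case-inr↓ (fst↓ (snd↓ var↓)) (case-inl↓ (fst↓ var↓) zero↓))
    go (just b)     (just w) nothing        = weaken (m≤m+n 12 8) (case-inr↓ (fst↓ (snd↓ var↓)) (case-inr↓ (fst↓ var↓) (case-inl↓ (snd↓ (snd↓ var↓)) zero↓)))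
    go (just true)  (just w) (just true)    = weaken (m≤m+n 16 4) (case-inr↓ (fst↓ (snd↓ var↓)) (case-inr↓ (fst↓ var↓) (case-inr↓ (snd↓ (snd↓ var↓)) (case-inr↓ var↓ (case-inr↓ var↓ zero↓)))))
    go (just true)  (just w) (just false)   = weaken (m≤m+n 16 4) (case-inr↓ (fst↓ (snd↓ var↓)) (case-inr↓ (fst↓ var↓) (case-inr↓ (snd↓ (snd↓ var↓)) (case-inr↓ var↓ (case-inl↓ var↓ var↓)))))
    go (just false) (just w) (just true)    = weaken (m≤m+n 16 4) (case-inr↓ (fst↓ (snd↓ var↓)) (case-inr↓ (fst↓ var↓) (case-inr↓ (snd↓ (snd↓ var↓)) (case-inl↓ var↓ (case-inr↓ var↓ var↓)))))
    go (just false) (just w) (just false)   = weaken (m≤m+n 16 4) (case-inr↓ (fst↓ (snd↓ var↓)) (case-inr↓ (fst↓ var↓) (case-inr↓ (snd↓ (snd↓ var↓)) (case-inl↓ var↓ (case-inl↓ var↓ zero↓)))))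

  module _ {n} (n≤S : n ≤ S) where

    private
      len : ∀ {A} (f : Fin n → Val A) → length (tabulate f) ≤ S
      len f = vec-length f n≤S

    degree↓ : (r : Row n) → rowDegree r ≤ S → Computes degreeF (encodeRow r) (nat (rowDegree r)) 4
    degree↓ r r≤S ρ = norm (fold↓ {k = 3} (folds r (λ u → ≤-trans (term≤sum _ u) r≤S)) (len (encodeMaybe ∘ r)) var↓)
      where
      folds : ∀ {n Γ} {σ : Env Γ} (r : Row n) → (∀ u → fromMaybe 0 (r u) ≤ S) →
              Folds σ zero degreeStep 1 (tabulate (encodeMaybe ∘ r)) (nat (rowDegree r))
      folds {zero}  r h = [] zero↓
      folds {suc n} r h = step (call↓ (add↓ _ _ (h zero)) (pair↓ (go (r zero)) var↓)) (folds (r ∘ suc) (h ∘ suc))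
        where
        go : ∀ {Γ A C} {σ : Env Γ} {a : Val A} {c : Val C} x →
             a ∷ c ∷ encodeMaybe x ∷ σ ⊢ case⊎ v2 zero v0 ↓ nat (fromMaybe 0 x) ∣ 3 · 1
        go nothing  = case-inl↓ var↓ zero↓
        go (just x) = case-inr↓ var↓ var↓

    cutDegree↓ : ∀ p (r : Row n) P → rowDegree r ≤ S →
      Computes cutDegreeF (pair (encodeColor p) (pair (encodeRow r) (encodePartial P)))
        (nat (sum λ u → crossing p (r u) (P u))) 4
    cutDegree↓ p r P r≤S ρ = norm (fold↓ {k = 3} (folds r P λ u → ≤-trans (crossing≤ p (r u) (P u)) (≤-trans (term≤sum _ u) r≤S))
        (len _) (call↓ (zip↓ _ _ n≤S) (snd↓ var↓)))
      where
      folds : ∀ {n Γ x} {σ : Env Γ} (r : Row n) (P : Partial n) → (∀ u → crossing p (r u) (P u) ≤ S) →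
              Folds (pair (encodeColor p) x ∷ σ) zero cutDegreeStep 1
                (tabulate λ u → pair (encodeMaybe (r u)) (encodeColor (P u))) (nat (sum λ u → crossing p (r u) (P u)))
      folds {zero}  r P h = [] zero↓
      folds {suc n} r P h = step
        (call↓ (add↓ _ _ (h zero)) (pair↓ (call↓ (entry↓ p (r zero) (P zero)) (pair↓ (fst↓ var↓) var↓)) var↓))
        (folds (r ∘ suc) (P ∘ suc) (h ∘ suc))

    total↓ : ∀ (P : Partial n) (d : Fin n → ℕ) (st : Indicator n) → sum d ≤ S → Computes totalF (encodeProfile P d st) (nat (sum d)) 4
    total↓ P d st d≤S ρ = norm (fold↓ {k = 3} (folds P d st λ u → ≤-trans (term≤sum _ u) d≤S) (len _) var↓)
      where
      folds : ∀ {n Γ} {σ : Env Γ} (P : Partial n) (d : Fin n → ℕ) (st : Indicator n) → (∀ u → d u ≤ S) →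
              Folds σ zero totalStep 1
                (tabulate λ u → pair (encodeColor (P u)) (pair (nat (d u)) (encodeBool (st u)))) (nat (sum d))
      folds {zero}  P d st h = [] zero↓
      folds {suc n} P d st h = step (call↓ (add↓ _ _ (h zero)) (pair↓ (fst↓ (snd↓ var↓)) var↓))
        (folds (P ∘ suc) (d ∘ suc) (st ∘ suc) (h ∘ suc))

    settled↓ : ∀ (σ : Indicator n) (P : Partial n) (d : Fin n → ℕ) (st : Indicator n) →
      Computes settledF (pair (encodeBag σ) (encodeProfile P d st))
        (encodeBool (allᵇ λ v → σ v ∨ (not (is-just (P v)) ∨ st v))) 4
    settled↓ σ P d st ρ = norm (fold↓ {k = 3} (folds σ P d st) (len _) (call↓ (zip↓ _ _ n≤S) var↓))
      where
      go : ∀ {Γ} {ρ : Env Γ} {f l w g} s p d st acc →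
           encodeBool acc ∷ f ∷ pair (encodeBool s) (pair (encodeColor p) (pair (nat d) (encodeBool st))) ∷ l ∷ w ∷ g ∷ ρ
             ⊢ settledStep ↓ encodeBool ((s ∨ (not (is-just p) ∨ st)) ∧ acc) ∣ 1 · 1
      go true  p        d st    acc = norm (case-inr↓ (fst↓ var↓) var↓)
      go false nothing  d st    acc = norm (case-inl↓ (fst↓ var↓) (case-inl↓ (fst↓ (snd↓ var↓)) var↓))
      go false (just b) d true  acc = norm (case-inl↓ (fst↓ var↓) (case-inr↓ (fst↓ (snd↓ var↓)) (case-inr↓ (snd↓ (snd↓ (snd↓ var↓))) var↓)))
      go false (just b) d false acc = norm (case-inl↓ (fst↓ var↓) (case-inr↓ (fst↓ (snd↓ var↓)) (case-inl↓ (snd↓ (snd↓ (snd↓ var↓))) false↓)))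
      folds : ∀ {n Γ} {ρ : Env Γ} (σ : Indicator n) (P : Partial n) (d : Fin n → ℕ) (st : Indicator n) →
              Folds ρ trueE settledStep 1
                (tabulate λ v → pair (encodeBool (σ v)) (pair (encodeColor (P v)) (pair (nat (d v)) (encodeBool (st v)))))
                (encodeBool (allᵇ λ v → σ v ∨ (not (is-just (P v)) ∨ st v)))
      folds {zero}  σ P d st = [] true↓
      folds {suc n} σ P d st = step (go (σ zero) (P zero) (d zero) (st zero) _)
        (folds (σ ∘ suc) (P ∘ suc) (d ∘ suc) (st ∘ suc))

    key↓ : ∀ (σ : Indicator n) (P : Partial n) (d : Fin n → ℕ) (st : Indicator n) → (∀ v → d v ≤ S) →
      Computes keyF (pair (encodeBag σ) (encodeProfile P d st)) (vec λ v → nat (keyEntry (σ v) (P v) (d v))) 5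
    key↓ σ P d st d≤S ρ = norm (fold↓ {k = 4} (folds σ P d st d≤S) (len _) (call↓ (zip↓ _ _ n≤S) var↓))
      where
      go : ∀ {Γ} {ρ : Env Γ} {f l w g vs} s p d st → d ≤ S →
           list vs ∷ f ∷ pair (encodeBool s) (pair (encodeColor p) (pair (nat d) (encodeBool st))) ∷ l ∷ w ∷ g ∷ ρ
             ⊢ keyStep ↓ list (nat (keyEntry s p d) ∷ vs) ∣ 1 · 2
      go false p            d st h = norm (cons↓ (case-inl↓ (fst↓ var↓) zero↓) var↓)
      go true  nothing      d st h = norm (cons↓ (case-inr↓ (fst↓ var↓) (case-inl↓ (fst↓ (snd↓ var↓)) zero↓)) var↓)
      go true  (just true)  d st h = norm (cons↓ (case-inr↓ (fst↓ var↓) (case-inr↓ (fst↓ (snd↓ var↓)) (case-inr↓ var↓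
        (suc↓ (suc↓ (call↓ (add↓ d d h) (pair↓ (fst↓ (snd↓ (snd↓ var↓))) (fst↓ (snd↓ (snd↓ var↓)))))))))) var↓)
      go true  (just false) d st h = norm (cons↓ (case-inr↓ (fst↓ var↓) (case-inr↓ (fst↓ (snd↓ var↓)) (case-inl↓ var↓
        (suc↓ (call↓ (add↓ d d h) (pair↓ (fst↓ (snd↓ (snd↓ var↓))) (fst↓ (snd↓ (snd↓ var↓))))))))) var↓)
      folds : ∀ {n Γ} {ρ : Env Γ} (σ : Indicator n) (P : Partial n) (d : Fin n → ℕ) (st : Indicator n) → (∀ v → d v ≤ S) →
              Folds ρ nil keyStep 2
                (tabulate λ v → pair (encodeBool (σ v)) (pair (encodeColor (P v)) (pair (nat (d v)) (encodeBool (st v)))))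
                (vec λ v → nat (keyEntry (σ v) (P v) (d v)))
      folds {zero}  σ P d st h = [] nil↓
      folds {suc n} σ P d st h = step (go (σ zero) (P zero) (d zero) (st zero) (h zero))
        (folds (σ ∘ suc) (P ∘ suc) (d ∘ suc) (st ∘ suc) (h ∘ suc))

    equal↓ : ∀ (f g : Fin n → ℕ) → (∀ v → f v ≤ S) → (∀ v → g v ≤ S) →
      Computes equalF (pair (vec (nat ∘ f)) (vec (nat ∘ g))) (encodeBool (equalᵇ f g)) 5
    equal↓ f g f≤S g≤S ρ = norm (fold↓ {k = 4} (folds f g f≤S g≤S) (len _) (call↓ (zip↓ _ _ n≤S) var↓))
      where
      go : ∀ {Γ} {ρ : Env Γ} {y l w z} i j acc → i ≤ S → j ≤ S →
           encodeBool acc ∷ y ∷ pair (nat i) (nat j) ∷ l ∷ w ∷ z ∷ ρ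
             ⊢ equalStep ↓ encodeBool (((i ≤ᵇ j) ∧ (j ≤ᵇ i)) ∧ acc) ∣ 1 · 2
      go i j acc i≤S j≤S = norm (if↓ (λ b → encodeBool ((b ∧ (j ≤ᵇ i)) ∧ acc)) (i ≤ᵇ j) (call↓ (leq↓ i j i≤S) var↓)
        (if↓ (λ b → encodeBool (b ∧ acc)) (j ≤ᵇ i) (call↓ (leq↓ j i j≤S) (pair↓ (snd↓ var↓) (fst↓ var↓))) var↓ false↓)
        false↓)
      folds : ∀ {n Γ} {ρ : Env Γ} (f g : Fin n → ℕ) → (∀ v → f v ≤ S) → (∀ v → g v ≤ S) →
              Folds ρ trueE equalStep 2 (tabulate λ v → pair (nat (f v)) (nat (g v))) (encodeBool (equalᵇ f g))
      folds {zero}  f g f≤ g≤ = [] true↓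
      folds {suc n} f g f≤ g≤ = step (go (f zero) (g zero) _ (f≤ zero) (g≤ zero))
        (folds (f ∘ suc) (g ∘ suc) (f≤ ∘ suc) (g≤ ∘ suc))

    merge↓ : ∀ (P Q : Partial n) → Computes mergeF (pair (encodePartial P) (encodePartial Q)) (encodePartial (merge P Q)) 4
    merge↓ P Q ρ = norm (fold↓ {k = 3} (folds P Q) (len _) (call↓ (zip↓ _ _ n≤S) var↓))
      where
      go : ∀ {Γ} {ρ : Env Γ} {y l w z vs} p q →
           list vs ∷ y ∷ pair (encodeColor p) (encodeColor q) ∷ l ∷ w ∷ z ∷ ρ ⊢ mergeStep ↓ list (encodeColor (p <∣> q) ∷ vs) ∣ 1 · 1
      go nothing  q = norm (cons↓ (case-inl↓ (fst↓ var↓) (snd↓ var↓)) var↓)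
      go (just b) q = norm (cons↓ (case-inr↓ (fst↓ var↓) (inr↓ var↓)) var↓)
      folds : ∀ {n Γ} {ρ : Env Γ} (P Q : Partial n) →
              Folds ρ nil mergeStep 1 (tabulate λ v → pair (encodeColor (P v)) (encodeColor (Q v))) (encodePartial (merge P Q))
      folds {zero}  P Q = [] nil↓
      folds {suc n} P Q = step (go (P zero) (Q zero)) (folds (P ∘ suc) (Q ∘ suc))

    compatible↓ : ∀ (P Q : Partial n) → Computes compatibleF (pair (encodePartial P) (encodePartial Q)) (encodeBool (compatible P Q)) 4
    compatible↓ P Q ρ = norm (fold↓ {k = 3} (folds P Q) (len _) (call↓ (zip↓ _ _ n≤S) var↓))
      where
      go : ∀ {Γ} {ρ : Env Γ} {y l w z} p q acc →
           encodeBool acc ∷ y ∷ pair (encodeColor p) (encodeColor q) ∷ l ∷ w ∷ z ∷ ρ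
             ⊢ compatibleStep ↓ encodeBool (not (differ p q) ∧ acc) ∣ 1 · 1
      go nothing  q        acc = norm (case-inl↓ (fst↓ var↓) var↓)
      go (just b) nothing  acc = norm (case-inr↓ (fst↓ var↓) (case-inl↓ (snd↓ var↓) var↓))
      go (just true)  (just true)  acc = norm (case-inr↓ (fst↓ var↓) (case-inr↓ (snd↓ var↓) (case-inr↓ var↓ (case-inr↓ var↓ var↓))))
      go (just true)  (just false) acc = norm (case-inr↓ (fst↓ var↓) (case-inr↓ (snd↓ var↓) (case-inr↓ var↓ (case-inl↓ var↓ false↓))))
      go (just false) (just true)  acc = norm (case-inr↓ (fst↓ var↓) (case-inr↓ (snd↓ var↓) (case-inl↓ var↓ (case-inr↓ var↓ false↓))))
      go (just false) (just false) acc = norm (case-inr↓ (fst↓ var↓) (case-inr↓ (snd↓ var↓) (case-inl↓ var↓ (case-inl↓ var↓ var↓))))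
      folds : ∀ {n Γ} {ρ : Env Γ} (P Q : Partial n) →
              Folds ρ trueE compatibleStep 1 (tabulate λ v → pair (encodeColor (P v)) (encodeColor (Q v))) (encodeBool (compatible P Q))
      folds {zero}  P Q = [] true↓
      folds {suc n} P Q = step (go (P zero) (Q zero) _) (folds (P ∘ suc) (Q ∘ suc))

  module _ {n} (n≤S : n ≤ S) (M : Matrix n) (degree≤S : ∀ v → rowDegree (M v) ≤ S) where

    profile↓ : ∀ P → Computes profileF (pair (encodeMatrix M) (encodePartial P)) (encodeProfile P (cutDeg M P) (stableᵇ M P)) 7
    profile↓ P ρ = norm (fold↓ {k = 6} (folds M P degree≤S) (vec-length _ n≤S) (call↓ (zip↓ _ _ n≤S) var↓))
      where
      -- The fold peels vertices off `R` and `p`, while each row is still summed against the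
      -- complete cut `P`; hence the rows and their colours are generalised separately from `P`.
      folds : ∀ {m Γ x} {σ : Env Γ} (R : Fin m → Row n) (p : Fin m → Maybe Bool) → (∀ v → rowDegree (R v) ≤ S) →
              (let d = λ v → sum λ u → crossing (p v) (R v u) (P u)) →
              Folds (pair x (encodePartial P) ∷ σ) nil profileStep 4
                (tabulate λ v → pair (encodeRow (R v)) (encodeColor (p v)))
                (vec λ v → pair (encodeColor (p v)) (pair (nat (d v)) (encodeBool (rowDegree (R v) ≤ᵇ d v + d v))))
      folds {zero}  R p h = [] nil↓
      folds {suc m} R p h = step
        (cons↓ (pair↓ (snd↓ var↓) (pair↓ deg (call↓ (leq↓ _ _ (h zero)) (pair↓ (call↓ (degree↓ n≤S (R zero) (h zero)) (fst↓ var↓))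
          (call↓ (add↓ _ _ (≤-trans (sum-mono λ u → crossing≤ (p zero) (R zero u) (P u)) (h zero))) (pair↓ deg deg)))))) var↓)
        (folds (R ∘ suc) (p ∘ suc) (h ∘ suc))
        where
        deg = call↓ (cutDegree↓ n≤S (p zero) (R zero) P (h zero)) (pair↓ (snd↓ var↓) (pair↓ (fst↓ var↓) (snd↓ var↓)))

    module _ (total≤S : ∀ P → total M P ≤ S) (key≤S : ∀ σ P v → key M σ P v ≤ S) where

      keyE↓ : ∀ {Γ A} {ρ : Env Γ} {a p m m′} {x : Val A} σ P →
              ρ ⊢ a ↓ pair (encodeMatrix M) (pair (encodeBag σ) x) ∣ m · 7 → ρ ⊢ p ↓ encodePartial P ∣ m′ · 7 →
              ρ ⊢ keyE a p ↓ vec (nat ∘ key M σ P) ∣ 3 + (1 + (2 + m) + (3 + (1 + (1 + m) + m′))) · 7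
      keyE↓ σ P a p = call↓ (key↓ n≤S σ P _ _ λ v → ≤-trans (cutDeg≤rowDegree M P v) (degree≤S v))
        (pair↓ (fst↓ (snd↓ a)) (call↓ (profile↓ P) (pair↓ (fst↓ a) p)))

      totalE↓ : ∀ {Γ A} {ρ : Env Γ} {a p m m′} {x : Val A} {y} P →
                ρ ⊢ a ↓ pair (encodeMatrix M) (pair y x) ∣ m · 7 → ρ ⊢ p ↓ encodePartial P ∣ m′ · 7 →
                ρ ⊢ totalE a p ↓ nat (total M P) ∣ 3 + (3 + (1 + (1 + m) + m′)) · 7
      totalE↓ P a p = call↓ (total↓ n≤S P _ _ (total≤S P)) (call↓ (profile↓ P) (pair↓ (fst↓ a) p))

      insert↓ : ∀ σ P A → length A ≤ S →
        Computes insertF (pair (encodeMatrix M) (pair (encodeBag σ) (pair (encodePartial P) (encodeTable A))))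
          (encodeTable (insert M σ P A)) 10
      insert↓ σ P A A≤S ρ = norm (fold↓ {k = 9} (folds A) (subst (_≤ S) (sym (length-map encodePartial A)) A≤S) (snd↓ (snd↓ (snd↓ var↓))))
        where
        folds : ∀ {Γ C} {x : Val C} {ρ : Env Γ} A →
                Folds (pair (encodeMatrix M) (pair (encodeBag σ) (pair (encodePartial P) x)) ∷ ρ)
                  (cons (fst (snd (snd v2))) nil) insertStep 7
                  (List.map encodePartial A) (encodeTable (insert M σ P A))
        folds []      = [] (cons↓ (fst↓ (snd↓ (snd↓ var↓))) nil↓)
        folds (Q ∷ A) = step
          (if↓ (λ b → encodeTable (if b then (if total M P ≤ᵇ total M Q then P ∷ A else Q ∷ A) else Q ∷ insert M σ P A))
            (equalᵇ (key M σ P) (key M σ Q))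
            (call↓ (equal↓ n≤S (key M σ P) (key M σ Q) (key≤S σ P) (key≤S σ Q))
              (pair↓ (keyE↓ σ P var↓ (fst↓ (snd↓ (snd↓ var↓)))) (keyE↓ σ Q var↓ var↓)))
            (if↓ (λ b → encodeTable (if b then P ∷ A else Q ∷ A)) (total M P ≤ᵇ total M Q)
              (call↓ (leq↓ _ _ (total≤S P)) (pair↓ (totalE↓ P var↓ (fst↓ (snd↓ (snd↓ var↓)))) (totalE↓ Q var↓ var↓)))
              (cons↓ (fst↓ (snd↓ (snd↓ var↓))) var↓)
              (cons↓ var↓ var↓))
            (cons↓ var↓ var↓))
          (folds A)

      module _ (σ : Indicator n) where

        -- The accumulator at each suffix of `R` is again a `mergeInto`, so the length hypothesis
        -- ranges over all second tables. Counting keys proves it for all of them alike.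
        mergeInto↓ : ∀ P A R → length R ≤ S → (∀ R → length (mergeInto M σ P A R) ≤ S) →
          Computes mergeIntoF (pair (encodeMatrix M) (pair (encodeBag σ) (pair (encodePartial P) (pair (encodeTable A) (encodeTable R)))))
            (encodeTable (mergeInto M σ P A R)) 13
        mergeInto↓ P A R R≤S AR≤S ρ =
          norm (fold↓ {k = 12} (folds R) (subst (_≤ S) (sym (length-map encodePartial R)) R≤S) (snd↓ (snd↓ (snd↓ (snd↓ var↓)))))
          where
          folds : ∀ {Γ C} {x : Val C} {ρ : Env Γ} R →
                  Folds (pair (encodeMatrix M) (pair (encodeBag σ) (pair (encodePartial P) (pair (encodeTable A) x))) ∷ ρ)
                    (fst (snd (snd (snd v2)))) mergeIntoStep 10
                    (List.map encodePartial R) (encodeTable (mergeInto M σ P A R))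
          folds []      = [] (fst↓ (snd↓ (snd↓ (snd↓ var↓))))
          folds (Q ∷ R) = step
            (if↓ (λ b → encodeTable (if b then (if settledᵇ M σ (merge P Q) then insert M σ (merge P Q) (mergeInto M σ P A R) else mergeInto M σ P A R) else mergeInto M σ P A R))
              (compatible P Q)
              (call↓ (compatible↓ n≤S P Q) (pair↓ (fst↓ (snd↓ (snd↓ var↓))) var↓))
              (if↓ (λ b → encodeTable (if b then insert M σ (merge P Q) (mergeInto M σ P A R) else mergeInto M σ P A R))
                (settledᵇ M σ (merge P Q))
                (call↓ (settled↓ n≤S σ (merge P Q) _ _) (pair↓ (fst↓ (snd↓ var↓))
                  (call↓ (profile↓ (merge P Q)) (pair↓ (fst↓ var↓) (call↓ (merge↓ n≤S P Q) (pair↓ (fst↓ (snd↓ (snd↓ var↓))) var↓))))))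
                (call↓ (insert↓ σ (merge P Q) _ (AR≤S R)) (pair↓ (fst↓ var↓) (pair↓ (fst↓ (snd↓ var↓))
                  (pair↓ (call↓ (merge↓ n≤S P Q) (pair↓ (fst↓ (snd↓ (snd↓ var↓))) var↓)) var↓))))
                var↓)
              var↓)
            (folds R)

        join↓ : ∀ A R → length A ≤ S → length R ≤ S → (∀ P A R R′ → length (mergeInto M σ P (join M σ A R) R′) ≤ S) →
          Computes joinF (pair (encodeMatrix M) (pair (encodeBag σ) (pair (encodeTable A) (encodeTable R))))
            (encodeTable (join M σ A R)) 16
        join↓ A R A≤S R≤S AR≤S ρ =
          norm (fold↓ {k = 15} (folds A) (subst (_≤ S) (sym (length-map encodePartial A)) A≤S) (fst↓ (snd↓ (snd↓ var↓))))
          where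
          folds : ∀ {Γ} {x : Val `Table} {ρ : Env Γ} A →
                  Folds (pair (encodeMatrix M) (pair (encodeBag σ) (pair x (encodeTable R))) ∷ ρ) nil joinStep 13
                    (List.map encodePartial A) (encodeTable (join M σ A R))
          folds []      = [] nil↓
          folds (P ∷ A) = step
            (call↓ (mergeInto↓ P (join M σ A R) R R≤S (AR≤S P A R))
              (pair↓ (fst↓ var↓) (pair↓ (fst↓ (snd↓ var↓)) (pair↓ var↓ (pair↓ var↓ (snd↓ (snd↓ (snd↓ var↓))))))))
            (folds A)

  initial↓ : ∀ {n} (σ : Indicator n) → n ≤ S → length (initial σ) ≤ S → Computes initialF (encodeBag σ) (encodeTable (initial σ)) 6
  initial↓ σ n≤S σ≤S ρ = norm (fold↓ {k = 5} (folds σ σ≤S) (vec-length _ n≤S) var↓)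
    where
    free : ∀ {n Γ} {ρ : Env Γ} (A : List (Partial n)) →
           Folds ρ nil freeStep 0 (List.map encodePartial A) (encodeTable (extend true A))
    free []      = [] nil↓
    free (P ∷ A) = step (cons↓ (cons↓ (inr↓ false↓) var↓) (cons↓ (cons↓ (inr↓ true↓) var↓) var↓)) (free A)
    fixed : ∀ {n Γ} {ρ : Env Γ} (A : List (Partial n)) →
            Folds ρ nil fixedStep 0 (List.map encodePartial A) (encodeTable (extend false A))
    fixed []      = [] nil↓
    fixed (P ∷ A) = step (cons↓ (cons↓ (inl↓ tt↓) var↓) var↓) (fixed A)
    go : ∀ {n Γ} {ρ : Env Γ} {y l w z} b (A : List (Partial n)) → length A ≤ S →
         encodeTable A ∷ y ∷ encodeBool b ∷ l ∷ w ∷ z ∷ ρ ⊢ initialStep ↓ encodeTable (extend b A) ∣ 1 · 3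
    go true  A A≤S = norm (case-inr↓ var↓ (fold↓ {k = 2} (free A) (subst (_≤ S) (sym (length-map encodePartial A)) A≤S) var↓))
    go false A A≤S = norm (case-inl↓ var↓ (fold↓ {k = 2} (fixed A) (subst (_≤ S) (sym (length-map encodePartial A)) A≤S) var↓))
    folds : ∀ {n Γ} {ρ : Env Γ} (σ : Indicator n) → length (initial σ) ≤ S →
            Folds ρ (cons nil nil) initialStep 3 (tabulate (encodeBool ∘ σ)) (encodeTable (initial σ))
    folds {zero}  σ h = [] (cons↓ nil↓ nil↓)
    folds {suc n} σ h = step (go (σ zero) (initial (σ ∘ suc)) h′) (folds (σ ∘ suc) h′)
      where h′ = ≤-trans (length-extend (σ zero) (initial (σ ∘ suc))) h

  lefts↓ : ∀ {A C} (vs : List (Val A)) → length vs ≤ S → Computes (leftsF {A} {C}) (list vs) (list (List.map (λ _ → inl tt) vs)) 3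
  lefts↓ vs vs≤S ρ = norm (fold↓ {k = 2} (folds vs) vs≤S var↓)
    where
    folds : ∀ {Γ A C} {ρ : Env Γ} (vs : List (Val A)) → Folds ρ nil (leftsStep {C = C}) 0 vs (list (List.map (λ _ → inl tt) vs))
    folds []       = [] nil↓
    folds (v ∷ vs) = step (cons↓ (inl↓ tt↓) var↓) (folds vs)

  first↓ : ∀ {n} (P : Partial n) A → n ≤ S → Computes firstF (encodeTable (P ∷ A)) (encodeCut (fromMaybe false ∘ P)) 3
  first↓ P A n≤S ρ = norm (case-cons↓ var↓ (fold↓ {k = 2} (folds P) (vec-length _ n≤S) var↓))
    where
    go : ∀ {Γ} {ρ : Env Γ} {y l w z vs} p →
         list vs ∷ y ∷ encodeColor p ∷ l ∷ w ∷ z ∷ ρ ⊢ cutStep ↓ list (encodeBool (fromMaybe false p) ∷ vs) ∣ 6 · 0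
    go nothing  = cons↓ (case-inl↓ var↓ false↓) var↓
    go (just b) = weaken (m≤m+n 5 1) (cons↓ (case-inr↓ var↓ var↓) var↓)
    folds : ∀ {n Γ} {ρ : Env Γ} (P : Partial n) →
            Folds ρ nil cutStep 0 (tabulate (encodeColor ∘ P)) (encodeCut (fromMaybe false ∘ P))
    folds {zero}  P = [] nil↓
    folds {suc n} P = step (go (P zero)) (folds (P ∘ suc))

  small↓ : ∀ {n} (M : Matrix n) → n ≤ S → (∀ v → rowDegree (M v) ≤ S) → Computes smallF (encodeMatrix M) (encodeBool (allSmall M)) 7
  small↓ {n} M n≤S M≤S ρ = norm (fold↓ {k = 6} (folds M M≤S) (vec-length _ n≤S) var↓)
    where
    folds : ∀ {m Γ} {ρ : Env Γ} (R : Fin m → Row n) → (∀ v → rowDegree (R v) ≤ S) →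
            Folds ρ trueE smallStep 4 (tabulate (encodeRow ∘ R)) (encodeBool (allᵇ λ v → rowDegree (R v) ≤ᵇ 1))
    folds {zero}  R h = [] true↓
    folds {suc m} R h = step
      (if↓ (λ b → encodeBool (b ∧ allᵇ λ v → rowDegree (R (suc v)) ≤ᵇ 1)) (rowDegree (R zero) ≤ᵇ 1)
        (call↓ (leq↓ _ _ (h zero)) (pair↓ (call↓ (degree↓ n≤S (R zero) (h zero)) var↓) (suc↓ zero↓))) var↓ false↓)
      (folds (R ∘ suc) (h ∘ suc))

  tails↓ : ∀ {A m n} (f : Fin m → Fin (suc n) → Val A) → m ≤ S → Computes (tailsF {A}) (vec λ u → vec (f u)) (vec λ u → vec (f u ∘ suc)) 3
  tails↓ f m≤S ρ = norm (fold↓ {k = 2} (folds f) (vec-length _ m≤S) var↓)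
    where
    folds : ∀ {A m n Γ} {ρ : Env Γ} (f : Fin m → Fin (suc n) → Val A) →
            Folds ρ nil tailsStep 0 (tabulate λ u → vec (f u)) (vec λ u → vec (f u ∘ suc))
    folds {m = zero}  f = [] nil↓
    folds {m = suc m} f = step (cons↓ (case-cons↓ var↓ var↓) var↓) (folds (f ∘ suc))

  greedy↓ : ∀ {n} (M : Matrix n) → n ≤ S → (∀ v → rowDegree (M v) ≤ S) → Computes greedyF (encodeMatrix M) (encodeCut (greedy M)) 5
  greedy↓ {n} M n≤S M≤S ρ = absorb (linear {50} n _ n≤S) (weaken (≤-reflexive (*-comm (suc n) 50)) (go M n≤S M≤S))
    where
    positive : ∀ {Γ} {ρ : Env Γ} {e m} x → ρ ⊢ e ↓ nat x ∣ m · 4 → ρ ⊢ caseℕ e falseE trueE ↓ encodeBool (1 ≤ᵇ x) ∣ 1 + m + 2 · 4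
    positive zero    d = caseℕ-zero↓ d false↓
    positive (suc x) d = caseℕ-suc↓ d true↓
    go : ∀ {n} (M : Matrix n) → n ≤ S → (∀ v → rowDegree (M v) ≤ S) →
         encodeMatrix M ∷ closure ρ greedyF ∷ ρ ⊢ greedyF ↓ encodeCut (greedy M) ∣ suc n * 50 · 4
    go {zero}  M n≤S M≤S = weaken (m≤m+n 3 47) (case-nil↓ var↓ nil↓)
    go {suc n} M n≤S M≤S = weaken (m≤n+m _ 34) (case-cons↓ var↓ (cons↓
      (positive _ (call↓ (degree↓ n≤S (M zero) (M≤S zero)) var↓))
      (app↓ var↓ (call↓ (tails↓ (λ u v → encodeMaybe (M (suc u) v)) (<⇒≤ n≤S)) var↓)
        (go (λ u v → M (suc u) (suc v)) (<⇒≤ n≤S) λ v → ≤-trans (m≤n+m _ (fromMaybe 0 (M (suc v) zero))) (M≤S (suc v))))))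

  module _ {n} (M : Matrix n) where

    -- The bags whose tables fit into `S`. The second field also bounds the intermediate tables
    -- inside a join; a nonempty complete join is the case where `R′` is `R`.
    record Narrow (σ : Indicator n) : Set where
      field
        initial≤S : length (initial σ) ≤ S
        join≤S    : ∀ P A R R′ → length (mergeInto M σ P (join M σ A R) R′) ≤ S

    open Narrow

    length-join : ∀ {σ} → Narrow σ → ∀ A R → length (join M σ A R) ≤ S
    length-join nσ []      R = z≤n
    length-join nσ (P ∷ A) R = join≤S nσ P A R R

    length-solve : ∀ {σ} → Narrow σ → ∀ A ts → length A ≤ S → length (solveForest M σ A ts) ≤ S
    length-solve nσ A []               A≤S = A≤S
    length-solve nσ A (node s us ∷ ts) A≤S = length-solve nσ _ ts (length-join nσ A _)

    solveInput : Indicator n → List (Partial n) → List (Val (`Tree `Bag)) → Val (`Matrix `× `Bag `× `Table `× `List (`Tree `Bag))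
    solveInput σ A ts = pair (encodeMatrix M) (pair (encodeBag σ) (pair (encodeTable A) (list ts)))

    module _ (n≤S : n ≤ S) (degree≤S : ∀ v → rowDegree (M v) ≤ S)
             (total≤S : ∀ P → total M P ≤ S) (key≤S : ∀ σ P v → key M σ P v ≤ S) where

      solve↓ : ∀ σ A ts → Narrow σ → Everyᶠ Narrow ts → length A ≤ S → forestSize ts ≤ S →
        Computes solveF (solveInput σ A (encodeForest ts)) (encodeTable (solveForest M σ A ts)) 17
      solve↓ σ A ts nσ nts A≤S ts≤S ρ =
        absorb (≤-trans (forestTime≤ ts ts≤S) large)
          (go σ A ts nσ nts A≤S)
        where
        -- The literals are the cost of one round of `solveF` apart from its two recursive calls, as
        -- it results from the derivation in `combine`.
        slack : ∀ T T′ → 45 + (T + 1 + T′) ≤ 100 + (T + T′)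
        slack T T′ = subst (_≤ 100 + (T + T′)) (cong (45 +_) (cong (_+ T′) (+-comm 1 T))) (+-monoˡ-≤ (T + T′) (m≤m+n 46 54))
        -- The encoded bag of the child equals `encodeBag τ` only propositionally; as a variable `b`
        -- with an equation it can be matched away.
        combine : ∀ {σ A R f us ts b T T′ v} τ → b ≡ encodeBag τ → Narrow σ → Narrow τ → length A ≤ S → length R ≤ S →
                  solveInput τ (initial τ) us ∷ f ∷ ρ ⊢ solveF ↓ encodeTable R ∣ T · 16 →
                  solveInput σ (join M σ A R) ts ∷ f ∷ ρ ⊢ solveF ↓ v ∣ T′ · 16 →
                  f ≡ closure ρ solveF →
                  solveInput σ A (node b us ∷ ts) ∷ f ∷ ρ ⊢ solveF ↓ v ∣ 100 + (T + T′) · 16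
        combine {σ} {A} {R} {T = T} {T′} τ refl nσ nτ A≤S R≤S d d′ refl = weaken (slack T T′)
          (case-cons↓ (snd↓ (snd↓ (snd↓ var↓))) (case-node↓ var↓
            (app↓ var↓ (pair↓ (fst↓ var↓) (pair↓ (fst↓ (snd↓ var↓)) (pair↓
              (call↓ (join↓ n≤S M degree≤S total≤S key≤S σ A R A≤S R≤S (join≤S nσ))
                (pair↓ (fst↓ var↓) (pair↓ (fst↓ (snd↓ var↓)) (pair↓ (fst↓ (snd↓ (snd↓ var↓)))
                  (app↓ var↓ (pair↓ (fst↓ var↓) (pair↓ var↓ (pair↓ (call↓ (initial↓ τ n≤S (initial≤S nτ)) var↓) var↓))) d)))))
              var↓))) d′)))
        go : ∀ σ A ts → Narrow σ → Everyᶠ Narrow ts → length A ≤ S →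
             solveInput σ A (encodeForest ts) ∷ closure ρ solveF ∷ ρ ⊢ solveF ↓ encodeTable (solveForest M σ A ts) ∣ forestTime ts · 16
        go σ A []               nσ _               A≤S = weaken (m≤m+n 9 91) (case-nil↓ (snd↓ (snd↓ (snd↓ var↓))) (fst↓ (snd↓ (snd↓ var↓))))
        go σ A (node s us ∷ ts) nσ (nτ , nus , nts) A≤S = combine τ (encodeSubset≡ s) nσ nτ A≤S (length-solve nτ _ us (initial≤S nτ))
            (go τ (initial τ) us nτ nus (initial≤S nτ)) (go σ _ ts nσ nts (length-join nσ A _)) refl
          where τ = Vec.lookup s

-- Correctness of the tables

false≢true : false ≢ true
false≢true ()

∧-true : ∀ {a b} → a ∧ b ≡ true → a ≡ true × b ≡ true
∧-true {true} {true} _ = refl , refl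

allᵇ-sound : ∀ {n} (f : Fin n → Bool) → allᵇ f ≡ true → ∀ v → f v ≡ true
allᵇ-sound f h zero    = proj₁ (∧-true {f zero} h)
allᵇ-sound f h (suc v) = allᵇ-sound (f ∘ suc) (proj₂ (∧-true {f zero} h)) v

allᵇ-complete : ∀ {n} (f : Fin n → Bool) → (∀ v → f v ≡ true) → allᵇ f ≡ true
allᵇ-complete {zero}  f h = refl
allᵇ-complete {suc n} f h = cong₂ _∧_ (h zero) (allᵇ-complete (f ∘ suc) (h ∘ suc))

≤ᵇ-sound : ∀ {m n} → (m ≤ᵇ n) ≡ true → m ≤ n
≤ᵇ-sound {m} {n} h = ≤ᵇ⇒≤ m n (Equivalence.from T-≡ h)

≤ᵇ-complete : ∀ {m n} → m ≤ n → (m ≤ᵇ n) ≡ true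
≤ᵇ-complete h = Equivalence.to T-≡ (≤⇒≤ᵇ h)

equalᵇ-sound : ∀ {n} (f g : Fin n → ℕ) → equalᵇ f g ≡ true → f ≗ g
equalᵇ-sound f g h v = ≤-antisym (≤ᵇ-sound (proj₁ both)) (≤ᵇ-sound (proj₂ both))
  where both = ∧-true {f v ≤ᵇ g v} (allᵇ-sound _ h v)

equalᵇ-complete : ∀ {n} (f g : Fin n → ℕ) → f ≗ g → equalᵇ f g ≡ true
equalᵇ-complete f g h = allᵇ-complete _ λ v →
  cong₂ _∧_ (≤ᵇ-complete (≤-reflexive (h v))) (≤ᵇ-complete (≤-reflexive (sym (h v))))

sum-zero : ∀ {n} {f : Fin n → ℕ} → (∀ u → f u ≡ 0) → sum f ≡ 0
sum-zero {n} h = trans (sum-cong-≗ h) (sum-replicate-zero n)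

sum-split : ∀ {n} {f g f′ g′ : Fin n → ℕ} → (∀ u → f u + g u ≡ f′ u + g′ u) → sum f + sum g ≡ sum f′ + sum g′
sum-split {f = f} {g} {f′} {g′} h =
  trans (sym (∑-distrib-+ f g)) (trans (sum-cong-≗ h) (∑-distrib-+ f′ g′))

double-injective : ∀ {m n} → m + m ≡ n + n → m ≡ n
double-injective {zero}  {zero}  h = refl
double-injective {suc m} {suc n} h = cong suc (double-injective
  (suc-injective (trans (sym (+-suc m m)) (trans (suc-injective h) (+-suc n n)))))

double≢suc-double : ∀ m n → m + m ≢ suc (n + n)
double≢suc-double (suc m) zero    h with trans (sym (+-suc m m)) (suc-injective h)
... | ()
double≢suc-double (suc m) (suc n) h = double≢suc-double m n
  (suc-injective (trans (sym (+-suc m m)) (trans (suc-injective h) (cong suc (+-suc n n)))))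

-- Zero, odd and positive even values stand for uncoloured, `false` and `true`, so parity separates
-- the colours. The two hypotheses restore the degree that an uncoloured entry does not record.
keyEntry-injective : ∀ p q {d e} → (p ≡ nothing → d ≡ 0) → (q ≡ nothing → e ≡ 0) →
                     keyEntry true p d ≡ keyEntry true q e → p ≡ q × d ≡ e
keyEntry-injective nothing      nothing      hp hq h = refl , trans (hp refl) (sym (hq refl))
keyEntry-injective nothing      (just true)  hp hq ()
keyEntry-injective nothing      (just false) hp hq ()
keyEntry-injective (just true)  nothing      hp hq ()
keyEntry-injective (just false) nothing      hp hq ()
keyEntry-injective (just true)  (just true)  hp hq h = refl , double-injective (suc-injective (suc-injective h))
keyEntry-injective (just false) (just false) hp hq h = refl , double-injective (suc-injective h)
keyEntry-injective (just true)  (just false) {d} {e} hp hq h = contradiction (suc-injective (sym h)) (double≢suc-double e d)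
keyEntry-injective (just false) (just true)  {d} {e} hp hq h = contradiction (suc-injective h) (double≢suc-double d e)

-- Restriction and merging of partial cuts

differ-refl : ∀ p → differ p p ≡ false
differ-refl nothing  = refl
differ-refl (just b) = xor-same b

restrict : ∀ {n} → Indicator n → Partial n → Partial n
restrict D P v = if D v then P v else nothing

HasDomain : ∀ {n} → Partial n → Indicator n → Set
HasDomain P D = ∀ v → is-just (P v) ≡ D v

outside-domain : ∀ {n} {P : Partial n} {D} → HasDomain P D → ∀ {v} → D v ≡ false → P v ≡ nothing
outside-domain {P = P} dom {v} h with P v | trans (dom v) h
... | nothing | _ = refl

restrict-merge-left : ∀ {n} {P Q : Partial n} {D} → HasDomain P D → restrict D (merge P Q) ≗ P
restrict-merge-left {P = P} {D = D} dom v with D v | P v | dom v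
... | true  | just b  | _ = refl
... | false | nothing | _ = refl

-- `merge` prefers its left argument, so on this side the two cuts have to agree on the overlap.
restrict-merge-right : ∀ {n} {P Q : Partial n} {D E} → HasDomain P D → HasDomain Q E →
  (∀ v → D v ≡ true → E v ≡ true → P v ≡ Q v) → restrict E (merge P Q) ≗ Q
restrict-merge-right {P = P} {Q} {D} {E} domP domQ agree v with E v in eE | D v in eD
... | false | _     = sym (outside-domain {P = Q} domQ eE)
... | true  | false rewrite outside-domain {P = P} domP eD = refl
... | true  | true  rewrite agree v eD eE with Q v
...   | just b  = refl
...   | nothing = refl

-- Settled cuts, keys and table operations

module _ {n} (M : Matrix n) where

  cutDeg-cong : ∀ {P Q} → P ≗ Q → ∀ v → cutDeg M P v ≡ cutDeg M Q v
  cutDeg-cong P≗Q v = sum-cong-≗ λ u → cong₂ (λ p q → crossing p (M v u) q) (P≗Q v) (P≗Q u)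

  total-cong : ∀ {P Q} → P ≗ Q → total M P ≡ total M Q
  total-cong P≗Q = sum-cong-≗ (cutDeg-cong P≗Q)

  cutDeg-nothing : ∀ P {v} → P v ≡ nothing → cutDeg M P v ≡ 0
  cutDeg-nothing P {v} h = sum-zero λ u → cong (λ p → crossing p (M v u) (P u)) h

  Settled : Indicator n → Partial n → Set
  Settled σ P = ∀ v → σ v ≡ false → is-just (P v) ≡ true → rowDegree (M v) ≤ cutDeg M P v + cutDeg M P v

  settledᵇ-sound : ∀ σ P → settledᵇ M σ P ≡ true → Settled σ P
  settledᵇ-sound σ P h v σv Pv with σ v | is-just (P v) | allᵇ-sound _ h v
  settledᵇ-sound σ P h v refl refl | false | true | st = ≤ᵇ-sound st

  settledᵇ-complete : ∀ σ P → Settled σ P → settledᵇ M σ P ≡ true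
  settledᵇ-complete σ P h = allᵇ-complete _ go
    where
    go : ∀ v → σ v ∨ (not (is-just (P v)) ∨ stableᵇ M P v) ≡ true
    go v with σ v in eσ | is-just (P v) in eP
    ... | true  | _     = refl
    ... | false | false = refl
    ... | false | true  = ≤ᵇ-complete (h v eσ eP)

  module _ (σ : Indicator n) where

    SameKey : Partial n → Partial n → Set
    SameKey P Q = key M σ P ≗ key M σ Q

    Agree : Partial n → Partial n → Set
    Agree P Q = ∀ v → σ v ≡ true → P v ≡ Q v × cutDeg M P v ≡ cutDeg M Q v

    sameKey⇒agree : ∀ P Q → SameKey P Q → Agree P Q
    sameKey⇒agree P Q h v σv = keyEntry-injective (P v) (Q v) (cutDeg-nothing P) (cutDeg-nothing Q)
      (subst (λ b → keyEntry b (P v) (cutDeg M P v) ≡ keyEntry b (Q v) (cutDeg M Q v)) σv (h v))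

    agree⇒sameKey : ∀ P Q → Agree P Q → SameKey P Q
    agree⇒sameKey P Q h v with σ v in eq
    ... | false = refl
    ... | true  = cong₂ (keyEntry true) (proj₁ (h v eq)) (proj₂ (h v eq))

    -- Membership does not survive `insert`, which may replace an entry by one with the same key
    -- that is no heavier. Being dominated by an entry does survive, and it is transitive.
    record Covers (A : List (Partial n)) (P : Partial n) : Set where
      constructor covered
      field
        {cover}  : Partial n
        cover∈   : cover ∈ A
        sameKey  : SameKey cover P
        lighter  : total M cover ≤ total M P

    covers-trans : ∀ {A P Q} → Covers A P → SameKey P Q → total M P ≤ total M Q → Covers A Q
    covers-trans (covered ∈A same ≤P) same′ ≤Q = covered ∈A (λ v → trans (same v) (same′ v)) (≤-trans ≤P ≤Q)

    covers-mono : ∀ {A A′ P} → (∀ {Q} → Q ∈ A → Covers A′ Q) → Covers A P → Covers A′ P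
    covers-mono f (covered ∈A same ≤P) = covers-trans (f ∈A) same ≤P

    covers-self : ∀ {A P} → P ∈ A → Covers A P
    covers-self ∈A = covered ∈A (λ v → refl) ≤-refl

    insert-⊆ : ∀ P A {Q} → Q ∈ insert M σ P A → Q ≡ P ⊎ Q ∈ A
    insert-⊆ P []      (here refl) = inj₁ refl
    insert-⊆ P (Q ∷ A) h with equalᵇ (key M σ P) (key M σ Q) | total M P ≤ᵇ total M Q | h
    ... | true  | true  | here refl = inj₁ refl
    ... | true  | true  | there i   = inj₂ (there i)
    ... | true  | false | i         = inj₂ i
    ... | false | _     | here refl = inj₂ (here refl)
    ... | false | _     | there i   with insert-⊆ P A i
    ...   | inj₁ eq = inj₁ eq
    ...   | inj₂ j  = inj₂ (there j)

    insert-covers-new : ∀ P A → Covers (insert M σ P A) P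
    insert-covers-new P []      = covers-self (here refl)
    insert-covers-new P (Q ∷ A) with equalᵇ (key M σ P) (key M σ Q) in eqKey | total M P ≤ᵇ total M Q in eqTotal
    ... | true  | true  = covers-self (here refl)
    ... | true  | false = covered (here refl) (λ v → sym (equalᵇ-sound (key M σ P) (key M σ Q) eqKey v))
                            (≰⇒≥ λ P≤Q → false≢true (trans (sym eqTotal) (≤ᵇ-complete P≤Q)))
    ... | false | _     = covers-mono (covers-self ∘ there) (insert-covers-new P A)

    insert-covers-old : ∀ P A {R} → R ∈ A → Covers (insert M σ P A) R
    insert-covers-old P (Q ∷ A) R∈ with equalᵇ (key M σ P) (key M σ Q) in eqKey | total M P ≤ᵇ total M Q in eqTotal | R∈
    ... | true  | true  | here refl = covered (here refl) (equalᵇ-sound (key M σ P) (key M σ Q) eqKey) (≤ᵇ-sound eqTotal)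
    ... | true  | true  | there i   = covers-self (there i)
    ... | true  | false | i         = covers-self i
    ... | false | _     | here refl = covers-self (here refl)
    ... | false | _     | there i   = covers-mono (covers-self ∘ there) (insert-covers-old P A i)

    -- Serves twice: it bounds the length of a table by the number of keys, and it leaves at most
    -- one entry in the last table, where all keys are equal.
    Distinct : List (Partial n) → Set
    Distinct = AllPairs λ P Q → ¬ SameKey P Q

    insert-fresh : ∀ {X} P A → ¬ SameKey X P → All (λ Q → ¬ SameKey X Q) A → All (λ Q → ¬ SameKey X Q) (insert M σ P A)
    insert-fresh P []      X≁P []          = X≁P ∷ []
    insert-fresh P (Q ∷ A) X≁P (X≁Q ∷ X≁A) with equalᵇ (key M σ P) (key M σ Q) | total M P ≤ᵇ total M Q
    ... | true  | true  = X≁P ∷ X≁A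
    ... | true  | false = X≁Q ∷ X≁A
    ... | false | _     = X≁Q ∷ insert-fresh P A X≁P X≁A

    insert-distinct : ∀ P A → Distinct A → Distinct (insert M σ P A)
    insert-distinct P []      []        = [] ∷ []
    insert-distinct P (Q ∷ A) (Q≁A ∷ A≁) with equalᵇ (key M σ P) (key M σ Q) in eqKey | total M P ≤ᵇ total M Q
    ... | true  | true  = All.map (λ Q≁R P∼R → Q≁R λ v → trans (sym (equalᵇ-sound (key M σ P) (key M σ Q) eqKey v)) (P∼R v)) Q≁A ∷ A≁
    ... | true  | false = Q≁A ∷ A≁
    ... | false | _     = insert-fresh P A (λ Q∼P → false≢true (trans (sym eqKey) (equalᵇ-complete (key M σ P) (key M σ Q) λ v → sym (Q∼P v)))) Q≁A
                          ∷ insert-distinct P A A≁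

    mergeInto-distinct : ∀ P A R → Distinct A → Distinct (mergeInto M σ P A R)
    mergeInto-distinct P A []      A≁ = A≁
    mergeInto-distinct P A (Q ∷ R) A≁ with compatible P Q | settledᵇ M σ (merge P Q)
    ... | true  | true  = insert-distinct (merge P Q) _ (mergeInto-distinct P A R A≁)
    ... | true  | false = mergeInto-distinct P A R A≁
    ... | false | _     = mergeInto-distinct P A R A≁

    join-distinct : ∀ A R → Distinct (join M σ A R)
    join-distinct []      R = []
    join-distinct (P ∷ A) R = mergeInto-distinct P _ R (join-distinct A R)

    Merged : List (Partial n) → List (Partial n) → Partial n → Set
    Merged A R X = Σ[ P ∈ Partial n ] Σ[ Q ∈ Partial n ] (P ∈ A × Q ∈ R × X ≡ merge P Q × Settled σ X)

    mergeInto-⊆ : ∀ P A R {X} → X ∈ mergeInto M σ P A R →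
                  X ∈ A ⊎ (Σ[ Q ∈ Partial n ] (Q ∈ R × X ≡ merge P Q × Settled σ X))
    mergeInto-⊆ P A []      i = inj₁ i
    mergeInto-⊆ P A (Q ∷ R) i with compatible P Q | settledᵇ M σ (merge P Q) in eq
    ... | true  | true  with insert-⊆ (merge P Q) (mergeInto M σ P A R) i
    ...   | inj₁ refl = inj₂ (Q , here refl , refl , settledᵇ-sound σ (merge P Q) eq)
    ...   | inj₂ j    with mergeInto-⊆ P A R j
    ...     | inj₁ k                    = inj₁ k
    ...     | inj₂ (Q′ , Q′∈ , eq′ , st) = inj₂ (Q′ , there Q′∈ , eq′ , st)
    mergeInto-⊆ P A (Q ∷ R) i | true  | false with mergeInto-⊆ P A R i
    ...     | inj₁ k                    = inj₁ k
    ...     | inj₂ (Q′ , Q′∈ , eq′ , st) = inj₂ (Q′ , there Q′∈ , eq′ , st)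
    mergeInto-⊆ P A (Q ∷ R) i | false | _ with mergeInto-⊆ P A R i
    ...     | inj₁ k                    = inj₁ k
    ...     | inj₂ (Q′ , Q′∈ , eq′ , st) = inj₂ (Q′ , there Q′∈ , eq′ , st)

    mergeInto-covers-old : ∀ P A R {X} → X ∈ A → Covers (mergeInto M σ P A R) X
    mergeInto-covers-old P A []      i = covers-self i
    mergeInto-covers-old P A (Q ∷ R) i with compatible P Q | settledᵇ M σ (merge P Q)
    ... | true  | true  = covers-mono (insert-covers-old (merge P Q) (mergeInto M σ P A R)) (mergeInto-covers-old P A R i)
    ... | true  | false = mergeInto-covers-old P A R i
    ... | false | _     = mergeInto-covers-old P A R i

    mergeInto-covers-new : ∀ P A R {Q} → Q ∈ R → compatible P Q ≡ true → settledᵇ M σ (merge P Q) ≡ true →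
                           Covers (mergeInto M σ P A R) (merge P Q)
    mergeInto-covers-new P A (Q ∷ R) (here refl) c s rewrite c | s = insert-covers-new (merge P Q) (mergeInto M σ P A R)
    mergeInto-covers-new P A (Q ∷ R) (there i)   c s with compatible P Q | settledᵇ M σ (merge P Q)
    ... | true  | true  = covers-mono (insert-covers-old (merge P Q) (mergeInto M σ P A R)) (mergeInto-covers-new P A R i c s)
    ... | true  | false = mergeInto-covers-new P A R i c s
    ... | false | _     = mergeInto-covers-new P A R i c s

    join-⊆ : ∀ A R {X} → X ∈ join M σ A R → Merged A R X
    join-⊆ (P ∷ A) R i with mergeInto-⊆ P (join M σ A R) R i
    ... | inj₂ (Q , Q∈ , eq , st) = P , Q , here refl , Q∈ , eq , st
    ... | inj₁ j with join-⊆ A R j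
    ...   | P′ , Q , P′∈ , rest = P′ , Q , there P′∈ , rest

    join-covers : ∀ A R {P Q} → P ∈ A → Q ∈ R → compatible P Q ≡ true → settledᵇ M σ (merge P Q) ≡ true →
                  Covers (join M σ A R) (merge P Q)
    join-covers (P ∷ A) R (here refl) j c s = mergeInto-covers-new P _ R j c s
    join-covers (P ∷ A) R (there i)   j c s = covers-mono (mergeInto-covers-old P _ R) (join-covers A R i j c s)

  -- `D` holds the vertices processed so far. The first two fields are soundness. The third asks for
  -- domination of every settled cut on `D`, whether or not it extends to a stable cut of the whole
  -- graph; this is what makes the invariant inductive.
  record Represents (σ D : Indicator n) (A : List (Partial n)) : Set where
    field
      domain  : ∀ {P} → P ∈ A → HasDomain P D
      settled : ∀ {P} → P ∈ A → Settled σ P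
      covers  : ∀ Q → HasDomain Q D → Settled σ Q → Covers σ A Q

  -- A separation of the graph with the overlap inside both bags. Between the two sides edges of
  -- weight zero are allowed, as they contribute to no cut degree.
  record Separates (σ D τ E : Indicator n) : Set where
    field
      shared  : ∀ v → D v ≡ true → E v ≡ true → σ v ≡ true × τ v ≡ true
      no-edge : ∀ u v → D u ≡ true → E u ≡ false → D v ≡ false → E v ≡ true → fromMaybe 0 (M u v) ≡ 0

  crossing-zero : ∀ p r q → fromMaybe 0 r ≡ 0 → crossing p r q ≡ 0
  crossing-zero p r q h with differ p q
  ... | true  = h
  ... | false = refl

  crossing-nothing : ∀ p r → crossing p r nothing ≡ 0
  crossing-nothing nothing  r = refl
  crossing-nothing (just _) r = refl

  module _ (M-sym : ∀ u v → M u v ≡ M v u) (D E : Indicator n) where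

    NoEdge : Set
    NoEdge = ∀ u v → D u ≡ true → E u ≡ false → D v ≡ false → E v ≡ true → fromMaybe 0 (M u v) ≡ 0

    module _ (no-edge : NoEdge) (X : Partial n) (dom : HasDomain X (λ v → D v ∨ E v)) where

      private
        X₀ = restrict (λ v → D v ∧ E v) X
        X₁ = restrict D X
        X₂ = restrict E X

      -- Inclusion and exclusion for one ordered pair. A pair inside `D` or inside `E` balances by
      -- counting. Any other pair has an uncoloured end, or it joins the two sides and has weight
      -- zero by `no-edge`.
      crossing-split : ∀ v u → crossing (X v) (M v u) (X u) + crossing (X₀ v) (M v u) (X₀ u) ≡
                               crossing (X₁ v) (M v u) (X₁ u) + crossing (X₂ v) (M v u) (X₂ u)
      crossing-split v u with D v in Dv | E v in Ev | D u in Du | E u in Eu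
      ... | true  | true  | true  | true  = refl
      ... | true  | true  | true  | false = cong (crossing (X v) (M v u) (X u) +_) (trans (crossing-nothing (X v) (M v u)) (sym (crossing-nothing (X v) (M v u))))
      ... | true  | true  | false | true  = trans (cong (crossing (X v) (M v u) (X u) +_) (crossing-nothing (X v) (M v u))) (trans (+-comm _ 0)
              (cong (_+ crossing (X v) (M v u) (X u)) (sym (crossing-nothing (X v) (M v u)))))
      ... | true  | true  | false | false rewrite outside-domain {P = X} dom {u} (cong₂ _∨_ Du Eu) = refl
      ... | true  | false | true  | true  = refl
      ... | true  | false | true  | false = refl
      ... | true  | false | false | true  = cong (_+ 0) (trans (crossing-zero (X v) (M v u) (X u) (no-edge v u Dv Ev Du Eu)) (sym (crossing-nothing (X v) (M v u))))
      ... | true  | false | false | false rewrite outside-domain {P = X} dom {u} (cong₂ _∨_ Du Eu) = refl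
      ... | false | true  | true  | true  = +-comm _ 0
      ... | false | true  | true  | false = trans (+-identityʳ _) (trans
              (crossing-zero (X v) (M v u) (X u) (trans (cong (fromMaybe 0) (M-sym v u)) (no-edge u v Du Eu Dv Ev)))
              (sym (crossing-nothing (X v) (M v u))))
      ... | false | true  | false | true  = +-comm _ 0
      ... | false | true  | false | false rewrite outside-domain {P = X} dom {u} (cong₂ _∨_ Du Eu) = +-comm (crossing (X v) (M v u) nothing) 0
      ... | false | false | _     | _     rewrite outside-domain {P = X} dom {v} (cong₂ _∨_ Dv Ev) = refl

      cutDeg-split : ∀ v → cutDeg M X v + cutDeg M X₀ v ≡ cutDeg M X₁ v + cutDeg M X₂ v
      cutDeg-split v = sum-split (crossing-split v)

      total-split : total M X + total M X₀ ≡ total M X₁ + total M X₂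
      total-split = sum-split cutDeg-split

-- The exchange argument at a join

bool-cases : ∀ b → b ≡ true ⊎ b ≡ false
bool-cases true  = inj₁ refl
bool-cases false = inj₂ refl

restrict-inside : ∀ {n} D (P : Partial n) {v} → D v ≡ true → restrict D P v ≡ P v
restrict-inside D P {v} h = cong (λ b → if b then P v else nothing) h

restrict-outside : ∀ {n} D (P : Partial n) {v} → D v ≡ false → restrict D P v ≡ nothing
restrict-outside D P {v} h = cong (λ b → if b then P v else nothing) h

restrict-domain : ∀ {n} (P : Partial n) D → (∀ v → D v ≡ true → is-just (P v) ≡ true) → HasDomain (restrict D P) D
restrict-domain P D h v with D v in eq
... | true  = h v eq
... | false = refl

∨-true : ∀ {a b} → a ∨ b ≡ true → a ≡ true ⊎ b ≡ true
∨-true {true}  h = inj₁ refl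
∨-true {false} h = inj₂ h

module _ {n} (M : Matrix n) (M-sym : ∀ u v → M u v ≡ M v u) where

  open Represents

  -- Forgetting happens here: the vertices of `τ` outside `σ` are still open in `R` and have to be
  -- stable in the merged cut. So a competitor `Q` is settled outside `σ`, whereas its half on `E`
  -- only has to be settled outside `τ`.
  join-represents : ∀ {σ D τ E A R} → Represents M σ D A → Represents M τ E R → Separates M σ D τ E →
    (∀ v → σ v ≡ true → D v ≡ true) → (∀ v → τ v ≡ true → E v ≡ true) →
    Represents M σ (λ v → D v ∨ E v) (join M σ A R)
  join-represents {σ} {D} {τ} {E} {A} {R} repA repR sep σ⊆D τ⊆E = record
    { domain  = λ i → dom (join-⊆ M σ A R i)
    ; settled = λ i → let (_ , _ , _ , _ , _ , st) = join-⊆ M σ A R i in st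
    ; covers  = cover-all
    }
    where
    open Separates sep
    D∩E : Indicator n
    D∩E v = D v ∧ E v

    dom : ∀ {X} → Merged M σ A R X → HasDomain X (λ v → D v ∨ E v)
    dom (P , Q , P∈A , Q∈R , refl , _) v with P v | domain repA P∈A v | domain repR Q∈R v
    ... | nothing | d | e = cong₂ _∨_ d e
    ... | just _  | d | e = cong (_∨ E v) d

    cover-all : ∀ Q → HasDomain Q (λ v → D v ∨ E v) → Settled M σ Q → Covers M σ (join M σ A R) Q
    cover-all Q domQ stQ = covers-trans M σ
      (join-covers M σ A R P₁∈ P₂∈ compat (settledᵇ-complete M σ P stP))
      (agree⇒sameKey M σ P Q λ v σv → colorP v σv , degP v (λ _ → σv) (λ Ev → proj₂ (shared v (σ⊆D v σv) Ev)))
      lightP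
      where
      Q₀ = restrict D∩E Q
      Q₁ = restrict D Q
      Q₂ = restrict E Q

      domQ₁ : HasDomain Q₁ D
      domQ₁ = restrict-domain Q D λ v Dv → trans (domQ v) (cong (_∨ E v) Dv)

      domQ₂ : HasDomain Q₂ E
      domQ₂ = restrict-domain Q E λ v Ev → trans (domQ v) (trans (cong (D v ∨_) Ev) (∨-zeroʳ (D v)))

      module _ (X : Partial n) (domX : HasDomain X (λ v → D v ∨ E v)) where

        -- Outside `E` both the overlap term and the `E` term of `cutDeg-split` vanish.
        degree-left : ∀ {v} → E v ≡ false → cutDeg M X v ≡ cutDeg M (restrict D X) v
        degree-left {v} Ev = +-cancelʳ-≡ 0 _ _ (begin
          cutDeg M X v + 0                                     ≡⟨ cong (cutDeg M X v +_) (sym (cutDeg-nothing M (restrict D∩E X) (restrict-outside D∩E X (trans (cong (D v ∧_) Ev) (∧-false (D v)))))) ⟩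
          cutDeg M X v + cutDeg M (restrict D∩E X) v ≡⟨ cutDeg-split M M-sym D E no-edge X domX v ⟩
          cutDeg M (restrict D X) v + cutDeg M (restrict E X) v ≡⟨ cong (cutDeg M (restrict D X) v +_) (cutDeg-nothing M (restrict E X) (restrict-outside E X Ev)) ⟩
          cutDeg M (restrict D X) v + 0                        ∎)
          where
          open ≡-Reasoning
          ∧-false : ∀ b → b ∧ false ≡ false
          ∧-false true  = refl
          ∧-false false = refl

        degree-right : ∀ {v} → D v ≡ false → cutDeg M X v ≡ cutDeg M (restrict E X) v
        degree-right {v} Dv = +-cancelʳ-≡ 0 _ _ (begin
          cutDeg M X v + 0                                     ≡⟨ cong (cutDeg M X v +_) (sym (cutDeg-nothing M (restrict D∩E X) (restrict-outside D∩E X (cong (_∧ E v) Dv)))) ⟩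
          cutDeg M X v + cutDeg M (restrict D∩E X) v ≡⟨ cutDeg-split M M-sym D E no-edge X domX v ⟩
          cutDeg M (restrict D X) v + cutDeg M (restrict E X) v ≡⟨ cong (_+ cutDeg M (restrict E X) v) (cutDeg-nothing M (restrict D X) (restrict-outside D X Dv)) ⟩
          cutDeg M (restrict E X) v                            ≡⟨ sym (+-identityʳ _) ⟩
          cutDeg M (restrict E X) v + 0                        ∎)
          where open ≡-Reasoning

      stQ₁ : Settled M σ Q₁
      stQ₁ v σv Q₁v = subst (λ d → rowDegree (M v) ≤ d + d) (degree-left Q domQ Ev)
        (stQ v σv (trans (domQ v) (cong (_∨ E v) Dv)))
        where
        Dv = trans (sym (domQ₁ v)) Q₁v
        Ev : E v ≡ false
        Ev with bool-cases (E v)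
        ... | inj₂ h = h
        ... | inj₁ h = contradiction (trans (sym σv) (proj₁ (shared v Dv h))) false≢true

      -- A vertex of `E` outside `τ` is not in the overlap, hence not in `D` and so not in `σ`. Thus
      -- `Q` is stable there, and its cut degree is that of the half `Q₂`.
      stQ₂ : Settled M τ Q₂
      stQ₂ v τv Q₂v = subst (λ d → rowDegree (M v) ≤ d + d) (degree-right Q domQ Dv)
        (stQ v σv (trans (domQ v) (trans (cong (D v ∨_) Ev) (∨-zeroʳ (D v)))))
        where
        Ev = trans (sym (domQ₂ v)) Q₂v
        Dv : D v ≡ false
        Dv with bool-cases (D v)
        ... | inj₂ h = h
        ... | inj₁ h = contradiction (trans (sym τv) (proj₂ (shared v h Ev))) false≢true
        σv : σ v ≡ false
        σv with bool-cases (σ v)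
        ... | inj₂ h = h
        ... | inj₁ h = contradiction (trans (sym Dv) (σ⊆D v h)) false≢true

      open Covers (covers repA Q₁ domQ₁ stQ₁) renaming (cover to P₁; cover∈ to P₁∈; sameKey to same₁; lighter to light₁)
      open Covers (covers repR Q₂ domQ₂ stQ₂) renaming (cover to P₂; cover∈ to P₂∈; sameKey to same₂; lighter to light₂)

      P = merge P₁ P₂

      domP₁ = domain repA P₁∈
      domP₂ = domain repR P₂∈

      domP : HasDomain P (λ v → D v ∨ E v)
      domP v with P₁ v | domP₁ v
      ... | nothing | d = cong₂ _∨_ d (domP₂ v)
      ... | just _  | d = cong (_∨ E v) d

      agree₁ : Agree M σ P₁ Q₁
      agree₁ = sameKey⇒agree M σ P₁ Q₁ same₁

      agree₂ : Agree M τ P₂ Q₂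
      agree₂ = sameKey⇒agree M τ P₂ Q₂ same₂

      color₁ : ∀ v → σ v ≡ true → P₁ v ≡ Q v
      color₁ v σv = trans (proj₁ (agree₁ v σv)) (restrict-inside D Q (σ⊆D v σv))

      color₂ : ∀ v → τ v ≡ true → P₂ v ≡ Q v
      color₂ v τv = trans (proj₁ (agree₂ v τv)) (restrict-inside E Q (τ⊆E v τv))

      P₁≡P₂ : ∀ v → D v ≡ true → E v ≡ true → P₁ v ≡ P₂ v
      P₁≡P₂ v Dv Ev = trans (color₁ v (proj₁ (shared v Dv Ev))) (sym (color₂ v (proj₂ (shared v Dv Ev))))

      left : restrict D P ≗ P₁
      left = restrict-merge-left {P = P₁} {P₂} {D} domP₁

      right : restrict E P ≗ P₂
      right = restrict-merge-right {P = P₁} {P₂} {D} {E} domP₁ domP₂ P₁≡P₂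

      colorP : ∀ v → σ v ≡ true → P v ≡ Q v
      colorP v σv = trans (sym (restrict-inside D P (σ⊆D v σv))) (trans (left v) (color₁ v σv))

      -- The overlap lies in `σ`, where the key records the colours, so `P` and `Q` have the same
      -- correction term in the split identities and it cancels.
      middle : restrict D∩E P ≗ Q₀
      middle v with bool-cases (D v ∧ E v)
      ... | inj₂ h = trans (restrict-outside D∩E P h) (sym (restrict-outside D∩E Q h))
      ... | inj₁ h = trans (restrict-inside D∩E P h)
        (trans (colorP v (proj₁ (shared v (proj₁ (∧-true h)) (proj₂ (∧-true {D v} h))))) (sym (restrict-inside D∩E Q h)))

      compat : compatible P₁ P₂ ≡ true
      compat = allᵇ-complete _ go
        where
        go : ∀ v → not (differ (P₁ v) (P₂ v)) ≡ true
        go v with bool-cases (D v) | bool-cases (E v)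
        ... | inj₂ Dv | _       rewrite outside-domain {P = P₁} {D} domP₁ Dv = refl
        ... | inj₁ Dv | inj₁ Ev rewrite P₁≡P₂ v Dv Ev = cong not (differ-refl (P₂ v))
        ... | inj₁ Dv | inj₂ Ev rewrite outside-domain {P = P₂} {E} domP₂ Ev with P₁ v
        ...   | nothing = refl
        ...   | just _  = refl

      -- The two implications make it apply to the vertices of `σ` and also to those vertices of `τ`
      -- that lie outside `D`. A half that does not contain `v` contributes degree zero on either
      -- side.
      degP : ∀ v → (D v ≡ true → σ v ≡ true) → (E v ≡ true → τ v ≡ true) → cutDeg M P v ≡ cutDeg M Q v
      degP v D⇒σ E⇒τ = +-cancelʳ-≡ (cutDeg M Q₀ v) _ _ (begin
        cutDeg M P v + cutDeg M Q₀ v                ≡⟨ cong (cutDeg M P v +_) (sym (cutDeg-cong M middle v)) ⟩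
        cutDeg M P v + cutDeg M (restrict D∩E P) v    ≡⟨ cutDeg-split M M-sym D E no-edge P domP v ⟩
        cutDeg M (restrict D P) v + cutDeg M (restrict E P) v ≡⟨ cong₂ _+_ (cutDeg-cong M left v) (cutDeg-cong M right v) ⟩
        cutDeg M P₁ v + cutDeg M P₂ v               ≡⟨ cong₂ _+_ one two ⟩
        cutDeg M Q₁ v + cutDeg M Q₂ v               ≡⟨ sym (cutDeg-split M M-sym D E no-edge Q domQ v) ⟩
        cutDeg M Q v + cutDeg M Q₀ v                ∎)
        where
        open ≡-Reasoning
        one : cutDeg M P₁ v ≡ cutDeg M Q₁ v
        one with bool-cases (D v)
        ... | inj₁ Dv = proj₂ (agree₁ v (D⇒σ Dv))
        ... | inj₂ Dv = trans (cutDeg-nothing M P₁ (outside-domain {P = P₁} {D} domP₁ Dv)) (sym (cutDeg-nothing M Q₁ (restrict-outside D Q Dv)))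
        two : cutDeg M P₂ v ≡ cutDeg M Q₂ v
        two with bool-cases (E v)
        ... | inj₁ Ev = proj₂ (agree₂ v (E⇒τ Ev))
        ... | inj₂ Ev = trans (cutDeg-nothing M P₂ (outside-domain {P = P₂} {E} domP₂ Ev)) (sym (cutDeg-nothing M Q₂ (restrict-outside E Q Ev)))

      lightP : total M P ≤ total M Q
      lightP = +-cancelʳ-≤ (total M Q₀) _ _ (begin
        total M P + total M Q₀                            ≡⟨ cong (total M P +_) (sym (total-cong M middle)) ⟩
        total M P + total M (restrict D∩E P)                ≡⟨ total-split M M-sym D E no-edge P domP ⟩
        total M (restrict D P) + total M (restrict E P)   ≡⟨ cong₂ _+_ (total-cong M left) (total-cong M right) ⟩
        total M P₁ + total M P₂                           ≤⟨ +-mono-≤ light₁ light₂ ⟩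
        total M Q₁ + total M Q₂                           ≡⟨ sym (total-split M M-sym D E no-edge Q domQ) ⟩
        total M Q + total M Q₀                            ∎)
        where open ≤-Reasoning

      stP : Settled M σ P
      stP v σv Pv with bool-cases (D v) | bool-cases (E v)
      ... | inj₁ Dv | inj₁ Ev = contradiction (trans (sym σv) (proj₁ (shared v Dv Ev))) false≢true
      ... | inj₂ Dv | inj₂ Ev = contradiction (trans (sym (cong₂ _∨_ Dv Ev)) (trans (sym (domP v)) Pv)) false≢true
      ... | inj₁ Dv | inj₂ Ev = subst (λ d → rowDegree (M v) ≤ d + d)
              (sym (trans (degree-left P domP Ev) (cutDeg-cong M left v)))
              (settled repA P₁∈ v σv (trans (domP₁ v) Dv))
      ... | inj₂ Dv | inj₁ Ev with bool-cases (τ v)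
      ...   | inj₂ τv = subst (λ d → rowDegree (M v) ≤ d + d)
              (sym (trans (degree-right P domP Dv) (cutDeg-cong M right v)))
              (settled repR P₂∈ v τv (trans (domP₂ v) Ev))
      -- A vertex forgotten by this very join: the table `R` says nothing about its stability, but
      -- `Q` is stable there and `P` has the same cut degree.
      ...   | inj₁ τv = subst (λ d → rowDegree (M v) ≤ d + d)
              (sym (degP v (λ Dv′ → contradiction (trans (sym Dv) Dv′) false≢true) (λ _ → τv)))
              (stQ v σv (trans (domQ v) (trans (cong (D v ∨_) Ev) (∨-zeroʳ (D v)))))

-- Initial tables and the recursion along the tree

extend-∈ : ∀ {n} b (A : List (Partial n)) {X} → X ∈ extend b A →
           Σ[ c ∈ Maybe Bool ] Σ[ P ∈ Partial n ] (P ∈ A × X ≡ c Vector.∷ P × is-just c ≡ b)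
extend-∈ true  (P ∷ A) (here refl)         = just false , P , here refl , refl , refl
extend-∈ true  (P ∷ A) (there (here refl)) = just true , P , here refl , refl , refl
extend-∈ true  (P ∷ A) (there (there i))   with extend-∈ true A i
... | c , Q , j , rest = c , Q , there j , rest
extend-∈ false (P ∷ A) (here refl)         = nothing , P , here refl , refl , refl
extend-∈ false (P ∷ A) (there i)           with extend-∈ false A i
... | c , Q , j , rest = c , Q , there j , rest

∈-extend : ∀ {n} c {A : List (Partial n)} {P} → P ∈ A → (c Vector.∷ P) ∈ extend (is-just c) A
∈-extend nothing      (here refl) = here refl
∈-extend (just false) (here refl) = here refl
∈-extend (just true)  (here refl) = there (here refl)
∈-extend nothing      (there i)   = there (∈-extend nothing i)
∈-extend (just false) (there i)   = there (there (∈-extend (just false) i))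
∈-extend (just true)  (there i)   = there (there (∈-extend (just true) i))

initial-domain : ∀ {n} (σ : Indicator n) {P} → P ∈ initial σ → HasDomain P σ
initial-domain {suc n} σ i v with extend-∈ (σ zero) (initial (σ ∘ suc)) i
initial-domain {suc n} σ i zero    | c , P , j , refl , h = h
initial-domain {suc n} σ i (suc v) | c , P , j , refl , h = initial-domain (σ ∘ suc) j v

-- The entry is only pointwise equal to `Q`, partial cuts being functions; keys and weights respect
-- pointwise equality.
initial-complete : ∀ {n} (σ : Indicator n) Q → HasDomain Q σ → Σ[ P ∈ Partial n ] (P ∈ initial σ × P ≗ Q)
initial-complete {zero}  σ Q dom = Vector.[] , here refl , λ ()
initial-complete {suc n} σ Q dom with initial-complete (σ ∘ suc) (Q ∘ suc) (dom ∘ suc)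
... | P , i , eq = Q zero Vector.∷ P
  , subst (λ b → (Q zero Vector.∷ P) ∈ extend b (initial (σ ∘ suc))) (dom zero) (∈-extend (Q zero) i)
  , λ { zero → refl ; (suc v) → eq v }

occurs : ∀ {n} → Tree (Subset n) → Indicator n
occursᶠ : ∀ {n} → List (Tree (Subset n)) → Indicator n
occurs (node s ts) v = Vec.lookup s v ∨ occursᶠ ts v
occursᶠ []       v = false
occursᶠ (t ∷ ts) v = occurs t v ∨ occursᶠ ts v

module _ {n} (M : Matrix n) where

  covers-≗ : ∀ {σ A P Q} → P ∈ A → P ≗ Q → Covers M σ A Q
  covers-≗ {σ} {P = P} {Q} i h = covered i
    (agree⇒sameKey M σ P Q λ v _ → h v , cutDeg-cong M h v) (≤-reflexive (total-cong M h))

  initial-represents : ∀ σ → Represents M σ σ (initial σ)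
  initial-represents σ = record
    { domain  = initial-domain σ
    ; settled = λ i v σv Pv → contradiction (trans (sym σv) (trans (sym (initial-domain σ i v)) Pv)) false≢true
    ; covers  = λ Q dom _ → let (P , i , eq) = initial-complete σ Q dom in covers-≗ i eq
    }

  blank-represents : Represents M (λ _ → false) (λ _ → false) ((λ _ → nothing) ∷ [])
  blank-represents = record
    { domain  = λ { (here refl) v → refl }
    ; settled = λ { (here refl) v _ () }
    ; covers  = λ Q dom _ → covers-≗ (here refl) λ v → sym (outside-domain {P = Q} dom refl)
    }

  represents-≗ : ∀ {σ D E A} → D ≗ E → Represents M σ D A → Represents M σ E A
  represents-≗ h rep = record
    { domain  = λ i v → trans (domain i v) (h v)
    ; settled = settled
    ; covers  = λ Q dom → covers Q λ v → trans (dom v) (sym (h v))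
    }
    where open Represents rep

  -- The separations needed by the joins of `solveForest`, with `D` growing by the vertices of each
  -- finished child.
  Separated : Indicator n → Indicator n → List (Tree (Subset n)) → Set
  Separated σ D []               = ⊤
  Separated σ D (node s us ∷ ts) =
    Separates M σ D (Vec.lookup s) (occurs (node s us)) ×
    Separated (Vec.lookup s) (Vec.lookup s) us ×
    Separated σ (λ v → D v ∨ occurs (node s us) v) ts

  solve-represents : (∀ u v → M u v ≡ M v u) → ∀ {σ D A} ts → Represents M σ D A → (∀ v → σ v ≡ true → D v ≡ true) →
    Separated σ D ts → Represents M σ (λ v → D v ∨ occursᶠ ts v) (solveForest M σ A ts)
  solve-represents M-sym {D = D} [] rep σ⊆D _ = represents-≗ (λ v → sym (∨-identityʳ (D v))) rep
  solve-represents M-sym {D = D} (node s us ∷ ts) rep σ⊆D (sep , sepᵘ , sepᵗ) =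
    represents-≗ (λ v → ∨-assoc (D v) _ _)
      (solve-represents M-sym ts
        (join-represents M M-sym rep
          (solve-represents M-sym us (initial-represents (Vec.lookup s)) (λ _ → id) sepᵘ)
          sep σ⊆D (λ v h → cong (_∨ occursᶠ us v) h))
        (λ v h → cong (_∨ occurs (node s us) v) (σ⊆D v h)) sepᵗ)

-- Separations from a tree decomposition

Joins : ∀ {n} {t : Tree (Subset n)} → Fin n → Node t → Node t → Set
Joins v x y = Parent x y × v ∈ₛ label x × v ∈ₛ label y

Connected : ∀ {n} → Tree (Subset n) → Set
Connected t = ∀ v (x y : Node t) → v ∈ₛ label x → v ∈ₛ label y → EqClosure (Joins v) x y

module _ {n} {s : Subset n} {t : Tree (Subset n)} {ts : List (Tree (Subset n))} where

  private
    T = node s (t ∷ ts)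

  inFirst : Node T → Bool
  inFirst root              = false
  inFirst (child zero x)    = true
  inFirst (child (suc i) x) = false

  -- A walk that enters or leaves the first subtree uses the edge above its root.
  crossing-walk : ∀ {v} {x y : Node T} → EqClosure (Joins v) x y →
                  inFirst x ≡ inFirst y ⊎ (v ∈ₛ s × v ∈ₛ label {t = t} root)
  crossing-walk {v} = EqClosure.fold equivalence edge
    where
    equivalence : IsEquivalence λ x y → inFirst x ≡ inFirst y ⊎ (v ∈ₛ s × v ∈ₛ label {t = t} root)
    equivalence = record
      { refl  = inj₁ refl
      ; sym   = Sum.map₁ sym
      ; trans = λ { (inj₁ p) (inj₁ q) → inj₁ (trans p q) ; (inj₁ p) (inj₂ q) → inj₂ q ; (inj₂ p) _ → inj₂ p }
      }
    edge : ∀ {x y} → Joins v x y → inFirst x ≡ inFirst y ⊎ (v ∈ₛ s × v ∈ₛ label {t = t} root)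
    edge (here {i = zero}  , vx , vy)  = inj₂ (vx , vy)
    edge (here {i = suc i} , _)        = inj₁ refl
    edge (below {i = zero}  _ , _)     = inj₁ refl
    edge (below {i = suc i} _ , _)     = inj₁ refl

  -- A retraction onto the first subtree that sends everything else to its root. Edges outside
  -- collapse to a point, so walks map to walks and connectedness is inherited.
  toFirst : Node T → Node t
  toFirst root              = root
  toFirst (child zero x)    = x
  toFirst (child (suc i) x) = root

  connected-first : Connected T → Connected t
  connected-first conn v x y vx vy =
    EqClosure.gfold (EqClosure.isEquivalence (Joins v)) toFirst edge (conn v (child zero x) (child zero y) vx vy)
    where
    edge : ∀ {x y} → Joins v x y → EqClosure (Joins v) (toFirst x) (toFirst y)
    edge (here {i = zero}   , _)        = EqClosure.reflexive _
    edge (here {i = suc i}  , _)        = EqClosure.reflexive _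
    edge (below {i = zero}  p , vx , vy) = EqClosure.return (p , vx , vy)
    edge (below {i = suc i} p , _)      = EqClosure.reflexive _

  -- The complementary retraction, which collapses the first subtree into the root.
  dropFirst : Node T → Node (node s ts)
  dropFirst root              = root
  dropFirst (child zero x)    = root
  dropFirst (child (suc i) x) = child i x

  connected-rest : Connected T → Connected (node s ts)
  connected-rest conn v x y vx vy = subst₂ (EqClosure (Joins v)) (drop-keep x) (drop-keep y)
    (EqClosure.gfold (EqClosure.isEquivalence (Joins v)) dropFirst edge (conn v (keep x) (keep y) (keep-label x vx) (keep-label y vy)))
    where
    keep : Node (node s ts) → Node T
    keep root        = root
    keep (child i x) = child (suc i) x
    keep-label : ∀ x → v ∈ₛ label x → v ∈ₛ label (keep x)
    keep-label root        h = h
    keep-label (child i x) h = h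
    drop-keep : ∀ x → dropFirst (keep x) ≡ x
    drop-keep root        = refl
    drop-keep (child i x) = refl
    edge : ∀ {x y} → Joins v x y → EqClosure (Joins v) (dropFirst x) (dropFirst y)
    edge (here {i = zero}   , _)         = EqClosure.reflexive _
    edge (here {i = suc i}  , vx , vy)   = EqClosure.return (here , vx , vy)
    edge (below {i = zero}  p , _)       = EqClosure.reflexive _
    edge (below {i = suc i} p , vx , vy) = EqClosure.return (below p , vx , vy)

occurs-node : ∀ {n} (t : Tree (Subset n)) {v} → occurs t v ≡ true → Σ[ x ∈ Node t ] v ∈ₛ label x
occursᶠ-node : ∀ {n} (ts : List (Tree (Subset n))) {v} → occursᶠ ts v ≡ true →
               Σ[ i ∈ Fin (length ts) ] Σ[ x ∈ Node (List.lookup ts i) ] v ∈ₛ label x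
occurs-node (node s ts) {v} h with ∨-true h
... | inj₁ vs = root , lookup⇒[]= v s vs
... | inj₂ h′ = let (i , x , vx) = occursᶠ-node ts h′ in child i x , vx
occursᶠ-node (t ∷ ts) h with ∨-true h
... | inj₁ h′ = zero , occurs-node t h′
... | inj₂ h′ = let (i , x , vx) = occursᶠ-node ts h′ in suc i , x , vx

∨-introʳ : ∀ a {b} → b ≡ true → a ∨ b ≡ true
∨-introʳ a refl = ∨-zeroʳ a

∨-introˡ : ∀ {a b} → a ≡ true → a ∨ b ≡ true
∨-introˡ refl = refl

node-occurs : ∀ {n} {t : Tree (Subset n)} (x : Node t) {v} → v ∈ₛ label x → occurs t v ≡ true
node-occursᶠ : ∀ {n} (ts : List (Tree (Subset n))) i (x : Node (List.lookup ts i)) {v} → v ∈ₛ label x → occursᶠ ts v ≡ true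
node-occurs {t = node s ts} root        vx = ∨-introˡ ([]=⇒lookup vx)
node-occurs {t = node s ts} (child i x) {v} vx = ∨-introʳ (Vec.lookup s v) (node-occursᶠ ts i x vx)
node-occursᶠ (t ∷ ts) zero    x vx = ∨-introˡ (node-occurs x vx)
node-occursᶠ (t ∷ ts) (suc i) x {v} vx = ∨-introʳ (occurs t v) (node-occursᶠ ts i x vx)

module _ {n} (M : Matrix n) where

  -- While the recursion descends, an edge may be covered by a bag outside the current tree only;
  -- then both of its ends lie in `O`.
  EdgesIn : Indicator n → Tree (Subset n) → Set
  EdgesIn O t = ∀ u v → fromMaybe 0 (M u v) ≢ 0 →
    (Σ[ x ∈ Node t ] (u ∈ₛ label x × v ∈ₛ label x)) ⊎ (O u ≡ true × O v ≡ true)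

  -- O is the set of the vertices in bags outside the tree, D the union of the
  -- root's bag with the part of the graph processed so far.
  separated : ∀ s ts (O D : Indicator n) → Connected (node s ts) →
    (∀ v → O v ≡ true → occurs (node s ts) v ≡ true → Vec.lookup s v ≡ true) →
    (∀ v → D v ≡ true → O v ≡ true ⊎ Vec.lookup s v ≡ true) →
    (∀ v → Vec.lookup s v ≡ true → D v ≡ true) →
    EdgesIn O (node s ts) → Separated M (Vec.lookup s) D ts
  separated s [] O D conn outside D⊆ s⊆D edges = tt
  separated s (node s′ us ∷ ts) O D conn outside D⊆ s⊆D edges =
    record { shared = λ v Dv tv → [ (λ Ov → outside v Ov (inT v tv)) , id ]′ (D⊆ v Dv)
                                , proj₂ (root-crossing v ([ (λ Ov → outside v Ov (inT v tv)) , id ]′ (D⊆ v Dv)) tv)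
           ; no-edge = no-edge } ,
    -- Seen from the child, the outside consists of the old outside, which includes the earlier
    -- siblings, the bag `s` and the later siblings. For the remaining siblings below, the finished
    -- child joins the outside.
    separated s′ us (λ v → O v ∨ (σ v ∨ occursᶠ ts v)) (Vec.lookup s′) (connected-first conn)
      (λ v O′v tv → [ (λ Ov → proj₂ (root-crossing v (outside v Ov (inT v tv)) tv))
                    , [ (λ σv → proj₂ (root-crossing v σv tv)) , (λ h → proj₂ (rest-crossing v h tv)) ]′ ∘ ∨-true ]′ (∨-true {O v} O′v))
      (λ v → inj₂) (λ v → id) edges₁ ,
    separated s ts (λ v → O v ∨ occurs t v) (λ v → D v ∨ occurs t v) (connected-rest conn)
      (λ v O′v h → [ (λ Ov → outside v Ov (inRest v h))
                   , (λ tv → [ id , (λ h′ → proj₁ (rest-crossing v h′ tv)) ]′ (∨-true {σ v} h)) ]′ (∨-true {O v} O′v))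
      (λ v D′v → [ (λ Dv → Sum.map₁ ∨-introˡ (D⊆ v Dv)) , (λ tv → inj₁ (∨-introʳ (O v) tv)) ]′ (∨-true {D v} D′v))
      (λ v σv → ∨-introˡ (s⊆D v σv)) edges₂
    where
    t = node s′ us
    σ = Vec.lookup s

    inT : ∀ v → occurs t v ≡ true → occurs (node s (t ∷ ts)) v ≡ true
    inT v tv = ∨-introʳ (σ v) (∨-introˡ tv)

    inRest : ∀ v → occurs (node s ts) v ≡ true → occurs (node s (t ∷ ts)) v ≡ true
    inRest v h with ∨-true {σ v} h
    ... | inj₁ σv = ∨-introˡ σv
    ... | inj₂ h′ = ∨-introʳ (σ v) (∨-introʳ (occurs t v) h′)

    leave : ∀ v (y : Node (node s (t ∷ ts))) → inFirst y ≡ false → v ∈ₛ label y → occurs t v ≡ true →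
            σ v ≡ true × Vec.lookup s′ v ≡ true
    leave v y out vy tv with occurs-node t tv
    ... | x , vx with crossing-walk (conn v (child zero x) y vx vy)
    ...   | inj₁ eq        = contradiction (trans (sym out) (sym eq)) false≢true
    ...   | inj₂ (vs , vt) = []=⇒lookup vs , []=⇒lookup vt

    root-crossing : ∀ v → σ v ≡ true → occurs t v ≡ true → σ v ≡ true × Vec.lookup s′ v ≡ true
    root-crossing v σv = leave v root refl (lookup⇒[]= v s σv)

    rest-crossing : ∀ v → occursᶠ ts v ≡ true → occurs t v ≡ true → σ v ≡ true × Vec.lookup s′ v ≡ true
    rest-crossing v h tv = let (i , x , vx) = occursᶠ-node ts h in leave v (child (suc i) x) refl vx tv

    -- If a bag with both ends lies in the child, then `u` occurs there. If it lies anywhere else,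
    -- then `v` occurs inside and outside the child, hence in `s` and in `D`. Both are excluded.
    no-edge : ∀ u v → D u ≡ true → occurs t u ≡ false → D v ≡ false → occurs t v ≡ true → fromMaybe 0 (M u v) ≡ 0
    no-edge u v Du tu Dv tv with fromMaybe 0 (M u v) ≟ 0
    ... | yes h = h
    ... | no  h with edges u v h
    ...   | inj₂ (_ , Ov)                      = contradiction (trans (sym Dv) (s⊆D v (outside v Ov (inT v tv)))) false≢true
    ...   | inj₁ (root , _ , vx)               = contradiction (trans (sym Dv) (s⊆D v ([]=⇒lookup vx))) false≢true
    ...   | inj₁ (child zero x , ux , _)       = contradiction (trans (sym tu) (node-occurs x ux)) false≢true
    ...   | inj₁ (child (suc i) x , _ , vx)    = contradiction (trans (sym Dv) (s⊆D v (proj₁ (leave v (child (suc i) x) refl vx tv)))) false≢true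

    edges₁ : EdgesIn (λ v → O v ∨ (σ v ∨ occursᶠ ts v)) t
    edges₁ u v h with edges u v h
    ... | inj₂ (Ou , Ov)                 = inj₂ (∨-introˡ Ou , ∨-introˡ Ov)
    ... | inj₁ (root , ux , vx)          = inj₂ (∨-introʳ (O u) (∨-introˡ ([]=⇒lookup ux)) , ∨-introʳ (O v) (∨-introˡ ([]=⇒lookup vx)))
    ... | inj₁ (child zero x , ux , vx)  = inj₁ (x , ux , vx)
    ... | inj₁ (child (suc i) x , ux , vx) = inj₂
      (∨-introʳ (O u) (∨-introʳ (σ u) (node-occursᶠ ts i x ux)) , ∨-introʳ (O v) (∨-introʳ (σ v) (node-occursᶠ ts i x vx)))

    edges₂ : EdgesIn (λ v → O v ∨ occurs t v) (node s ts)
    edges₂ u v h with edges u v h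
    ... | inj₂ (Ou , Ov)                 = inj₂ (∨-introˡ Ou , ∨-introˡ Ov)
    ... | inj₁ (root , ux , vx)          = inj₁ (root , ux , vx)
    ... | inj₁ (child zero x , ux , vx)  = inj₂ (∨-introʳ (O u) (node-occurs x ux) , ∨-introʳ (O v) (node-occurs x vx))
    ... | inj₁ (child (suc i) x , ux , vx) = inj₁ (child i x , ux , vx)

-- The number of keys

count : ∀ {n} → Indicator n → ℕ
count σ = sum λ v → if σ v then 1 else 0

count≡∣∣ : ∀ {n} (s : Subset n) → count (Vec.lookup s) ≡ ∣ s ∣
count≡∣∣ Vec.[]          = refl
count≡∣∣ (true Vec.∷ s)  = cong suc (count≡∣∣ s)
count≡∣∣ (false Vec.∷ s) = count≡∣∣ s

length-extend-true : ∀ {n} (A : List (Partial n)) → length (extend true A) ≡ 2 * length A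
length-extend-true []      = refl
length-extend-true (P ∷ A) = trans (cong (2 +_) (length-extend-true A)) (sym (*-suc 2 (length A)))

length-extend-false : ∀ {n} (A : List (Partial n)) → length (extend false A) ≡ length A
length-extend-false []      = refl
length-extend-false (P ∷ A) = cong suc (length-extend-false A)

length-initial : ∀ {n} (σ : Indicator n) → length (initial σ) ≡ 2 ^ count σ
length-initial {zero}  σ = refl
length-initial {suc n} σ with σ zero
... | true  = trans (length-extend-true (initial (σ ∘ suc))) (cong (2 *_) (length-initial (σ ∘ suc)))
... | false = trans (length-extend-false (initial (σ ∘ suc))) (length-initial (σ ∘ suc))

module _ (R : ℕ) .{{_ : NonZero R}} where

  -- The values at positions in `σ` are read as digits in base `R`, the lowest index being the least
  -- significant. Positions outside `σ` are skipped, so the exponent is the size of the bag and not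
  -- `n`.
  code : ∀ {n} → Indicator n → (Fin n → ℕ) → ℕ
  code {zero}  σ f = 0
  code {suc n} σ f = if σ zero then f zero + code (σ ∘ suc) (f ∘ suc) * R else code (σ ∘ suc) (f ∘ suc)

  code< : ∀ {n} (σ : Indicator n) f → (∀ v → f v < R) → code σ f < R ^ count σ
  code< {zero}  σ f f< = s≤s z≤n
  code< {suc n} σ f f< with σ zero
  ... | false = code< (σ ∘ suc) (f ∘ suc) (f< ∘ suc)
  ... | true  = begin-strict
    f zero + c * R        <⟨ +-monoˡ-< (c * R) (f< zero) ⟩
    suc c * R             ≤⟨ *-monoˡ-≤ R (code< (σ ∘ suc) (f ∘ suc) (f< ∘ suc)) ⟩
    R ^ count (σ ∘ suc) * R ≡⟨ *-comm (R ^ count (σ ∘ suc)) R ⟩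
    R * R ^ count (σ ∘ suc) ∎
    where
    open ≤-Reasoning
    c = code (σ ∘ suc) (f ∘ suc)

  digit-injective : ∀ {a b} x y → a < R → b < R → a + x * R ≡ b + y * R → a ≡ b × x ≡ y
  digit-injective {a} {b} x y a< b< h = a≡b , *-cancelʳ-≡ x y R (+-cancelˡ-≡ b _ _ (trans (cong (_+ x * R) (sym a≡b)) h))
    where
    remainder : ∀ {a} x → a < R → a ≡ (a + x * R) % R
    remainder {a} x a< = trans (sym (m<n⇒m%n≡m a<)) (sym ([m+kn]%n≡m%n a x R))
    a≡b : a ≡ b
    a≡b = trans (remainder x a<) (trans (cong (_% R) h) (sym (remainder y b<)))

  code-injective : ∀ {n} (σ : Indicator n) f g → (∀ v → f v < R) → (∀ v → g v < R) →
    (∀ v → σ v ≡ false → f v ≡ g v) → code σ f ≡ code σ g → f ≗ g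
  code-injective {suc n} σ f g f< g< off h v with σ zero in eq
  code-injective {suc n} σ f g f< g< off h zero    | false = off zero eq
  code-injective {suc n} σ f g f< g< off h (suc v) | false =
    code-injective (σ ∘ suc) (f ∘ suc) (g ∘ suc) (f< ∘ suc) (g< ∘ suc) (off ∘ suc) h v
  code-injective {suc n} σ f g f< g< off h zero    | true = proj₁ (digit-injective (code (σ ∘ suc) (f ∘ suc)) (code (σ ∘ suc) (g ∘ suc)) (f< zero) (g< zero) h)
  code-injective {suc n} σ f g f< g< off h (suc v) | true =
    code-injective (σ ∘ suc) (f ∘ suc) (g ∘ suc) (f< ∘ suc) (g< ∘ suc) (off ∘ suc)
      (proj₂ (digit-injective (code (σ ∘ suc) (f ∘ suc)) (code (σ ∘ suc) (g ∘ suc)) (f< zero) (g< zero) h)) v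

module _ {n} (M : Matrix n) where

  keyEntry≤ : ∀ b p d → keyEntry b p d ≤ 2 + (d + d)
  keyEntry≤ false p            d = z≤n
  keyEntry≤ true  nothing      d = z≤n
  keyEntry≤ true  (just true)  d = ≤-refl
  keyEntry≤ true  (just false) d = n≤1+n _

  key≤ : ∀ {x} → (∀ v → rowDegree (M v) ≤ x) → ∀ σ P v → key M σ P v ≤ 2 + (x + x)
  key≤ h σ P v = ≤-trans (keyEntry≤ (σ v) (P v) (cutDeg M P v)) (+-monoʳ-≤ 2 (+-mono-≤ c≤x c≤x))
    where c≤x = ≤-trans (cutDeg≤rowDegree M P v) (h v)

  lookup-distinct : ∀ {σ A} → Distinct M σ A → ∀ i j → SameKey M σ (List.lookup A i) (List.lookup A j) → i ≡ j
  lookup-distinct (_ ∷ _)      zero    zero    _ = refl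
  lookup-distinct {A = P ∷ A} (P≁A ∷ _) zero    (suc j) h = contradiction h (All.lookup P≁A (∈-lookup j))
  lookup-distinct {A = P ∷ A} (P≁A ∷ _) (suc i) zero    h = contradiction (λ v → sym (h v)) (All.lookup P≁A (∈-lookup i))
  lookup-distinct {A = P ∷ A} (_ ∷ A≁)  (suc i) (suc j) h = cong suc (lookup-distinct A≁ i j h)

  -- Pigeonhole: entries with different keys have different codes below the bound.
  distinct-length : ∀ {R} .{{_ : NonZero R}} {σ A} → (∀ P v → key M σ P v < R) → Distinct M σ A → length A ≤ R ^ count σ
  distinct-length {R} {σ} {A} key< A≁ = injective⇒≤ {f = index} injective
    where
    codeAt : Fin (length A) → ℕ
    codeAt i = code R σ (key M σ (List.lookup A i))
    codeAt< : ∀ i → codeAt i < R ^ count σ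
    codeAt< i = code< R σ _ (key< (List.lookup A i))
    index : Fin (length A) → Fin (R ^ count σ)
    index i = fromℕ< (codeAt< i)
    off : ∀ P Q v → σ v ≡ false → key M σ P v ≡ key M σ Q v
    off P Q v σv = trans (vanish P) (sym (vanish Q))
      where
      vanish : ∀ P → key M σ P v ≡ 0
      vanish P = cong (λ b → keyEntry b (P v) (cutDeg M P v)) σv
    injective : ∀ {i j} → index i ≡ index j → i ≡ j
    injective {i} {j} h = lookup-distinct A≁ i j
      (code-injective R σ _ _ (key< (List.lookup A i)) (key< (List.lookup A j)) (off _ _)
        (fromℕ<-injective (codeAt i) (codeAt j) (codeAt< i) (codeAt< j) h))

-- Existence of stable cuts

sum-at : ∀ {n} (v : Fin n) (g : Fin n → ℕ) → (sum λ u → if does (u ≟ᶠ v) then g u else 0) ≡ g v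
sum-at {suc n} zero g = trans (cong (g zero +_) (sum-replicate-zero n)) (+-identityʳ (g zero))
sum-at (suc v) g = sum-at v (g ∘ suc)

sum-split₃ : ∀ {n} {f g h f′ g′ h′ : Fin n → ℕ} → (∀ u → f u + g u + h u ≡ f′ u + g′ u + h′ u) →
             sum f + sum g + sum h ≡ sum f′ + sum g′ + sum h′
sum-split₃ {f = f} {g} {h} {f′} {g′} {h′} eq =
  trans (cong (_+ sum h) (sym (∑-distrib-+ f g))) (trans (sum-split eq) (cong (_+ sum h′) (∑-distrib-+ f′ g′)))

flip : ∀ {n} → Fin n → Indicator n → Indicator n
flip v C u = if does (u ≟ᶠ v) then not (C u) else C u

colored : ∀ {n} → Indicator n → Partial n
colored C v = just (C v)

crossing-opposite : ∀ a b r → crossing (just (not a)) r (just b) + crossing (just a) r (just b) ≡ fromMaybe 0 r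
crossing-opposite true  true  r = +-identityʳ _
crossing-opposite true  false r = refl
crossing-opposite false true  r = refl
crossing-opposite false false r = +-identityʳ _

crossing-sym : ∀ p r q → crossing p r q ≡ crossing q r p
crossing-sym nothing  r nothing  = refl
crossing-sym nothing  r (just _) = refl
crossing-sym (just _) r nothing  = refl
crossing-sym (just a) r (just b) = cong (λ c → if c then fromMaybe 0 r else 0) (xor-comm a b)

module _ {n} (M : Matrix n) (M-sym : ∀ u v → M u v ≡ M v u) (M-irrefl : ∀ v → M v v ≡ nothing) where

  Stableᶜ : Indicator n → Set
  Stableᶜ C = ∀ v → rowDegree (M v) ≤ cutDeg M (colored C) v + cutDeg M (colored C) v

  crossing-loop : ∀ C v → crossing (colored C v) (M v v) (colored C v) ≡ 0
  crossing-loop C v = crossing-zero M (colored C v) (M v v) (colored C v) (cong (fromMaybe 0) (M-irrefl v))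

  module _ (C : Indicator n) (v : Fin n) where

    private
      c c′ : Fin n → Fin n → ℕ
      c  a b = crossing (colored C a) (M a b) (colored C b)
      c′ a b = crossing (colored (flip v C) a) (M a b) (colored (flip v C) b)

      at : Fin n → ℕ → ℕ
      at u x = if does (u ≟ᶠ v) then x else 0

    -- Flipping `v` changes only the row and the column of `v`. Adding to each side the row and
    -- column entries of the other side avoids subtraction; the diagonal entry is added twice, but
    -- loops weigh nothing.
    flip-pointwise : ∀ a b → c′ a b + at a (c a b) + at b (c a b) ≡ c a b + at a (c′ a b) + at b (c′ a b)
    flip-pointwise a b with a ≟ᶠ v | b ≟ᶠ v
    ... | no  _ | no  _ = refl
    ... | yes _ | no  _ = cong (_+ 0) (+-comm (crossing (just (not (C a))) (M a b) (just (C b))) (crossing (just (C a)) (M a b) (just (C b))))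
    ... | no  _ | yes _ = trans (cong (_+ crossing (just (C a)) (M a b) (just (C b))) (+-identityʳ _))
            (trans (+-comm (crossing (just (C a)) (M a b) (just (not (C b)))) _) (cong (_+ crossing (just (C a)) (M a b) (just (not (C b)))) (sym (+-identityʳ _))))
    ... | yes refl | yes refl = trans (sums (crossing-zero M (just (not (C a))) (M a a) (just (not (C a))) (cong (fromMaybe 0) (M-irrefl a))) (crossing-loop C a))
            (sym (sums (crossing-loop C a) (crossing-zero M (just (not (C a))) (M a a) (just (not (C a))) (cong (fromMaybe 0) (M-irrefl a)))))
      where
      sums : ∀ {x y} → x ≡ 0 → y ≡ 0 → x + y + y ≡ 0
      sums refl refl = refl

    private
      sum-if : ∀ b (g : Fin n → ℕ) → sum (λ u → if b then g u else 0) ≡ (if b then sum g else 0)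
      sum-if true  g = refl
      sum-if false g = sum-replicate-zero n

      -- The row of `v` and, by symmetry, its column have the same sum, whence the doubled degrees
      -- in `flip-total`.
      rows : ∀ (d : Fin n → Fin n → ℕ) → (∀ a b → d a b ≡ d b a) →
             sum (λ a → at a (sum (d a))) + sum (λ a → d a v) ≡ sum (d v) + sum (d v)
      rows d d-sym = cong₂ _+_ (sum-at v (λ a → sum (d a))) (sum-cong-≗ λ a → d-sym a v)

      c-sym : ∀ C a b → crossing (colored C a) (M a b) (colored C b) ≡ crossing (colored C b) (M b a) (colored C a)
      c-sym C a b = trans (cong (λ r → crossing (colored C a) r (colored C b)) (M-sym a b)) (crossing-sym (colored C a) (M b a) (colored C b))

    flip-total : total M (colored (flip v C)) + (cutDeg M (colored C) v + cutDeg M (colored C) v) ≡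
                 total M (colored C) + (cutDeg M (colored (flip v C)) v + cutDeg M (colored (flip v C)) v)
    flip-total = begin
      total M (colored (flip v C)) + (sum (c v) + sum (c v))        ≡⟨ cong (total M (colored (flip v C)) +_) (sym (rows c (c-sym C))) ⟩
      total M (colored (flip v C)) + (sum (λ a → at a (sum (c a))) + sum (λ a → c a v)) ≡⟨ sym (+-assoc (total M (colored (flip v C))) _ _) ⟩
      total M (colored (flip v C)) + sum (λ a → at a (sum (c a))) + sum (λ a → c a v)   ≡⟨ sum-split₃ by-row ⟩
      total M (colored C) + sum (λ a → at a (sum (c′ a))) + sum (λ a → c′ a v)          ≡⟨ +-assoc (total M (colored C)) _ _ ⟩
      total M (colored C) + (sum (λ a → at a (sum (c′ a))) + sum (λ a → c′ a v))        ≡⟨ cong (total M (colored C) +_) (rows c′ (c-sym (flip v C))) ⟩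
      total M (colored C) + (sum (c′ v) + sum (c′ v))               ∎
      where
      open ≡-Reasoning
      by-row : ∀ a → sum (c′ a) + at a (sum (c a)) + c a v ≡ sum (c a) + at a (sum (c′ a)) + c′ a v
      by-row a = subst₂ _≡_ (fold-row c′ c) (fold-row c c′) (sum-split₃ (flip-pointwise a))
        where
        fold-row : ∀ (d e : Fin n → Fin n → ℕ) →
                   sum (d a) + sum (λ b → at a (e a b)) + sum (λ b → at b (e a b)) ≡ sum (d a) + at a (sum (e a)) + e a v
        fold-row d e = cong₂ (λ x y → sum (d a) + x + y) (sum-if (does (a ≟ᶠ v)) (e a)) (sum-at v (e a))

    -- Flipping `v` exchanges the cut and the uncut edges at `v`.
    flip-degree : cutDeg M (colored (flip v C)) v + cutDeg M (colored C) v ≡ rowDegree (M v)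
    flip-degree = trans (sym (∑-distrib-+ (c′ v) (c v))) (sum-cong-≗ opposite)
      where
      at-v : flip v C v ≡ not (C v)
      at-v with v ≟ᶠ v
      ... | yes _ = refl
      ... | no  h = contradiction refl h
      opposite : ∀ u → c′ v u + c v u ≡ fromMaybe 0 (M v u)
      opposite u rewrite at-v with u ≟ᶠ v
      ... | no  _    = crossing-opposite (C v) (C u) (M v u)
      ... | yes refl rewrite M-irrefl v with C v
      ...   | true  = refl
      ...   | false = refl

    flip-improves : cutDeg M (colored C) v + cutDeg M (colored C) v < rowDegree (M v) →
                    total M (colored C) < total M (colored (flip v C))
    flip-improves unstable = +-cancelʳ-< (d + d) _ _ (begin-strict
      total M (colored C) + (d + d)     <⟨ +-monoʳ-< (total M (colored C)) (+-mono-< d<d′ d<d′) ⟩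
      total M (colored C) + (d′ + d′)   ≡⟨ sym flip-total ⟩
      total M (colored (flip v C)) + (d + d) ∎)
      where
      open ≤-Reasoning
      d  = cutDeg M (colored C) v
      d′ = cutDeg M (colored (flip v C)) v
      d<d′ : d < d′
      d<d′ = +-cancelʳ-< d d d′ (subst (d + d <_) (sym flip-degree) unstable)

  total≤ : ∀ P → total M P ≤ sum λ v → rowDegree (M v)
  total≤ P = sum-mono (cutDeg≤rowDegree M P)

  -- `k` is fuel, a bound on how far the weight can still grow. Each flip gains at least 1, and with
  -- `k` used up another flip would exceed the sum of all weighted degrees.
  local-search : ∀ k C → (sum λ v → rowDegree (M v)) ≤ total M (colored C) + k → Σ[ C ∈ Indicator n ] Stableᶜ C
  local-search k C bound with any? (λ v → cutDeg M (colored C) v + cutDeg M (colored C) v <? rowDegree (M v))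
  ... | no stable = C , λ v → ≮⇒≥ λ unstable → stable (v , unstable)
  local-search zero    C bound | yes (v , unstable) = contradiction
    (≤-trans (total≤ (colored (flip v C))) (≤-trans bound (≤-reflexive (+-identityʳ _)))) (<⇒≱ (flip-improves C v unstable))
  local-search (suc k) C bound | yes (v , unstable) = local-search k (flip v C)
    (≤-trans bound (≤-trans (≤-reflexive (+-suc (total M (colored C)) k)) (+-monoˡ-≤ k (flip-improves C v unstable))))

  stable-exists : Σ[ C ∈ Indicator n ] Stableᶜ C
  stable-exists = local-search _ (λ _ → false) (m≤n+m _ (total M (colored λ _ → false)))

-- Matchings

minor : ∀ {n} → Matrix (suc n) → Matrix n
minor M u v = M (suc u) (suc v)

greedy-positive : ∀ {n} (M : Matrix n) v → greedy M v ≡ true → 1 ≤ rowDegree (M v)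
greedy-positive {suc n} M zero    h = ≤ᵇ-sound h
greedy-positive {suc n} M (suc v) h = ≤-trans (greedy-positive (minor M) v h) (m≤n+m _ _)

-- Induction until the smaller end is vertex 0, which has positive degree and gets `true`. Its
-- partner spends its whole degree of 1 on this edge, so it has degree 0 in the minor and gets
-- `false`.
greedy-opposite : ∀ {n} (M : Matrix n) → (∀ u v → M u v ≡ M v u) → (∀ v → M v v ≡ nothing) →
  (∀ v → rowDegree (M v) ≤ 1) → ∀ u v → 1 ≤ fromMaybe 0 (M u v) → greedy M u xor greedy M v ≡ true
greedy-opposite {suc n} M M-sym M-irrefl small zero    zero    h rewrite M-irrefl zero = contradiction h λ ()
greedy-opposite {suc n} M M-sym M-irrefl small zero    (suc v) h =
  cong₂ _xor_ (≤ᵇ-complete (≤-trans h (term≤sum (λ u → fromMaybe 0 (M zero u)) (suc v)))) later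
  where
  later : greedy (minor M) v ≡ false
  later with bool-cases (greedy (minor M) v)
  ... | inj₂ eq = eq
  ... | inj₁ eq = contradiction
    (≤-trans (+-mono-≤ (subst (λ r → 1 ≤ fromMaybe 0 r) (M-sym zero (suc v)) h) (greedy-positive (minor M) v eq)) (small (suc v))) λ { (s≤s ()) }
greedy-opposite {suc n} M M-sym M-irrefl small (suc u) zero    h =
  trans (xor-comm (greedy M (suc u)) (greedy M zero))
    (greedy-opposite M M-sym M-irrefl small zero (suc u) (subst (λ r → 1 ≤ fromMaybe 0 r) (M-sym (suc u) zero) h))
greedy-opposite {suc n} M M-sym M-irrefl small (suc u) (suc v) h =
  greedy-opposite (minor M) (λ u v → M-sym (suc u) (suc v)) (M-irrefl ∘ suc) (λ v → ≤-trans (m≤n+m _ _) (small (suc v))) u v h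

greedy-cutDeg : ∀ {n} (M : Matrix n) → (∀ u v → M u v ≡ M v u) → (∀ v → M v v ≡ nothing) →
  (∀ v → rowDegree (M v) ≤ 1) → ∀ v → cutDeg M (colored (greedy M)) v ≡ rowDegree (M v)
greedy-cutDeg M M-sym M-irrefl small v = sum-cong-≗ pointwise
  where
  pointwise : ∀ u → crossing (just (greedy M v)) (M v u) (just (greedy M u)) ≡ fromMaybe 0 (M v u)
  pointwise u with fromMaybe 0 (M v u) in eq
  ... | zero  with greedy M v xor greedy M u
  ...   | true  = refl
  ...   | false = refl
  pointwise u | suc w rewrite greedy-opposite M M-sym M-irrefl small v u (subst (1 ≤_) (sym eq) (s≤s z≤n)) = refl

-- From matrices to weighted graphs and minimum stable cuts

≤maximum : ∀ {n} (f : Fin n → ℕ) v → f v ≤ maximum f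
≤maximum f zero    = m≤m⊔n (f zero) _
≤maximum f (suc v) = ≤-trans (≤maximum (f ∘ suc) v) (m≤n⊔m (f zero) _)

sum-bounded : ∀ {n x} (f : Fin n → ℕ) → (∀ v → f v ≤ x) → sum f ≤ n * x
sum-bounded {zero}  f h = z≤n
sum-bounded {suc n} f h = +-mono-≤ (h zero) (sum-bounded (f ∘ suc) (h ∘ suc))

sum-*ʳ : ∀ {n} (f : Fin n → ℕ) x → sum (λ v → f v * x) ≡ sum f * x
sum-*ʳ {zero}  f x = refl
sum-*ʳ {suc n} f x = trans (cong (f zero * x +_) (sum-*ʳ (f ∘ suc) x)) (sym (*-distribʳ-+ x (f zero) _))

xor-split : ∀ a b w → (if a xor b then w else 0) ≡ (if not a ∧ b then w else 0) + (if not b ∧ a then w else 0)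
xor-split true  true  w = refl
xor-split true  false w = refl
xor-split false true  w = sym (+-identityʳ w)
xor-split false false w = refl

module _ {n} (G : WeightedGraph n) where
  open WeightedGraph G

  rowDegree≤ : ∀ v → rowDegree (weight v) ≤ maxDegree * maxWeight
  rowDegree≤ v = begin
    rowDegree (weight v)                                         ≤⟨ sum-mono edge ⟩
    sum (λ u → (if is-just (weight v u) then 1 else 0) * maxWeight) ≡⟨ sum-*ʳ (λ u → if is-just (weight v u) then 1 else 0) maxWeight ⟩
    degree v * maxWeight                                         ≤⟨ *-monoˡ-≤ maxWeight (≤maximum degree v) ⟩
    maxDegree * maxWeight                                        ∎
    where
    open ≤-Reasoning
    edge : ∀ u → w v u ≤ (if is-just (weight v u) then 1 else 0) * maxWeight
    edge u with weight v u in eq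
    ... | nothing = z≤n
    ... | just x  = ≤-trans (subst (_≤ maxWeight) (cong (fromMaybe 0) eq)
            (≤-trans (≤maximum (w v) u) (≤maximum (λ u → maximum (w u)) v))) (≤-reflexive (sym (*-identityˡ maxWeight)))

  total≡cutWeight : ∀ C → total weight (colored C) ≡ cutWeight G C + cutWeight G C
  total≡cutWeight C = begin
    total weight (colored C)   ≡⟨ sum-cong-≗ (λ v → sum-cong-≗ λ u → xor-split (C v) (C u) (w v u)) ⟩
    sum (λ v → sum λ u → f v u + g v u)        ≡⟨ sum-cong-≗ (λ v → ∑-distrib-+ (f v) (g v)) ⟩
    sum (λ v → sum (f v) + sum (g v))          ≡⟨ ∑-distrib-+ (λ v → sum (f v)) (λ v → sum (g v)) ⟩
    cutWeight G C + sum (λ v → sum (g v))      ≡⟨ cong (cutWeight G C +_) (∑-comm g) ⟩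
    cutWeight G C + sum (λ u → sum λ v → g v u) ≡⟨ cong (cutWeight G C +_) (sum-cong-≗ λ u → sum-cong-≗ λ v →
                                                     cong (λ r → if not (C u) ∧ C v then fromMaybe 0 r else 0) (symmetric v u)) ⟩
    cutWeight G C + cutWeight G C              ∎
    where
    open ≡-Reasoning
    f g : Fin n → Fin n → ℕ
    f v u = if not (C v) ∧ C u then w v u else 0
    g v u = if not (C u) ∧ C v then w v u else 0

  stableᶜ⇒stable : ∀ C → Stableᶜ weight symmetric irreflexive C → Stable G C
  stableᶜ⇒stable C h v = subst (rowDegree (weight v) ≤_) (cong (cutDegree G C v +_) (sym (+-identityʳ _))) (h v)

  stable⇒stableᶜ : ∀ C → Stable G C → Stableᶜ weight symmetric irreflexive C
  stable⇒stableᶜ C h v = subst (rowDegree (weight v) ≤_) (cong (cutDegree G C v +_) (+-identityʳ _)) (h v)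

  minimum : ∀ C → Stable G C → (∀ D → Stable G D → total weight (colored C) ≤ total weight (colored D)) → IsMinStableCut G C
  minimum C st least = st , λ D stD → ≮⇒≥ λ D<C →
    <⇒≱ (+-mono-< D<C D<C) (subst₂ _≤_ (total≡cutWeight C) (total≡cutWeight D) (least D stD))

  -- Half of a degree of at most 1, rounded up, is all of it. So every stable cut contains all edges
  -- of positive weight, and the greedy cut cannot be heavier than any other.
  greedy-minimum : allSmall weight ≡ true → IsMinStableCut G (greedy weight)
  greedy-minimum eq = minimum (greedy weight)
    (stableᶜ⇒stable (greedy weight) λ v → ≤-trans (≤-reflexive (sym (exact v))) (m≤m+n _ _))
    λ D stD → sum-mono λ v → ≤-trans (≤-reflexive (exact v)) (≤-one (small v) (stable⇒stableᶜ D stD v))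
    where
    small : ∀ v → rowDegree (weight v) ≤ 1
    small v = ≤ᵇ-sound (allᵇ-sound _ eq v)
    exact = greedy-cutDeg weight symmetric irreflexive small
    ≤-one : ∀ {d c} → d ≤ 1 → d ≤ c + c → d ≤ c
    ≤-one {c = zero}  d≤1 d≤c = d≤c
    ≤-one {c = suc c} d≤1 d≤c = ≤-trans d≤1 (s≤s z≤n)

  -- The table at the extra root

  nobody : Indicator n
  nobody _ = false

  blank : Partial n
  blank _ = nothing

  module _ (D : TreeDecomposition G) where
    open TreeDecomposition D using (tree; width; vertexCovered; edgeCovered; connected)

    table : List (Partial n)
    table = solveForest weight nobody (blank ∷ []) (tree ∷ [])

    table-distinct : ∀ t → Distinct weight nobody (solveForest weight nobody (blank ∷ []) (t ∷ []))
    table-distinct (node s us) = join-distinct weight nobody (blank ∷ [])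
      (solveForest weight (Vec.lookup s) (initial (Vec.lookup s)) us)

    edges-covered : EdgesIn weight nobody tree
    edges-covered u v h with weight u v in eq
    ... | nothing = contradiction refl h
    ... | just x  = inj₁ (edgeCovered u v (subst Is-just (sym eq) (just tt)))

    table-represents : ∀ t → Connected t → EdgesIn weight nobody t →
      Represents weight nobody (occursᶠ (t ∷ [])) (solveForest weight nobody (blank ∷ []) (t ∷ []))
    table-represents (node s us) conn edges = solve-represents weight symmetric (node s us ∷ []) (blank-represents weight) (λ v ())
      -- The extra root has processed no vertex, so its separation from the tree is vacuous.
      ( record { shared = λ v () ; no-edge = λ u v () }
      , separated weight s us nobody (Vec.lookup s) conn (λ v ()) (λ v → inj₂) (λ v h → h) edges
      , tt)

    everywhere : ∀ v → occursᶠ (tree ∷ []) v ≡ true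
    everywhere v = ∨-introˡ (let (x , vx) = vertexCovered v in node-occurs x vx)

    table-minimum : Σ[ P ∈ Partial n ] (table ≡ P ∷ [] × IsMinStableCut G (fromMaybe false ∘ P))
    table-minimum = go table (table-represents tree connected edges-covered) (table-distinct tree)
      where
      go : ∀ A → Represents weight nobody (occursᶠ (tree ∷ [])) A → Distinct weight nobody A →
           Σ[ P ∈ Partial n ] (A ≡ P ∷ [] × IsMinStableCut G (fromMaybe false ∘ P))
      go A rep A≁ = single A covers-cut domain settled A≁
        where
        open Represents rep
        covers-cut : ∀ C → Stable G C → Covers weight nobody A (colored C)
        covers-cut C st = covers (colored C) (λ v → sym (everywhere v)) λ v _ _ → stable⇒stableᶜ C st v
        single : ∀ A → (∀ C → Stable G C → Covers weight nobody A (colored C)) →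
                 (∀ {P} → P ∈ A → HasDomain P (occursᶠ (tree ∷ []))) → (∀ {P} → P ∈ A → Settled weight nobody P) →
                 Distinct weight nobody A → Σ[ P ∈ Partial n ] (A ≡ P ∷ [] × IsMinStableCut G (fromMaybe false ∘ P))
        single [] cov dom st _ with stable-exists weight symmetric irreflexive
        ... | C , stC with cov C (stableᶜ⇒stable C stC)
        ...   | covered () _ _
        -- Over the empty bag every key is constantly zero, so two entries would have the same key.
        single (P ∷ Q ∷ A) cov dom st ((P≁Q ∷ _) ∷ _) = contradiction (λ v → refl) P≁Q
        single (P ∷ []) cov dom st _ = P , refl , minimum C stC least
          where
          C = fromMaybe false ∘ P
          P≗C : P ≗ colored C
          P≗C v with P v | trans (dom (here refl) v) (everywhere v)
          ... | just b | _ = refl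
          stC : Stable G C
          stC = stableᶜ⇒stable C λ v → subst (λ d → rowDegree (weight v) ≤ d + d) (cutDeg-cong weight P≗C v)
            (st (here refl) v refl (trans (dom (here refl) v) (everywhere v)))
          least : ∀ D → Stable G D → total weight (colored C) ≤ total weight (colored D)
          least D stD with cov D stD
          ... | covered (here refl) _ light = ≤-trans (≤-reflexive (sym (total-cong weight P≗C))) light

    bags : All (λ s → ∣ s ∣ ≤ suc width) (labels tree)
    bags = All.map (λ h → ≤-trans h (suc-pred≥ _)) (go (labels tree))
      where
      -- `width` is a truncated difference, so equality fails if all bags are empty.
      suc-pred≥ : ∀ m → m ≤ suc (m ∸ 1)
      suc-pred≥ zero    = z≤n
      suc-pred≥ (suc m) = ≤-refl
      go : ∀ (ss : List (Subset n)) → All (λ s → ∣ s ∣ ≤ List.foldr _⊔_ 0 (List.map ∣_∣ ss)) ss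
      go []       = []
      go (s ∷ ss) = m≤m⊔n ∣ s ∣ _ ∷ All.map (λ h → ≤-trans h (m≤n⊔m ∣ s ∣ _)) (go ss)

    all-label : ∀ {X : Subset n → Set} (t : Tree (Subset n)) → All X (labels t) → ∀ x → X (label {t = t} x)
    all-labelᶠ : ∀ {X : Subset n → Set} ts → All X (forestLabels ts) → ∀ i x → X (label {t = List.lookup ts i} x)
    all-label (node s ts) (h ∷ hs) root        = h
    all-label (node s ts) (h ∷ hs) (child i x) = all-labelᶠ ts hs i x
    all-labelᶠ (t ∷ ts) hs zero    x = all-label t (proj₁ (++⁻ (labels t) hs)) x
    all-labelᶠ (t ∷ ts) hs (suc i) x = all-labelᶠ ts (proj₂ (++⁻ (labels t) hs)) i x

    all-every : ∀ {X : Indicator n → Set} ts → All (X ∘ Vec.lookup) (forestLabels ts) → Everyᶠ X ts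
    all-every []               hs       = tt
    all-every (node s us ∷ ts) (h ∷ hs) =
      h , all-every us (proj₁ (++⁻ (forestLabels us) hs)) , all-every ts (proj₂ (++⁻ (forestLabels us) hs))

    two-in-bag : ∀ {u v} (s : Subset n) → u ∈ₛ s → v ∈ₛ s → u ≢ v → 2 ≤ ∣ s ∣
    two-in-bag {u} {v} s us vs u≢v = ≤-trans (s≤s (≤-trans (s≤s z≤n) (x∈p⇒∣p-x∣<∣p∣ (x∈p∧x≢y⇒x∈p-y us u≢v)))) (x∈p⇒∣p-x∣<∣p∣ vs)

    -- Some edge at `v` has positive weight. Its ends differ, as there are no loops, and a bag
    -- containing both has at least two elements.
    width-positive : ∀ v → 1 ≤ rowDegree (weight v) → 1 ≤ width
    width-positive v h = go (any? λ u → 1 ≤? w v u)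
      where
      go : _ → 1 ≤ width
      go (no none) = contradiction (subst (1 ≤_) (sum-zero λ u → n<1⇒n≡0 (≰⇒> λ p → none (u , p))) h) λ ()
      go (yes (u , p)) with edges-covered v u (λ eq → <⇒≢ p (sym eq))
      ... | inj₁ (x , vx , ux) = s≤s⁻¹ (≤-trans (two-in-bag _ vx ux v≢u) (all-label tree bags x))
        where
        v≢u : v ≢ u
        v≢u refl = <⇒≢ p (sym (cong (fromMaybe 0) (irreflexive v)))

-- The time bound

^-mono-exponent : ∀ {x a b} → 1 ≤ x → a ≤ b → x ^ a ≤ x ^ b
^-mono-exponent {x} 1≤x = ^-monoʳ-≤ x {{>-nonZero 1≤x}}

-- Used with x = ΔW and m = n + N: if 2 ≤ x and 1 ≤ tw, then 3 + 2x ≤ x⁴ and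
-- a table has at most (x⁴)^(tw + 1) ≤ x^(8 tw) entries.
sizeBound : ℕ → ℕ → ℕ → ℕ
sizeBound x tw m = 8 * ((1 ⊔ x) ^ (8 * tw) * m)

module _ (x tw m : ℕ) where

  private
    X = (1 ⊔ x) ^ (8 * tw)

  1≤power : 1 ≤ X
  1≤power = ^-mono-exponent {a = 0} {8 * tw} (m≤m⊔n 1 x) z≤n

  power*≤size : ∀ {y z} → y ≤ X → z ≤ m → y * z ≤ sizeBound x tw m
  power*≤size y≤ z≤ = ≤-trans (*-mono-≤ y≤ z≤) (m≤n*m (X * m) 8)

  ≤size : ∀ {z} → z ≤ m → z ≤ sizeBound x tw m
  ≤size {z} z≤ = subst (_≤ sizeBound x tw m) (*-identityˡ z) (power*≤size 1≤power z≤)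

  module _ (2≤x : 2 ≤ x) (1≤tw : 1 ≤ tw) (1≤m : 1 ≤ m) where

    private
      1≤x : 1 ≤ x
      1≤x = ≤-trans (s≤s z≤n) 2≤x

    x≤power : ∀ {k} → k ≤ 8 * tw → x ^ k ≤ X
    x≤power {k} k≤ = subst (λ y → x ^ k ≤ y ^ (8 * tw)) (sym (m≤n⇒m⊔n≡n 1≤x)) (^-mono-exponent 1≤x k≤)

    power≥ : x ≤ X
    power≥ = subst (_≤ X) (^-identityʳ x) (x≤power (≤-trans (s≤s z≤n) (*-monoʳ-≤ 8 1≤tw)))

    ≤power⇒≤size : ∀ {y} → y ≤ X → y ≤ sizeBound x tw m
    ≤power⇒≤size {y} y≤ = subst (_≤ sizeBound x tw m) (*-identityʳ y) (power*≤size y≤ 1≤m)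

    radix≤ : 3 + (x + x) ≤ 8 * x
    radix≤ = begin
      3 + (x + x)          ≤⟨ +-monoˡ-≤ (x + x) (≤-trans (n≤1+n 3) (+-mono-≤ 2≤x 2≤x)) ⟩
      x + x + (x + x)      ≡⟨ solve 1 (λ x → x :+ x :+ (x :+ x) := con 4 :* x) refl x ⟩
      4 * x                ≤⟨ *-monoˡ-≤ x (m≤m+n 4 4) ⟩
      8 * x                ∎
      where
      open ≤-Reasoning
      open +-*-Solver

    -- The factor 8 of `sizeBound` absorbs the constants of this estimate.
    key-bound : 2 + (x + x) ≤ sizeBound x tw m
    key-bound = begin
      2 + (x + x)   ≤⟨ n≤1+n _ ⟩
      3 + (x + x)   ≤⟨ radix≤ ⟩
      8 * x         ≤⟨ *-monoʳ-≤ 8 power≥ ⟩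
      8 * X         ≡⟨ cong (8 *_) (sym (*-identityʳ X)) ⟩
      8 * (X * 1)   ≤⟨ *-monoʳ-≤ 8 (*-monoʳ-≤ X 1≤m) ⟩
      8 * (X * m)   ∎
      where open ≤-Reasoning

    table-bound : ∀ {k} → k ≤ suc tw → (3 + (x + x)) ^ k ≤ sizeBound x tw m
    table-bound {k} k≤ = ≤power⇒≤size (begin
      (3 + (x + x)) ^ k        ≤⟨ ^-monoˡ-≤ k radix≤ ⟩
      -- Here 8 is read as `2 ^ 3`, which is at most `x ^ 3`: because of `2 ≤ x`, constants
      -- disappear into powers of `x`.
      (8 * x) ^ k              ≤⟨ ^-monoˡ-≤ k (*-monoˡ-≤ x (^-monoˡ-≤ 3 2≤x)) ⟩
      (x ^ 3 * x) ^ k          ≡⟨ cong (_^ k) (*-comm (x ^ 3) x) ⟩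
      (x ^ 4) ^ k              ≡⟨ ^-*-assoc x 4 k ⟩
      x ^ (4 * k)              ≤⟨ x≤power 4k≤ ⟩
      X                        ∎)
      where
      open ≤-Reasoning
      4k≤ : 4 * k ≤ 8 * tw
      4k≤ = begin
        4 * k             ≤⟨ *-monoʳ-≤ 4 k≤ ⟩
        4 * (1 + tw)      ≤⟨ *-monoʳ-≤ 4 (+-monoˡ-≤ tw 1≤tw) ⟩
        4 * (tw + tw)     ≡⟨ solve 1 (λ t → con 4 :* (t :+ t) := con 8 :* t) refl tw ⟩
        8 * tw            ∎
        where open +-*-Solver

^-distribʳ-* : ∀ k x y → (x * y) ^ k ≡ x ^ k * y ^ k
^-distribʳ-* zero    x y = refl
^-distribʳ-* (suc k) x y = trans (cong (x * y *_) (^-distribʳ-* k x y))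
  (solve 4 (λ a b c d → (a :* b) :* (c :* d) := (a :* c) :* (b :* d)) refl x y (x ^ k) (y ^ k))
  where open +-*-Solver

-- One number serves as the factor, bounded below by `9000 ^ K`, and as the constant of both
-- exponents, bounded below by `8 * K`. The 9000 is 1000 times 9, since one plus 8 times a positive
-- number is at most 9 times it.
timeConstant : ℕ → ℕ
timeConstant K = 9000 ^ K + 8 * K

size-power : ∀ K x tw m → 1 ≤ m →
  (1000 * suc (sizeBound x tw m)) ^ K ≤ timeConstant K * ((1 ⊔ x) ^ (timeConstant K * tw) * m ^ timeConstant K)
size-power K x tw m 1≤m = begin
  (1000 * suc (8 * (X * m))) ^ K   ≤⟨ ^-monoˡ-≤ K (*-monoʳ-≤ 1000 (+-monoˡ-≤ (8 * (X * m)) (*-mono-≤ (1≤power x tw m) 1≤m))) ⟩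
  (1000 * (X * m + 8 * (X * m))) ^ K ≡⟨ cong (_^ K) (sym (*-assoc 1000 9 (X * m))) ⟩
  (9000 * (X * m)) ^ K             ≡⟨ ^-distribʳ-* K 9000 (X * m) ⟩
  9000 ^ K * (X * m) ^ K           ≡⟨ cong (9000 ^ K *_) (^-distribʳ-* K X m) ⟩
  9000 ^ K * (X ^ K * m ^ K)       ≤⟨ *-mono-≤ (m≤m+n (9000 ^ K) (8 * K)) (*-mono-≤ powers (^-mono-exponent 1≤m K≤c)) ⟩
  c * ((1 ⊔ x) ^ (c * tw) * m ^ c) ∎
  where
  open ≤-Reasoning
  X = (1 ⊔ x) ^ (8 * tw)
  c = timeConstant K
  8K≤c : 8 * K ≤ c
  8K≤c = m≤n+m (8 * K) (9000 ^ K)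
  K≤c : K ≤ c
  K≤c = ≤-trans (m≤n*m K 8) 8K≤c
  powers : X ^ K ≤ (1 ⊔ x) ^ (c * tw)
  powers = begin
    X ^ K                        ≡⟨ ^-*-assoc (1 ⊔ x) (8 * tw) K ⟩
    (1 ⊔ x) ^ (8 * tw * K)       ≤⟨ ^-mono-exponent (m≤m⊔n 1 x) (≤-trans (≤-reflexive (rearrange tw K)) (*-monoˡ-≤ tw 8K≤c)) ⟩
    (1 ⊔ x) ^ (c * tw)           ∎
    where
    open +-*-Solver
    rearrange : ∀ t k → 8 * t * k ≡ 8 * k * t
    rearrange = solve 2 (λ t k → con 8 :* t :* k := con 8 :* k :* t) refl

-- Execution of the whole program and choice of the bounds

module Run (S B : ℕ) (large : 1000 * suc S ≤ B) {n} (G : WeightedGraph n) (D : TreeDecomposition G)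
           (n≤S : n ≤ S) (degree≤S : ∀ v → rowDegree (WeightedGraph.weight G v) ≤ S) where

  open WeightedGraph G using (weight)
  open TreeDecomposition D using (tree)
  open Bounded S B large

  run-greedy : allSmall weight ≡ true →
    encodeInstance G D ∷ [] ⊢ minStableCut ↓ encodeCut (greedy weight) ∣ 1 · 18
  run-greedy small = norm {k = 17} (case-inr↓
    (result↓ (cong encodeBool small)
      (call↓ (small↓ weight n≤S degree≤S) (fst↓ var↓)))
    (call↓ (greedy↓ weight n≤S degree≤S) (fst↓ var↓)))

  lefts-matrix↓ : ∀ {C} → Computes (leftsF {`Row} {C}) (encodeMatrix weight) (vec {n = n} λ _ → inl tt) 3
  lefts-matrix↓ {C} = subst (λ vs → Computes (leftsF {`Row} {C}) (encodeMatrix weight) (list vs) 3)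
    (map-tabulate (encodeRow ∘ weight) (λ _ → inl tt)) (lefts↓ _ (vec-length _ n≤S))

  run-solve : ∀ {P A} → 1 ≤ S → allSmall weight ≡ false →
    (∀ P → total weight P ≤ S) → (∀ σ P v → key weight σ P v ≤ S) →
    Narrow weight (nobody G) → Everyᶠ (Narrow weight) (tree ∷ []) → forestSize (tree ∷ []) ≤ S →
    table G D ≡ P ∷ A →
    encodeInstance G D ∷ [] ⊢ minStableCut ↓ encodeCut (fromMaybe false ∘ P) ∣ 1 · 18
  run-solve {P} {A} 1≤S small total≤S key≤S narrow narrows tree≤S eq = norm {k = 17} (case-inl↓
    (result↓ (cong encodeBool small)
      (call↓ (small↓ weight n≤S degree≤S) (fst↓ var↓)))
    (call↓ (first↓ P A n≤S) (result↓ (cong encodeTable eq)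
      (call↓ (solve↓ weight n≤S degree≤S total≤S key≤S (nobody G) (blank G ∷ []) (tree ∷ []) narrow narrows 1≤S tree≤S)
        (pair↓ (fst↓ var↓) (pair↓ (call↓ lefts-matrix↓ (fst↓ var↓))
          (pair↓ (cons↓ (call↓ lefts-matrix↓ (fst↓ var↓)) nil↓) (cons↓ (snd↓ var↓) nil↓))))))))

module _ {n} (G : WeightedGraph n) (D : TreeDecomposition G) where

  open WeightedGraph G
  open TreeDecomposition D using (width; tree) renaming (size to N)

  private
    x = maxDegree * maxWeight
    m = n + N

  Solved : ℕ → Set
  Solved t = Σ[ C ∈ Cut n ] Σ[ time ∈ ℕ ]
    (IsMinStableCut G C × minStableCut on encodeInstance G D returns encodeCut C inTime time × time ≤ t)

  certified : ∀ {S B large C k} → IsMinStableCut G C →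
    Bounded._⊢_↓_∣_·_ S B large (encodeInstance G D ∷ []) minStableCut (encodeCut C) 1 k → Solved (1 * B ^ k)
  certified {C = C} least (Bounded.within {time} derivation bound) = C , time , least , derivation , bound

  solved-greedy : ∀ {S B} → 1000 * suc S ≤ B → n ≤ S → 1 ≤ S → allSmall weight ≡ true → Solved (1 * B ^ 18)
  solved-greedy {S} {B} large n≤S 1≤S small = certified (greedy-minimum G small)
    (Run.run-greedy S B large G D n≤S (λ v → ≤-trans (≤ᵇ-sound (allᵇ-sound _ small v)) 1≤S) small)

  record Sufficient (S : ℕ) : Set where
    field
      n≤S       : n ≤ S
      1≤S       : 1 ≤ S
      N≤S       : N ≤ S
      degree≤S  : x ≤ S
      total≤S   : n * x ≤ S
      key≤S     : 2 + (x + x) ≤ S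
      -- Key entries are at most 2 + 2x, and digits must be strictly below the radix.
      radix^≤S  : ∀ {k} → k ≤ suc width → (3 + (x + x)) ^ k ≤ S

  solved-dp : ∀ {S B} → 1000 * suc S ≤ B → Sufficient S → allSmall weight ≡ false → Solved (1 * B ^ 18)
  solved-dp {S} {B} large enough notSmall = certified (proj₂ (proj₂ (table-minimum G D))) run
    where
    open Sufficient enough
    narrow : ∀ {σ} → count σ ≤ suc width → Bounded.Narrow S B large weight σ
    narrow {σ} σ≤ = record
      { initial≤S = ≤-trans (≤-reflexive (length-initial σ))
          (≤-trans (^-monoˡ-≤ (count σ) (m≤m+n 2 (1 + (x + x)))) (radix^≤S σ≤))
      ; join≤S    = λ P A R R′ → ≤-trans
          (distinct-length weight (λ P v → s≤s (key≤ weight (rowDegree≤ G) σ P v))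
            (mergeInto-distinct weight σ P _ R′ (join-distinct weight σ A R)))
          (radix^≤S σ≤)
      }
    run = Run.run-solve S B large G D n≤S (λ v → ≤-trans (rowDegree≤ G v) degree≤S) 1≤S notSmall
      (λ P → ≤-trans (total≤ weight symmetric irreflexive P) (≤-trans (sum-bounded _ (rowDegree≤ G)) total≤S))
      (λ σ P v → ≤-trans (key≤ weight (rowDegree≤ G) σ P v) key≤S)
      (narrow (subst (_≤ suc width) (sym (sum-replicate-zero n)) z≤n))
      (all-every G D (tree ∷ []) (All.map (λ {s} h → narrow (subst (_≤ suc width) (sym (count≡∣∣ s)) h))
        (subst (All _) (sym (++-identityʳ _)) (bags G D))))
      (subst (_≤ S) (cong length (sym (++-identityʳ (labels tree)))) N≤S)
      (proj₁ (proj₂ (table-minimum G D)))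

  1≤m : 1 ≤ m
  1≤m = ≤-trans 1≤N (m≤n+m N n)
    where
    1≤N : 1 ≤ N
    1≤N with tree
    ... | node s ts = s≤s z≤n

  sufficient : allSmall weight ≡ false → Sufficient (sizeBound x width m)
  sufficient notSmall = record
    { n≤S      = ≤size x width m (m≤m+n n N)
    ; 1≤S      = ≤size x width m 1≤m
    ; N≤S      = ≤size x width m (m≤n+m N n)
    ; degree≤S = ≤power⇒≤size x width m 2≤x 1≤width 1≤m x≤X
    ; total≤S  = ≤-trans (≤-reflexive (*-comm n x)) (power*≤size x width m x≤X (m≤m+n n N))
    ; key≤S    = key-bound x width m 2≤x 1≤width 1≤m
    ; radix^≤S = table-bound x width m 2≤x 1≤width 1≤m
    }
    where
    someLarge : Σ[ v ∈ Fin n ] 2 ≤ rowDegree (weight v)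
    someLarge with any? (λ v → 2 ≤? rowDegree (weight v))
    ... | yes h = h
    ... | no  h = contradiction (trans (sym notSmall) (allᵇ-complete _ λ v → ≤ᵇ-complete (s≤s⁻¹ (≰⇒> λ p → h (v , p))))) false≢true
    2≤x : 2 ≤ x
    2≤x = ≤-trans (proj₂ someLarge) (rowDegree≤ G (proj₁ someLarge))
    1≤width : 1 ≤ width
    1≤width = width-positive G D (proj₁ someLarge) (≤-trans (s≤s z≤n) (proj₂ someLarge))
    x≤X : x ≤ (1 ⊔ x) ^ (8 * width)
    x≤X = power≥ x width m 2≤x 1≤width 1≤m

  solved : ∀ {S B} → 1000 * suc S ≤ B → n ≤ S → 1 ≤ S → (allSmall weight ≡ false → Sufficient S) → Solved (1 * B ^ 18)
  solved large n≤S 1≤S enough =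
    [ solved-greedy large n≤S 1≤S , (λ notSmall → solved-dp large (enough notSmall) notSmall) ]′ (bool-cases (allSmall weight))

  solved-weaken : ∀ {t t′} → t ≤ t′ → Solved t → Solved t′
  solved-weaken t≤t′ (C , time , least , run , time≤) = C , time , least , run , ≤-trans time≤ t≤t′

  SolvedAt : ℕ → Set
  SolvedAt K = ∀ {S B} → 1000 * suc S ≤ B → n ≤ S → 1 ≤ S → (allSmall weight ≡ false → Sufficient S) → Solved (1 * B ^ K)

  solved-within : ∀ K → SolvedAt K → Solved (timeConstant K * ((1 ⊔ x) ^ (timeConstant K * width) * m ^ timeConstant K))
  solved-within K solve = solved-weaken
    (≤-trans (≤-reflexive (*-identityˡ ((1000 * suc (sizeBound x width m)) ^ K))) (size-power K x width m 1≤m))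
    (solve {S = sizeBound x width m} {B = 1000 * suc (sizeBound x width m)} ≤-refl
      (≤size x width m (m≤m+n n N)) (≤size x width m 1≤m) sufficient)

-- Stated for a variable K, so that the constant is never evaluated.
uniform : ∀ K → (∀ {n} (G : WeightedGraph n) D → SolvedAt G D K) →
  Σ[ c ∈ ℕ ] (∀ n (G : WeightedGraph n) (D : TreeDecomposition G) →
    let x = WeightedGraph.maxDegree G * WeightedGraph.maxWeight G
    in Solved G D (c * ((1 ⊔ x) ^ (c * TreeDecomposition.width D) * (n + TreeDecomposition.size D) ^ c)))
uniform K solve = timeConstant K , λ n G D → solved-within G D K (solve G D)

theorem5 :
    Σ[ p ∈ Program `Instance `Cut ] Σ[ c ∈ ℕ ]
      (∀ (n : ℕ) (G : WeightedGraph n) (D : TreeDecomposition G) →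
        let Δ  = WeightedGraph.maxDegree G
            W  = WeightedGraph.maxWeight G
            tw = TreeDecomposition.width D
            N  = TreeDecomposition.size D
        in Σ[ C ∈ Cut n ] Σ[ time ∈ ℕ ]
             ( IsMinStableCut G C
             × p on encodeInstance G D returns encodeCut C inTime time
             × time ≤ c * ((1 ⊔ Δ * W) ^ (c * tw) * (n + N) ^ c)))
-- The exponent 18: a join costs `B ^ 16`, running over the tree adds one exponent, and normalising
-- the main program adds another.
theorem5 = minStableCut , uniform 18 solved
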